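{- Let $q$ be an odd prime power and $n\ge2$ with $(q^n-1)/2$ even. Let $\beta\in\mathbb{F}_q^*$, let $m$ be an even divisor of $q^n-1$, let $Q=(q^n-1)/(q-1)$, and let $m_Q$ be the product of those primes dividing $m$ that also divide $Q$. Then $$\mathcal{N}_\beta(m)\ \ge\ \theta(m)\,q^{\frac{n-1}{2}}\Big\{q^{\frac{n-1}{2}}-4W(m)+2W(m_Q)+1\Big\}.$$
   Context: For a divisor $m$ of $q^n-1$, an element $\xi\in\mathbb{F}_{q^n}^*$ is $m$-free if $\xi=\zeta^d$ with $d\mid m$ and $\zeta\in\mathbb{F}_{q^n}^*$ implies $d=1$. For $\beta\in\mathbb{F}_q$, $\mathcal{N}_\beta(m)$ denotes the number of $m$-free $\xi\in\mathbb{F}_{q^n}^*$ with $\mathrm{Tr}(\xi^2)=\beta$, where $\mathrm{Tr}(\xi)=\sum_{i=0}^{n-1}\xi^{q^i}$. $\theta(m)=\phi(m)/m$ with $\phi$ Euler's function, and $W(t)$ is the number of square-free divisors of $t$. -}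

module Defs where

open import Level using (Level; _⊔_) renaming (suc to lsuc)
open import Algebra.Bundles using (CommutativeRing)
open import Data.Nat as ℕ using (ℕ; zero; suc; NonZero)
open import Data.Nat.Properties as ℕP using ()
open import Data.Nat.Divisibility using (_∣_; _∣?_; ∣⇒≤; _∣0)
open import Data.Nat.Coprimality using (coprime?)
open import Data.Nat.Primality using (Prime; prime?; prime⇒nonZero; prime[2])
open import Data.Integer as ℤ using (ℤ)
open import Data.Fin using (Fin; toℕ; fromℕ<)
open import Data.Fin.Properties using (all?; toℕ-fromℕ<)
open import Data.List using (List; length; filter; upTo; allFin; map)
open import Data.Nat.ListAction using (product)
open import Data.Product using (Σ; ∃; _×_; _,_; proj₁; proj₂)
open import Data.Sum using (_⊎_)
open import Relation.Nullary using (¬_; Dec; yes; no)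
open import Relation.Nullary.Decidable using (map′; _×-dec_; _→-dec_; ¬?)
open import Relation.Binary using (Decidable)
open import Relation.Binary.PropositionalEquality as P using (_≡_)

record FiniteField (c ℓ : Level) : Set (lsuc (c ⊔ ℓ)) where
  field
    cring    : CommutativeRing c ℓ
  open CommutativeRing cring public
  field
    _≟_      : Decidable _≈_
    0≉1      : ¬ (0# ≈ 1#)
    inverse  : ∀ x → ¬ (x ≈ 0#) → ∃ λ y → x * y ≈ 1#
    size     : ℕ
    enum     : Fin size → Carrier
    enum-surj : ∀ x → ∃ λ i → enum i ≈ x
    enum-inj  : ∀ i j → enum i ≈ enum j → i ≡ j

  pow : Carrier → ℕ → Carrier
  pow x zero    = 1#
  pow x (suc k) = x * pow x k

  pow-cong : ∀ {x y} k → x ≈ y → pow x k ≈ pow y k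
  pow-cong zero    e = refl
  pow-cong (suc k) e = *-cong e (pow-cong k e)

  -- the prime subfield-type subfield F_q of F_{q^n}: fixed points of x ↦ x^q
  InSubfield : ℕ → Carrier → Set ℓ
  InSubfield q x = pow x q ≈ x

  Tr : ℕ → ℕ → Carrier → Carrier
  Tr q zero    x = 0#
  Tr q (suc i) x = Tr q i x + pow x (q ℕ.^ i)

  IsFree : ℕ → Carrier → Set (c ⊔ ℓ)
  IsFree m ξ = ∀ (d : ℕ) (ζ : Carrier) → d ∣ m → ¬ (ζ ≈ 0#) → ξ ≈ pow ζ d → d ≡ 1

  private
    Bounded : ℕ → Carrier → Set ℓ
    Bounded m ξ = ∀ (d : Fin (suc m)) (j : Fin size) →
      toℕ d ∣ m → ¬ (enum j ≈ 0#) → ξ ≈ pow (enum j) (toℕ d) → toℕ d ≡ 1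

    bounded? : ∀ m ξ → Dec (Bounded m ξ)
    bounded? m ξ = all? λ d → all? λ j →
      (toℕ d ∣? m) →-dec (¬? (enum j ≟ 0#)) →-dec (ξ ≟ pow (enum j) (toℕ d))
        →-dec (toℕ d ℕ.≟ 1)

    from : ∀ m .{{_ : NonZero m}} ξ → Bounded m ξ → IsFree m ξ
    from m ξ B d ζ d∣m ζ≉0 ξ≈ with enum-surj ζ
    ... | j , ej≈ζ =
      let lt = ℕ.s≤s (∣⇒≤ d∣m)
          fd = fromℕ< {d} {suc m} lt
          eq = toℕ-fromℕ< lt
          r  = B fd j (P.subst (_∣ m) (P.sym eq) d∣m)
                 (λ ej≈0 → ζ≉0 (trans (sym ej≈ζ) ej≈0))
                 (P.subst (λ k → ξ ≈ pow (enum j) k) (P.sym eq)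
                    (trans ξ≈ (pow-cong d (sym ej≈ζ))))
      in P.subst (_≡ 1) eq r

    to : ∀ m ξ → IsFree m ξ → Bounded m ξ
    to m ξ F d j = F (toℕ d) (enum j)

  isFree? : ∀ m .{{_ : NonZero m}} ξ → Dec (IsFree m ξ)
  isFree? m ξ = map′ (from m ξ) (to m ξ) (bounded? m ξ)

  Nβ : (q n : ℕ) → Carrier → (m : ℕ) → .{{_ : NonZero m}} → ℕ
  Nβ q n β m = length (filter
    (λ i → ¬? (enum i ≟ 0#) ×-dec isFree? m (enum i)
             ×-dec (Tr q n (enum i * enum i) ≟ β))
    (allFin size))

open import Data.Nat.Base using (_*_; _+_; _∸_; _^_)

φ : ℕ → ℕ
φ m = length (filter (λ k → coprime? k m) (map suc (upTo m)))

SquareFree : ℕ → Set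
SquareFree d = ∀ p → Prime p → ¬ (p * p ∣ d)

private
  BSF : ℕ → Set
  BSF d = ∀ (p : Fin (suc d)) → Prime (toℕ p) → ¬ (toℕ p * toℕ p ∣ d)

  sq≥ : ∀ p → NonZero p → p ℕ.≤ p * p
  sq≥ (suc p) _ = ℕP.m≤m*n (suc p) (suc p)

squareFree? : ∀ d → Dec (SquareFree d)
squareFree? zero = no λ sf → sf 2 prime[2] ((2 * 2) ∣0)
squareFree? d@(suc d′) = map′ fromB toB (all? λ p → prime? (toℕ p) →-dec ¬? (toℕ p * toℕ p ∣? d))
  where
  fromB : BSF d → SquareFree d
  fromB B p pp pp∣d =
    let instance _ = prime⇒nonZero pp
        lt = ℕ.s≤s (ℕP.≤-trans (sq≥ p (prime⇒nonZero pp)) (∣⇒≤ pp∣d))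
        eq = toℕ-fromℕ< lt
    in B (fromℕ< lt) (P.subst Prime (P.sym eq) pp) (P.subst (λ k → k * k ∣ d) (P.sym eq) pp∣d)
  toB : SquareFree d → BSF d
  toB sf p = sf (toℕ p)

W : ℕ → ℕ
W t = length (filter (λ d → (d ∣? t) ×-dec squareFree? d) (map suc (upTo t)))

radicalPart : (m Q : ℕ) → ℕ
radicalPart m Q = product (filter (λ p → prime? p ×-dec (p ∣? m) ×-dec (p ∣? Q)) (upTo (suc m)))

-- Comparison with a square root, for integers: b · √r ≤ a  (r ≥ 0 real root)
-- If b ≤ 0 the left side is ≤ 0: holds iff a ≥ 0 or a² ≤ b² r.
-- If b ≥ 0: holds iff a ≥ 0 and b² r ≤ a².
_*√_≤_ : ℤ → ℕ → ℤ → Set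
b *√ r ≤ a =
  (b ℤ.≤ ℤ.0ℤ × (ℤ.0ℤ ℤ.≤ a ⊎ a ℤ.* a ℤ.≤ b ℤ.* b ℤ.* ℤ.+ r))
  ⊎ (ℤ.0ℤ ℤ.≤ b × ℤ.0ℤ ℤ.≤ a × b ℤ.* b ℤ.* ℤ.+ r ℤ.≤ a ℤ.* a)

-- Write S_β = {ξ : Tr(ξ²) = β} and, for a squarefree d | qⁿ-1, let c_d be the sum of the
-- characters of exact order d; it takes the integer values ∏_{l | d} (l [ξ is an l-th power] - 1),
-- so no complex numbers are needed.  Up to the factor θ(m), the indicator of m-freeness is
-- Σ_{d | m} μ(d) c_d / φ(d), and everything reduces to
--   |Σ_{ξ ∈ S_β} c_d(ξ)| ≤ 2 φ(d) q^{(n-1)/2}  (d > 1)   and   ||S_β| - q^{n-1}| ≤ q^{(n-1)/2}.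
-- Instead of Gauss sums, use a second moment.  With F_b(z) = Σ_{Tr(z u²) = b} c_d(u), the identity
-- Σ_w c_d(w) c_d(wu) = (qⁿ-1) c_d(u) expresses F_β(1) through the values F_β(w⁻²), so that
-- Cauchy-Schwarz bounds F_β(1)² by Σ_z F_β(z)².  That sum is the same for all β in F_q^*, and
-- summed over all β in F_q it counts the z with Tr(z (u² - v²)) = 0, where only the pairs with
-- u² = v² survive because Σ c_d = 0.  The bound for |S_β| is the same argument with u in place
-- of u², applied to the quadratic character c_2, since |S_β| = Σ_{Tr(y) = β} (1 + c_2(y)).
-- This yields 2 W(m) - 1 in place of 4 W(m) - 2 W(m_Q) - 1, which is at least as strong.
module Submission where

open import Defs
open import Algebra.Bundles using (CommutativeRing)
open import Algebra.Structures using (IsCommutativeRing)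
open import Data.Empty using (⊥; ⊥-elim)
open import Data.Fin as Fin using (Fin; zero; suc)
import Data.Fin.Properties as FinP
open import Data.Integer as ℤ using (ℤ; +_; 0ℤ; 1ℤ)
import Data.Integer.Properties as ℤP
open import Data.Integer.Tactic.RingSolver using (solve-∀)
open import Data.List.Base using (List; []; _∷_; _++_; length; filter; tabulate; map; upTo; applyUpTo)
open import Data.List.Membership.Propositional using (_∈_)
open import Data.List.Membership.Propositional.Properties
  using (∈-map⁺; ∈-map⁻; ∈-filter⁺; ∈-filter⁻; ∈-upTo⁺; ∈-++⁻; ∈-++⁺ˡ; ∈-++⁺ʳ; ∈-∃++)
import Data.List.Properties as ListP
open import Data.List.Relation.Unary.All as All using (All; []; _∷_)
import Data.List.Relation.Unary.All.Properties as AllP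
open import Data.List.Relation.Unary.AllPairs using ([]; _∷_)
open import Data.List.Relation.Unary.Any using (here; there)
open import Data.List.Relation.Unary.Unique.Propositional using (Unique)
import Data.List.Relation.Unary.Unique.Propositional.Properties as UniqueP
open import Data.Nat as ℕ using (ℕ; zero; suc; NonZero)
open import Data.Nat.Combinatorics using (_C_; nCn≡1; nCk≡n!/k![n-k]!; k![n∸k]!∣n!)
open import Data.Nat.Coprimality using (Coprime; coprime?; coprime-Bézout; coprime-divisor)
open import Data.Nat.Divisibility
  using (_∣_; divides; _∣?_; ∣-refl; ∣-trans; ∣⇒≤; >⇒∤; ∣1⇒≡1; 0∣⇒≡0; m∣m*n; n∣m*n; ∣n⇒∣m*n; ∣m∣n⇒∣m+n; ∣m+n∣m⇒∣n; *-monoʳ-∣; *-cancelˡ-∣)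
open import Data.Nat.DivMod using (m/n*n≡m)
open import Data.Nat.GCD using (module Bézout)
open import Data.Nat.ListAction using (product)
open import Data.Nat.Primality
  using (Prime; prime?; prime[2]; euclidsLemma; prime⇒nonZero; prime⇒nonTrivial; prime⇒irreducible)
open import Data.Nat.Primality.Factorisation using (factorise; factorisationHasAllPrimeFactors)
import Data.Nat.Properties as ℕP
open import Data.Product using (∃; ∃₂; _×_; _,_; proj₁; proj₂)
open import Data.Sum using (_⊎_; inj₁; inj₂)
open import Data.Unit.Base using (⊤; tt)
open import Function.Base using (_∘_; id)
import Level
open import Relation.Binary.PropositionalEquality
open import Relation.Nullary using (¬_; Dec; yes; no)
open import Relation.Nullary.Decidable using (_×-dec_; ¬?)
open import Relation.Unary using (Pred; Decidable)

-- Two obstacles shape the argument. The bound q^((n-1)/2) can be irrational, so |a| ≤ b√r is kept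
-- as a² ≤ b²r with b ≥ 0; this form survives addition, scaling and cancellation of a positive
-- factor, which is all that the expansion over d asks for. And characters are replaced by counts of
-- powers. These counts come from Fermat's theorem and the bound k on the roots of a polynomial of
-- degree k: xˡ = 1 has exactly l solutions for l | qⁿ-1, and F_q and the fibres of the trace have
-- their full sizes. The convolution identity passes from prime d to products because the cosets of
-- d-th and of l-th powers are independent for coprime d and l. The factor 2 is the size of a fibre
-- of squaring. It enters the squared estimate twice, through the pairs with u² = v² and through the
-- map w ↦ w⁻², hence once after the square root. The expansion over r primes has 2^r terms, each
-- with relative error 2 except the trivial one with error 1; this is the origin of 2 W(m) - 1.

-- Integer inequalities and bounds |a| ≤ b√r

module IntegerInequalities where
  open import Data.Integer using (_+_; _*_; _-_; -_; _≤_; _<_)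

  *-nonneg : ∀ {a b} → 0ℤ ≤ a → 0ℤ ≤ b → 0ℤ ≤ a * b
  *-nonneg {+ a} {+ b} _ _ = subst (0ℤ ≤_) (ℤP.pos-* a b) (ℤ.+≤+ ℕ.z≤n)

  *-mono-≤ : ∀ {a b c d} → 0ℤ ≤ a → 0ℤ ≤ d → a ≤ b → c ≤ d → a * c ≤ b * d
  *-mono-≤ {a} {b} {c} {d} 0≤a 0≤d a≤b c≤d = ℤP.≤-trans
    (ℤP.*-monoˡ-≤-nonNeg a {{ℤ.nonNegative 0≤a}} c≤d)
    (ℤP.*-monoʳ-≤-nonNeg d {{ℤ.nonNegative 0≤d}} a≤b)

  *-monoˡ-≤ : ∀ {a b} c → 0ℤ ≤ c → a ≤ b → c * a ≤ c * b
  *-monoˡ-≤ c 0≤c = ℤP.*-monoˡ-≤-nonNeg c {{ℤ.nonNegative 0≤c}}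

  +-nonneg : ∀ {a b} → 0ℤ ≤ a → 0ℤ ≤ b → 0ℤ ≤ a + b
  +-nonneg = ℤP.+-mono-≤

  square-nonneg : ∀ a → 0ℤ ≤ a * a
  square-nonneg (+ a)        = *-nonneg {+ a} {+ a} (ℤ.+≤+ ℕ.z≤n) (ℤ.+≤+ ℕ.z≤n)
  square-nonneg ℤ.-[1+ a ] = ℤ.+≤+ ℕ.z≤n

  square-cancel-≤ : ∀ {x y} → 0ℤ ≤ y → x * x ≤ y * y → x ≤ y
  square-cancel-≤ {x} {y} 0≤y sq with x ℤP.≤? y
  ... | yes x≤y = x≤y
  ... | no  x≰y = ⊥-elim (ℤP.<-irrefl refl (ℤP.<-≤-trans y²<x² sq))
    where
    y<x = ℤP.≰⇒> x≰y
    y²<x² : y * y < x * x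
    y²<x² = ℤP.≤-<-trans
      (ℤP.*-monoˡ-≤-nonNeg y {{ℤ.nonNegative 0≤y}} (ℤP.<⇒≤ y<x))
      (ℤP.*-monoʳ-<-pos x {{ℤ.positive (ℤP.≤-<-trans 0≤y y<x)}} y<x)

  *-cancelˡ-≤ : ∀ {a b} c → 0ℤ < c → c * a ≤ c * b → a ≤ b
  *-cancelˡ-≤ {a} {b} c 0<c = ℤP.*-cancelˡ-≤-pos a b c {{ℤ.positive 0<c}}

  -- (2x)² ≤ 4AB ≤ (A + B)²
  2*-bound : ∀ {x A B} → 0ℤ ≤ A → 0ℤ ≤ B → x * x ≤ A * B → + 2 * x ≤ A + B
  2*-bound {x} {A} {B} 0≤A 0≤B x²≤AB = square-cancel-≤ (+-nonneg 0≤A 0≤B) (begin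
    (+ 2 * x) * (+ 2 * x)               ≡⟨ p x ⟩
    + 4 * (x * x)                       ≤⟨ *-monoˡ-≤ (+ 4) (ℤ.+≤+ ℕ.z≤n) x²≤AB ⟩
    + 4 * (A * B)                       ≡⟨ ℤP.+-identityʳ _ ⟨
    + 4 * (A * B) + 0ℤ                  ≤⟨ ℤP.+-monoʳ-≤ (+ 4 * (A * B)) (square-nonneg (A - B)) ⟩
    + 4 * (A * B) + (A - B) * (A - B)   ≡⟨ r A B ⟩
    (A + B) * (A + B)                   ∎)
    where
    open ℤP.≤-Reasoning
    p : ∀ x → (+ 2 * x) * (+ 2 * x) ≡ + 4 * (x * x)
    p = solve-∀
    r : ∀ A B → + 4 * (A * B) + (A - B) * (A - B) ≡ (A + B) * (A + B)
    r = solve-∀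

  -- a ∣≤ b √ r stands for |a| ≤ b √r with b ≥ 0.
  record _∣≤_√_ (a b r : ℤ) : Set where
    constructor sqrt-bound
    field
      0≤scale  : 0ℤ ≤ b
      sq≤      : a * a ≤ b * b * r
  open _∣≤_√_ public

  infix 4 _∣≤_√_

  -- Only the cross term needs care: (aa′)² ≤ (bb′r)² is the product of the two hypotheses, and bb′r
  -- ≥ 0 allows the squares to be dropped.
  √-+ : ∀ {a a′ b b′ r} → 0ℤ ≤ r → a ∣≤ b √ r → a′ ∣≤ b′ √ r → a + a′ ∣≤ b + b′ √ r
  √-+ {a} {a′} {b} {b′} {r} 0≤r (sqrt-bound 0≤b h) (sqrt-bound 0≤b′ h′) =
    sqrt-bound (+-nonneg 0≤b 0≤b′) (begin
      (a + a′) * (a + a′)                       ≡⟨ p a a′ ⟩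
      a * a + a′ * a′ + + 2 * (a * a′)
        ≤⟨ ℤP.+-mono-≤ (ℤP.+-mono-≤ h h′) (*-monoˡ-≤ (+ 2) (ℤ.+≤+ ℕ.z≤n) aa′≤) ⟩
      b * b * r + b′ * b′ * r + + 2 * (b * b′ * r)   ≡⟨ s b b′ r ⟩
      (b + b′) * (b + b′) * r                   ∎)
    where
    open ℤP.≤-Reasoning
    p : ∀ a b → (a + b) * (a + b) ≡ a * a + b * b + + 2 * (a * b)
    p = solve-∀
    s : ∀ b c r → b * b * r + c * c * r + + 2 * (b * c * r) ≡ (b + c) * (b + c) * r
    s = solve-∀
    t : ∀ a b → a * b * (a * b) ≡ (a * a) * (b * b)
    t = solve-∀
    u : ∀ b c r → (b * b * r) * (c * c * r) ≡ b * c * r * (b * c * r)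
    u = solve-∀
    aa′≤ : a * a′ ≤ b * b′ * r
    aa′≤ = square-cancel-≤ (*-nonneg (*-nonneg 0≤b 0≤b′) 0≤r) (begin
      a * a′ * (a * a′)                 ≡⟨ t a a′ ⟩
      (a * a) * (a′ * a′)               ≤⟨ *-mono-≤ (square-nonneg a) (*-nonneg (square-nonneg b′) 0≤r) h h′ ⟩
      (b * b * r) * (b′ * b′ * r)       ≡⟨ u b b′ r ⟩
      b * b′ * r * (b * b′ * r)         ∎)

  √-* : ∀ {a b r} c → 0ℤ ≤ c → a ∣≤ b √ r → c * a ∣≤ c * b √ r
  √-* {a} {b} {r} c 0≤c (sqrt-bound 0≤b h) = sqrt-bound (*-nonneg 0≤c 0≤b) (begin
    c * a * (c * a)       ≡⟨ p c a ⟩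
    c * c * (a * a)       ≤⟨ *-monoˡ-≤ (c * c) (square-nonneg c) h ⟩
    c * c * (b * b * r)   ≡⟨ s c b r ⟩
    c * b * (c * b) * r   ∎)
    where
    open ℤP.≤-Reasoning
    p : ∀ c a → c * a * (c * a) ≡ c * c * (a * a)
    p = solve-∀
    s : ∀ c b r → c * c * (b * b * r) ≡ c * b * (c * b) * r
    s = solve-∀

  √-neg : ∀ {a b r} → a ∣≤ b √ r → - a ∣≤ b √ r
  √-neg {a} {b} {r} (sqrt-bound 0≤b h) = sqrt-bound 0≤b (subst (_≤ b * b * r) (p a) h)
    where
    p : ∀ a → a * a ≡ - a * - a
    p = solve-∀

  √-cancel : ∀ {a b r} c → 0ℤ < c → 0ℤ ≤ b → c * a ∣≤ c * b √ r → a ∣≤ b √ r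
  √-cancel {a} {b} {r} c 0<c 0≤b (sqrt-bound _ h) =
    sqrt-bound 0≤b (*-cancelˡ-≤ (c * c) 0<c² (begin
    c * c * (a * a)       ≡⟨ p c a ⟨
    c * a * (c * a)       ≤⟨ h ⟩
    c * b * (c * b) * r   ≡⟨ s c b r ⟨
    c * c * (b * b * r)   ∎))
    where
    open ℤP.≤-Reasoning
    p : ∀ c a → c * a * (c * a) ≡ c * c * (a * a)
    p = solve-∀
    s : ∀ c b r → c * c * (b * b * r) ≡ c * b * (c * b) * r
    s = solve-∀
    0<c² : 0ℤ < c * c
    0<c² = ℤP.*-monoʳ-<-pos c {{ℤ.positive 0<c}} 0<c

  √-mono : ∀ {a b b′ r} → 0ℤ ≤ r → b ≤ b′ → a ∣≤ b √ r → a ∣≤ b′ √ r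
  √-mono 0≤r b≤b′ (sqrt-bound 0≤b h) = sqrt-bound 0≤b′
    (ℤP.≤-trans h (*-mono-≤ (*-nonneg 0≤b 0≤b) 0≤r (*-mono-≤ 0≤b 0≤b′ b≤b′ b≤b′) ℤP.≤-refl))
    where 0≤b′ = ℤP.≤-trans 0≤b b≤b′

-- Integer-valued indicators of decidable statements

module Indicators where
  open import Data.Integer using (_*_; _-_; -_; _≤_)

  private variable
    ℓ ℓ′ : Level.Level
    A : Set ℓ
    B : Set ℓ′

  ⟦_⟧ : Dec A → ℤ
  ⟦ yes _ ⟧ = 1ℤ
  ⟦ no  _ ⟧ = 0ℤ

  ⟦⟧-cong : (A → B) → (B → A) → (a : Dec A) (b : Dec B) → ⟦ a ⟧ ≡ ⟦ b ⟧
  ⟦⟧-cong f g (yes a) (yes b) = refl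
  ⟦⟧-cong f g (yes a) (no ¬b) = ⊥-elim (¬b (f a))
  ⟦⟧-cong f g (no ¬a) (yes b) = ⊥-elim (¬a (g b))
  ⟦⟧-cong f g (no ¬a) (no ¬b) = refl

  ⟦⟧-yes : (a : Dec A) → A → ⟦ a ⟧ ≡ 1ℤ
  ⟦⟧-yes (yes _) _ = refl
  ⟦⟧-yes (no ¬a) a = ⊥-elim (¬a a)

  ⟦⟧-no : (a : Dec A) → ¬ A → ⟦ a ⟧ ≡ 0ℤ
  ⟦⟧-no (yes a) ¬a = ⊥-elim (¬a a)
  ⟦⟧-no (no _) _ = refl

  0≤⟦⟧ : (a : Dec A) → 0ℤ ≤ ⟦ a ⟧
  0≤⟦⟧ (yes _) = ℤ.+≤+ ℕ.z≤n
  0≤⟦⟧ (no _)  = ℤ.+≤+ ℕ.z≤n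

  ⟦⟧≤1 : (a : Dec A) → ⟦ a ⟧ ≤ 1ℤ
  ⟦⟧≤1 (yes _) = ℤP.≤-refl
  ⟦⟧≤1 (no _)  = ℤ.+≤+ ℕ.z≤n

  ⟦⟧-mono : (A → B) → (a : Dec A) (b : Dec B) → ⟦ a ⟧ ≤ ⟦ b ⟧
  ⟦⟧-mono f (yes a) b = ℤP.≤-reflexive (sym (⟦⟧-yes b (f a)))
  ⟦⟧-mono f (no _)  b = 0≤⟦⟧ b

  ⟦⟧-× : (a : Dec A) (b : Dec B) → ⟦ a ×-dec b ⟧ ≡ ⟦ a ⟧ * ⟦ b ⟧
  ⟦⟧-× (yes _) (yes _) = refl
  ⟦⟧-× (yes _) (no _)  = refl
  ⟦⟧-× (no _)  b       = sym (ℤP.*-zeroˡ ⟦ b ⟧)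

  ⟦⟧-¬ : (a : Dec A) → ⟦ ¬? a ⟧ ≡ 1ℤ - ⟦ a ⟧
  ⟦⟧-¬ (yes _) = refl
  ⟦⟧-¬ (no _)  = refl

  ⟦⟧-idem : (a : Dec A) → ⟦ a ⟧ * ⟦ a ⟧ ≡ ⟦ a ⟧
  ⟦⟧-idem (yes _) = refl
  ⟦⟧-idem (no _)  = refl

  ⟦⟧-*-cong : (a : Dec A) {x y : ℤ} → (A → x ≡ y) → ⟦ a ⟧ * x ≡ ⟦ a ⟧ * y
  ⟦⟧-*-cong (yes a) e = cong (1ℤ *_) (e a)
  ⟦⟧-*-cong (no _)  {x} {y} _ = trans (ℤP.*-zeroˡ x) (sym (ℤP.*-zeroˡ y))

  ⟦⟧-*-mono : (a : Dec A) {x y : ℤ} → (A → x ≤ y) → ⟦ a ⟧ * x ≤ ⟦ a ⟧ * y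
  ⟦⟧-*-mono (yes a) {x} {y} e = IntegerInequalities.*-monoˡ-≤ 1ℤ (ℤ.+≤+ ℕ.z≤n) (e a)
  ⟦⟧-*-mono (no _)  {x} {y} _ = ℤP.≤-reflexive (trans (ℤP.*-zeroˡ x) (sym (ℤP.*-zeroˡ y)))

-- Finite integer sums and the Cauchy-Schwarz inequality

module Sums where
  open import Data.Integer using (_+_; _*_; _-_; -_; _≤_)
  open IntegerInequalities
  open Indicators
  open import Algebra.Properties.Semiring.Sum
    ℤP.+-*-semiring public
    using (sum; ∑-distrib-+; ∑-comm; *-distribˡ-sum; *-distribʳ-sum; ∑-permute; sum-replicate-zero)
    renaming (sum-cong-≗ to sum-cong)

  sum-mono : ∀ {n} {f g : Fin n → ℤ} → (∀ i → f i ≤ g i) → sum f ≤ sum g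
  sum-mono {zero}  h = ℤP.≤-refl
  sum-mono {suc n} h = ℤP.+-mono-≤ (h zero) (sum-mono (λ i → h (suc i)))

  sum-zero : ∀ {n} {f : Fin n → ℤ} → (∀ i → f i ≡ 0ℤ) → sum f ≡ 0ℤ
  sum-zero {n} h = trans (sum-cong h) (sum-replicate-zero n)

  sum-nonneg : ∀ {n} {f : Fin n → ℤ} → (∀ i → 0ℤ ≤ f i) → 0ℤ ≤ sum f
  sum-nonneg {zero}  h = ℤP.≤-refl
  sum-nonneg {suc n} h = +-nonneg (h zero) (sum-nonneg (λ i → h (suc i)))

  sum-δ : ∀ {n} (a : Fin n) (f : Fin n → ℤ) → sum (λ x → ⟦ x FinP.≟ a ⟧ * f x) ≡ f a
  sum-δ zero f = begin
    1ℤ * f zero + sum (λ x → ⟦ suc x FinP.≟ zero ⟧ * f (suc x))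
      ≡⟨ cong₂ _+_ (ℤP.*-identityˡ (f zero)) (sum-zero (λ x → ℤP.*-zeroˡ (f (suc x)))) ⟩
    f zero + 0ℤ  ≡⟨ ℤP.+-identityʳ (f zero) ⟩
    f zero       ∎
    where
    open ≡-Reasoning
  sum-δ (suc a) f = begin
    0ℤ * f zero + sum (λ x → ⟦ suc x FinP.≟ suc a ⟧ * f (suc x))
      ≡⟨ cong₂ _+_ (ℤP.*-zeroˡ (f zero)) (sum-cong (λ x → cong (_* f (suc x))
           (⟦⟧-cong FinP.suc-injective (cong suc) (suc x FinP.≟ suc a) (x FinP.≟ a)))) ⟩
    0ℤ + sum (λ x → ⟦ x FinP.≟ a ⟧ * f (suc x))  ≡⟨ ℤP.+-identityˡ _ ⟩
    sum (λ x → ⟦ x FinP.≟ a ⟧ * f (suc x))       ≡⟨ sum-δ a (λ x → f (suc x)) ⟩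
    f (suc a)                                    ∎
    where
    open ≡-Reasoning

  sum-neg : ∀ {n} (f : Fin n → ℤ) → sum (λ i → - f i) ≡ - sum f
  sum-neg {zero}  f = refl
  sum-neg {suc n} f = trans (cong (λ z → - f zero + z) (sum-neg (λ i → f (suc i))))
    (sym (ℤP.neg-distrib-+ (f zero) _))

  sum-- : ∀ {n} (f g : Fin n → ℤ) → sum (λ i → f i - g i) ≡ sum f - sum g
  sum-- f g = trans (∑-distrib-+ f (λ i → - g i)) (cong (λ z → sum f + z) (sum-neg g))

  sum-one : ∀ n → sum {n} (λ _ → 1ℤ) ≡ + n
  sum-one zero    = refl
  sum-one (suc n) = cong (λ z → 1ℤ + z) (sum-one n)

  sum-reindex : ∀ {n} (π π⁻¹ : Fin n → Fin n) → (∀ x → π (π⁻¹ x) ≡ x) → (∀ x → π⁻¹ (π x) ≡ x) →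
                (f : Fin n → ℤ) → sum (λ x → f (π x)) ≡ sum f
  sum-reindex π π⁻¹ r l f = sym (∑-permute f (permutation π π⁻¹ r l))
    where
    open import Data.Fin.Permutation using (permutation)

  -- Induction splitting off one term: the induction hypothesis S² ≤ AB gives (abS)² ≤ (a²B)(b²A),
  -- so `2*-bound` applies to the cross term 2abS.
  cauchy-schwarz : ∀ {n} (f g : Fin n → ℤ) →
    sum (λ i → f i * g i) * sum (λ i → f i * g i) ≤ sum (λ i → f i * f i) * sum (λ i → g i * g i)
  cauchy-schwarz {zero}  f g = ℤP.≤-refl
  cauchy-schwarz {suc n} f g = begin
    (a * b + S) * (a * b + S)                     ≡⟨ p a b S ⟩
    a * a * (b * b) + S * S + + 2 * (a * b * S)   ≤⟨ ℤP.+-mono-≤ (ℤP.+-monoʳ-≤ (a * a * (b * b)) IH) cross ⟩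
    a * a * (b * b) + A * B + (a * a * B + b * b * A)   ≡⟨ r (a * a) (b * b) A B ⟩
    (a * a + A) * (b * b + B)                     ∎
    where
    open ℤP.≤-Reasoning
    a = f zero ; b = g zero
    S = sum (λ i → f (suc i) * g (suc i))
    A = sum (λ i → f (suc i) * f (suc i))
    B = sum (λ i → g (suc i) * g (suc i))
    0≤A : 0ℤ ≤ A
    0≤A = sum-nonneg (λ i → square-nonneg (f (suc i)))
    0≤B : 0ℤ ≤ B
    0≤B = sum-nonneg (λ i → square-nonneg (g (suc i)))
    IH : S * S ≤ A * B
    IH = cauchy-schwarz (λ i → f (suc i)) (λ i → g (suc i))
    p : ∀ a b S → (a * b + S) * (a * b + S) ≡ a * a * (b * b) + S * S + + 2 * (a * b * S)
    p = solve-∀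
    r : ∀ a b A B → a * b + A * B + (a * B + b * A) ≡ (a + A) * (b + B)
    r = solve-∀
    s : ∀ a b S → a * b * S * (a * b * S) ≡ a * a * (b * b) * (S * S)
    s = solve-∀
    t : ∀ a b A B → a * b * (A * B) ≡ (a * B) * (b * A)
    t = solve-∀
    cross : + 2 * (a * b * S) ≤ a * a * B + b * b * A
    cross = 2*-bound (*-nonneg (square-nonneg a) 0≤B) (*-nonneg (square-nonneg b) 0≤A) (begin
      a * b * S * (a * b * S)       ≡⟨ s a b S ⟩
      a * a * (b * b) * (S * S)     ≤⟨ *-monoˡ-≤ (a * a * (b * b)) (*-nonneg (square-nonneg a) (square-nonneg b)) IH ⟩
      a * a * (b * b) * (A * B)     ≡⟨ t (a * a) (b * b) A B ⟩
      (a * a * B) * (b * b * A)     ∎)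

  length-filter-tabulate : ∀ {a p} {A : Set a} {P : Pred A p} (P? : Decidable P) {n} (f : Fin n → A) →
    + length (filter P? (tabulate f)) ≡ sum (λ i → ⟦ P? (f i) ⟧)
  length-filter-tabulate P? {zero}  f = refl
  length-filter-tabulate P? {suc n} f with P? (f zero)
  ... | yes _ = cong (λ z → 1ℤ + z) (length-filter-tabulate P? (λ i → f (suc i)))
  ... | no _  = trans (length-filter-tabulate P? (λ i → f (suc i))) (sym (ℤP.+-identityˡ _))

-- Fields whose elements are indices, and sums over them

-- With propositional equality on `Fin N`, sums over the field are plain finite sums. Inversion is
-- total with `inv 𝟎 ≡ 𝟎`, which makes it an involution of the whole index set and hence available
-- for reindexing.
record FinField (N : ℕ) : Set where
  infixl 6 _⊕_
  infixl 7 _⊗_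
  infix  8 ⊝_
  field
    _⊕_ _⊗_ : Fin N → Fin N → Fin N
    ⊝_ inv  : Fin N → Fin N
    𝟎 𝟏     : Fin N
    isCommutativeRing : IsCommutativeRing _≡_ _⊕_ _⊗_ ⊝_ 𝟎 𝟏
    𝟎≢𝟏     : 𝟎 ≢ 𝟏
    inv-𝟎   : inv 𝟎 ≡ 𝟎
    ⊗-inv   : ∀ x → x ≢ 𝟎 → x ⊗ inv x ≡ 𝟏

  commutativeRing : CommutativeRing Level.zero Level.zero
  commutativeRing = record { isCommutativeRing = isCommutativeRing }

module FieldArithmetic {N : ℕ} (K : FinField N) where
  open FinField K public
  open CommutativeRing commutativeRing public using
    ( +-assoc; +-comm; +-identityˡ; +-identityʳ; -‿inverseˡ; -‿inverseʳ; *-assoc; *-comm; *-identityˡ; *-identityʳ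
    ; distribˡ; distribʳ; zeroˡ; zeroʳ; semiring; +-monoid; +-group; +-commutativeMonoid; *-commutativeMonoid; ring; commutativeSemiring)
  open import Algebra.Properties.Semiring.Exp semiring public
    using (^-assocʳ) renaming (_^_ to infixr 9 _↑_)
  open import Algebra.Properties.CommutativeSemiring.Exp commutativeSemiring public using (^-distrib-*)
  open import Algebra.Properties.Ring ring public using (-‿distribˡ-*; -‿distribʳ-*)

  infix 4 _≟_
  _≟_ : (x y : Fin N) → Dec (x ≡ y)
  _≟_ = FinP._≟_

  module KSolver where
    open import Algebra.Solver.Ring.NaturalCoefficients.Default commutativeSemiring public
      using (solve; _:=_; _:+_; _:*_)

  open import Algebra.Properties.Group +-group public using ()
    renaming (∙-cancelˡ to ⊕-cancelˡ; x∙y⁻¹≈ε⇒x≈y to x⊝y≡𝟎⇒x≡y)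

  ⊝-⊕ : ∀ x y → (x ⊕ ⊝ y) ⊕ y ≡ x
  ⊝-⊕ x y = trans (+-assoc x (⊝ y) y) (trans (cong (x ⊕_) (-‿inverseˡ y)) (+-identityʳ x))

  ⊕-⊝ : ∀ x y → (x ⊕ y) ⊕ ⊝ y ≡ x
  ⊕-⊝ x y = trans (+-assoc x y (⊝ y)) (trans (cong (x ⊕_) (-‿inverseʳ y)) (+-identityʳ x))

  inv-cancelˡ : ∀ x → x ≢ 𝟎 → ∀ y → inv x ⊗ (x ⊗ y) ≡ y
  inv-cancelˡ x x≢0 y = begin
    inv x ⊗ (x ⊗ y)   ≡⟨ solve 3 (λ a b c → a :* (b :* c) := (b :* a) :* c) refl (inv x) x y ⟩
    (x ⊗ inv x) ⊗ y   ≡⟨ cong (_⊗ y) (⊗-inv x x≢0) ⟩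
    𝟏 ⊗ y             ≡⟨ *-identityˡ y ⟩
    y                 ∎
    where
    open ≡-Reasoning
    open KSolver

  inv-cancelʳ : ∀ x → x ≢ 𝟎 → ∀ y → x ⊗ (inv x ⊗ y) ≡ y
  inv-cancelʳ x x≢0 y = begin
    x ⊗ (inv x ⊗ y)   ≡⟨ *-assoc x (inv x) y ⟨
    (x ⊗ inv x) ⊗ y   ≡⟨ cong (_⊗ y) (⊗-inv x x≢0) ⟩
    𝟏 ⊗ y             ≡⟨ *-identityˡ y ⟩
    y                 ∎
    where
    open ≡-Reasoning

  ⊗-cancelˡ : ∀ x {y z} → x ≢ 𝟎 → x ⊗ y ≡ x ⊗ z → y ≡ z
  ⊗-cancelˡ x {y} {z} x≢0 e =
    trans (sym (inv-cancelˡ x x≢0 y)) (trans (cong (inv x ⊗_) e) (inv-cancelˡ x x≢0 z))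

  ⊗-nonzero : ∀ {x y} → x ≢ 𝟎 → y ≢ 𝟎 → x ⊗ y ≢ 𝟎
  ⊗-nonzero {x} {y} x≢0 y≢0 e = y≢0 (⊗-cancelˡ x x≢0 (trans e (sym (zeroʳ x))))

  ⊗-nonzeroˡ : ∀ {x y} → x ⊗ y ≢ 𝟎 → x ≢ 𝟎
  ⊗-nonzeroˡ {x} {y} h refl = h (zeroˡ y)

  ⊗-nonzeroʳ : ∀ {x y} → x ⊗ y ≢ 𝟎 → y ≢ 𝟎
  ⊗-nonzeroʳ {x} {y} h refl = h (zeroʳ x)

  inv-nonzero : ∀ {x} → x ≢ 𝟎 → inv x ≢ 𝟎
  inv-nonzero {x} x≢0 e = 𝟎≢𝟏 (trans (sym (zeroʳ x)) (trans (cong (x ⊗_) (sym e)) (⊗-inv x x≢0)))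

  inv-involutive : ∀ x → inv (inv x) ≡ x
  inv-involutive x with x ≟ 𝟎
  ... | yes refl = trans (cong inv inv-𝟎) inv-𝟎
  ... | no  x≢0  = ⊗-cancelˡ (inv x) (inv-nonzero x≢0)
    (trans (⊗-inv (inv x) (inv-nonzero x≢0)) (sym (trans (*-comm (inv x) x) (⊗-inv x x≢0))))

  ↑-nonzero : ∀ {x} k → x ≢ 𝟎 → x ↑ k ≢ 𝟎
  ↑-nonzero zero    x≢0 = λ e → 𝟎≢𝟏 (sym e)
  ↑-nonzero (suc k) x≢0 = ⊗-nonzero x≢0 (↑-nonzero k x≢0)

  𝟏↑ : ∀ k → 𝟏 ↑ k ≡ 𝟏
  𝟏↑ zero    = refl
  𝟏↑ (suc k) = trans (*-identityˡ _) (𝟏↑ k)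

  𝟎↑ : ∀ k → .{{NonZero k}} → 𝟎 ↑ k ≡ 𝟎
  𝟎↑ (suc k) = zeroˡ _

module FieldSums (N : ℕ) where
  open import Data.Integer using (_+_; _*_; _-_; -_; _≤_)
  open IntegerInequalities
  open Indicators

  ∑ : (Fin N → ℤ) → ℤ
  ∑ = Sums.sum {N}

  ∑-cong : ∀ {f g : Fin N → ℤ} → (∀ x → f x ≡ g x) → ∑ f ≡ ∑ g
  ∑-cong = Sums.sum-cong {N}

  ∑-+ : ∀ (f g : Fin N → ℤ) → ∑ (λ x → f x + g x) ≡ ∑ f + ∑ g
  ∑-+ = Sums.∑-distrib-+ {N}

  ∑-- : ∀ (f g : Fin N → ℤ) → ∑ (λ x → f x - g x) ≡ ∑ f - ∑ g
  ∑-- = Sums.sum-- {N}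

  ∑-swap : ∀ (f : Fin N → Fin N → ℤ) → ∑ (λ x → ∑ (f x)) ≡ ∑ (λ y → ∑ (λ x → f x y))
  ∑-swap = Sums.∑-comm {N} {N}

  ∑-*ˡ : ∀ c (f : Fin N → ℤ) → c * ∑ f ≡ ∑ (λ x → c * f x)
  ∑-*ˡ = Sums.*-distribˡ-sum {N}

  ∑-*ʳ : ∀ c (f : Fin N → ℤ) → ∑ f * c ≡ ∑ (λ x → f x * c)
  ∑-*ʳ = Sums.*-distribʳ-sum {N}

  ∑-product : ∀ (f g : Fin N → ℤ) → ∑ f * ∑ g ≡ ∑ (λ x → ∑ (λ y → f x * g y))
  ∑-product f g = trans (∑-*ʳ (∑ g) f) (∑-cong (λ x → ∑-*ˡ (f x) g))

  ∑-mono : ∀ {f g : Fin N → ℤ} → (∀ x → f x ≤ g x) → ∑ f ≤ ∑ g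
  ∑-mono = Sums.sum-mono {N}

  ∑-zero : ∀ {f : Fin N → ℤ} → (∀ x → f x ≡ 0ℤ) → ∑ f ≡ 0ℤ
  ∑-zero = Sums.sum-zero {N}

  ∑-nonneg : ∀ {f : Fin N → ℤ} → (∀ x → 0ℤ ≤ f x) → 0ℤ ≤ ∑ f
  ∑-nonneg = Sums.sum-nonneg {N}

  ∑-δ : ∀ a (f : Fin N → ℤ) → ∑ (λ x → ⟦ x FinP.≟ a ⟧ * f x) ≡ f a
  ∑-δ = Sums.sum-δ {N}

  ∑-reindex : ∀ (π π⁻¹ : Fin N → Fin N) → (∀ x → π (π⁻¹ x) ≡ x) → (∀ x → π⁻¹ (π x) ≡ x) →
              (f : Fin N → ℤ) → ∑ (λ x → f (π x)) ≡ ∑ f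
  ∑-reindex = Sums.sum-reindex {N}

  ∑-one : ∑ (λ _ → 1ℤ) ≡ + N
  ∑-one = Sums.sum-one N

-- Polynomial functions and the number of their roots

module RootBound {N : ℕ} (K : FinField N) where
  open FieldArithmetic K
  open FieldSums N
  open Indicators
  private
    Fn = Fin N → Fin N

  -- Functions given by a polynomial that is monic of degree k, resp. of degree < k (Horner's scheme).
  Monic Low : ℕ → Fn → Set
  Monic zero    f = ∀ x → f x ≡ 𝟏
  Monic (suc k) f = ∃₂ λ g c → Monic k g × (∀ x → f x ≡ x ⊗ g x ⊕ c)
  Low zero    f = ∀ x → f x ≡ 𝟎
  Low (suc k) f = ∃₂ λ g c → Low k g × (∀ x → f x ≡ x ⊗ g x ⊕ c)

  Monic-cong : ∀ k {f g} → (∀ x → g x ≡ f x) → Monic k f → Monic k g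
  Monic-cong zero    e m = λ x → trans (e x) (m x)
  Monic-cong (suc k) e (h , c , m , p) = h , c , m , λ x → trans (e x) (p x)

  Low-cong : ∀ k {f g} → (∀ x → g x ≡ f x) → Low k f → Low k g
  Low-cong zero    e m = λ x → trans (e x) (m x)
  Low-cong (suc k) e (h , c , m , p) = h , c , m , λ x → trans (e x) (p x)

  Low-zero : ∀ k → Low k (λ _ → 𝟎)
  Low-zero zero    = λ _ → refl
  Low-zero (suc k) = (λ _ → 𝟎) , 𝟎 , Low-zero k , λ x → sym (trans (+-identityʳ _) (zeroʳ x))

  Low-const : ∀ k c → Low (suc k) (λ _ → c)
  Low-const k c = (λ _ → 𝟎) , c , Low-zero k , λ x → sym (trans (cong (_⊕ c) (zeroʳ x)) (+-identityˡ c))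

  Low-suc : ∀ k {f} → Low k f → Low (suc k) f
  Low-suc zero    l = Low-cong 1 l (Low-const 0 𝟎)
  Low-suc (suc k) (g , c , l , p) = g , c , Low-suc k l , p

  Low-+ : ∀ k {f g} → Low k f → Low k g → Low k (λ x → f x ⊕ g x)
  Low-+ zero    l l′ x = trans (cong₂ _⊕_ (l x) (l′ x)) (+-identityˡ 𝟎)
  Low-+ (suc k) (f , c , l , p) (g , d , l′ , q) =
    (λ x → f x ⊕ g x) , c ⊕ d , Low-+ k l l′ , λ x → trans (cong₂ _⊕_ (p x) (q x))
      (solve 5 (λ x f g c d → (x :* f :+ c) :+ (x :* g :+ d) := x :* (f :+ g) :+ (c :+ d)) refl x (f x) (g x) c d)
    where
    open KSolver

  Monic-+ : ∀ k {f g} → Monic k f → Low k g → Monic k (λ x → f x ⊕ g x)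
  Monic-+ zero    l l′ x = trans (cong₂ _⊕_ (l x) (l′ x)) (+-identityʳ 𝟏)
  Monic-+ (suc k) (f , c , l , p) (g , d , l′ , q) =
    (λ x → f x ⊕ g x) , c ⊕ d , Monic-+ k l l′ , λ x → trans (cong₂ _⊕_ (p x) (q x))
      (solve 5 (λ x f g c d → (x :* f :+ c) :+ (x :* g :+ d) := x :* (f :+ g) :+ (c :+ d)) refl x (f x) (g x) c d)
    where
    open KSolver

  Low-scale : ∀ k a {f} → Low k f → Low k (λ x → a ⊗ f x)
  Low-scale zero    a l x = trans (cong (a ⊗_) (l x)) (zeroʳ a)
  Low-scale (suc k) a (g , c , l , p) = (λ x → a ⊗ g x) , a ⊗ c , Low-scale k a l ,
    λ x → trans (cong (a ⊗_) (p x))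
      (solve 4 (λ a x g c → a :* (x :* g :+ c) := x :* (a :* g) :+ a :* c) refl a x (g x) c)
    where
    open KSolver

  Monic⇒Low : ∀ k {f} → Monic k f → Low (suc k) f
  Monic⇒Low zero    m = Low-cong 1 m (Low-const 0 𝟏)
  Monic⇒Low (suc k) (g , c , m , p) = g , c , Monic⇒Low k m , p

  Low-≤ : ∀ {j k} → j ℕ.≤ k → ∀ {f} → Low j f → Low k f
  Low-≤ {j} j≤k l = go (ℕP.≤⇒≤′ j≤k) l
    where
    go : ∀ {k} → j ℕ.≤′ k → ∀ {f} → Low j f → Low k f
    go ℕ.≤′-refl          l = l
    go (ℕ.≤′-step j≤k) {f} l = Low-suc _ {f} (go j≤k l)

  Monic-↑ : ∀ k → Monic k (_↑ k)
  Monic-↑ zero    = λ _ → refl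
  Monic-↑ (suc k) = (_↑ k) , 𝟎 , Monic-↑ k , λ x → sym (+-identityʳ _)

  private
    horner : ∀ y a g b c → (y ⊕ a) ⊗ (y ⊗ g ⊕ b) ⊕ c ≡ y ⊗ ((y ⊗ g ⊕ b) ⊕ a ⊗ g) ⊕ (a ⊗ b ⊕ c)
    horner = solve 5 (λ y a g b c → (y :+ a) :* (y :* g :+ b) :+ c :=
      y :* ((y :* g :+ b) :+ a :* g) :+ (a :* b :+ c)) refl
      where
      open KSolver

  -- Division by x - a with the degree recorded: if f = x h + c and h = (x - a) g + h(a), the
  -- quotient is h + a g.
  factor-Low : ∀ k {f} → Low (suc k) f → ∀ a → ∃ λ g → Low k g × (∀ x → f x ≡ (x ⊕ ⊝ a) ⊗ g x ⊕ f a)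
  factor-Low zero {f} (h , c , l , p) a = (λ _ → 𝟎) , (λ _ → refl) , λ x → begin
    f x                    ≡⟨ constant x ⟩
    c                      ≡⟨ +-identityˡ c ⟨
    𝟎 ⊕ c                  ≡⟨ cong₂ _⊕_ (zeroʳ (x ⊕ ⊝ a)) (constant a) ⟨
    (x ⊕ ⊝ a) ⊗ 𝟎 ⊕ f a    ∎
    where
    open ≡-Reasoning
    constant : ∀ x → f x ≡ c
    constant x = trans (p x) (trans (cong (_⊕ c) (trans (cong (x ⊗_) (l x)) (zeroʳ x))) (+-identityˡ c))
  factor-Low (suc k) {f} (h , c , l , p) a with factor-Low k l a
  ... | g , m , r = (λ x → h x ⊕ a ⊗ g x) , Low-+ (suc k) l (Low-suc k (Low-scale k a m)) , λ x → begin
    f x                                                   ≡⟨ p x ⟩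
    x ⊗ h x ⊕ c                                           ≡⟨ cong₂ (λ s t → s ⊗ t ⊕ c) (sym (⊝-⊕ x a)) (r x) ⟩
    ((x ⊕ ⊝ a) ⊕ a) ⊗ ((x ⊕ ⊝ a) ⊗ g x ⊕ h a) ⊕ c         ≡⟨ horner (x ⊕ ⊝ a) a (g x) (h a) c ⟩
    (x ⊕ ⊝ a) ⊗ (((x ⊕ ⊝ a) ⊗ g x ⊕ h a) ⊕ a ⊗ g x) ⊕ (a ⊗ h a ⊕ c)
      ≡⟨ cong₂ (λ s t → (x ⊕ ⊝ a) ⊗ (s ⊕ a ⊗ g x) ⊕ t) (r x) (p a) ⟨
    (x ⊕ ⊝ a) ⊗ (h x ⊕ a ⊗ g x) ⊕ f a                     ∎
    where
    open ≡-Reasoning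

  -- In the quotient h + a g the leading term is that of h, because g comes from dividing h and
  -- therefore has degree below k.
  factor-Monic : ∀ k {f} → Monic (suc k) f → ∀ a → ∃ λ g → Monic k g × (∀ x → f x ≡ (x ⊕ ⊝ a) ⊗ g x ⊕ f a)
  factor-Monic k {f} (h , c , m , p) a with factor-Low k (Monic⇒Low k m) a
  ... | g , l , r = (λ x → h x ⊕ a ⊗ g x) , Monic-+ k m (Low-scale k a l) , λ x → begin
    f x                                                   ≡⟨ p x ⟩
    x ⊗ h x ⊕ c                                           ≡⟨ cong₂ (λ s t → s ⊗ t ⊕ c) (sym (⊝-⊕ x a)) (r x) ⟩
    ((x ⊕ ⊝ a) ⊕ a) ⊗ ((x ⊕ ⊝ a) ⊗ g x ⊕ h a) ⊕ c         ≡⟨ horner (x ⊕ ⊝ a) a (g x) (h a) c ⟩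
    (x ⊕ ⊝ a) ⊗ (((x ⊕ ⊝ a) ⊗ g x ⊕ h a) ⊕ a ⊗ g x) ⊕ (a ⊗ h a ⊕ c)
      ≡⟨ cong₂ (λ s t → (x ⊕ ⊝ a) ⊗ (s ⊕ a ⊗ g x) ⊕ t) (r x) (p a) ⟨
    (x ⊕ ⊝ a) ⊗ (h x ⊕ a ⊗ g x) ⊕ f a                     ∎
    where
    open ≡-Reasoning

  root-bound : ∀ k {f} → Monic k f → ∑ (λ x → ⟦ f x ≟ 𝟎 ⟧) ℤ.≤ + k
  root-bound zero    {f} m = ℤP.≤-reflexive (∑-zero (λ x → ⟦⟧-no (f x ≟ 𝟎) (λ e → 𝟎≢𝟏 (trans (sym e) (m x)))))
  root-bound (suc k) {f} m with FinP.any? (λ a → f a ≟ 𝟎)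
  ... | no  ¬root = ℤP.≤-trans (ℤP.≤-reflexive (∑-zero (λ x → ⟦⟧-no (f x ≟ 𝟎) (λ e → ¬root (x , e))))) (ℤ.+≤+ ℕ.z≤n)
  ... | yes (a , fa≡0) with factor-Monic k m a
  ... | g , mg , r = begin
    ∑ (λ x → ⟦ f x ≟ 𝟎 ⟧)                                      ≤⟨ ∑-mono split ⟩
    ∑ (λ x → ⟦ x ≟ a ⟧ ℤ.* 1ℤ ℤ.+ ⟦ g x ≟ 𝟎 ⟧)                 ≡⟨ ∑-+ (λ x → ⟦ x ≟ a ⟧ ℤ.* 1ℤ) (λ x → ⟦ g x ≟ 𝟎 ⟧) ⟩
    ∑ (λ x → ⟦ x ≟ a ⟧ ℤ.* 1ℤ) ℤ.+ ∑ (λ x → ⟦ g x ≟ 𝟎 ⟧)       ≡⟨ cong (λ t → t ℤ.+ ∑ (λ x → ⟦ g x ≟ 𝟎 ⟧)) (∑-δ a (λ _ → 1ℤ)) ⟩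
    1ℤ ℤ.+ ∑ (λ x → ⟦ g x ≟ 𝟎 ⟧)                               ≤⟨ ℤP.+-monoʳ-≤ 1ℤ (root-bound k mg) ⟩
    + suc k                                                    ∎
    where
    open ℤP.≤-Reasoning
    split : ∀ x → ⟦ f x ≟ 𝟎 ⟧ ℤ.≤ ⟦ x ≟ a ⟧ ℤ.* 1ℤ ℤ.+ ⟦ g x ≟ 𝟎 ⟧
    split x with x ≟ a
    ... | yes _ = ℤP.≤-trans (⟦⟧≤1 (f x ≟ 𝟎)) (ℤP.+-monoʳ-≤ 1ℤ (0≤⟦⟧ (g x ≟ 𝟎)))
    ... | no x≢a = ℤP.≤-trans (⟦⟧-mono gx≡0 (f x ≟ 𝟎) (g x ≟ 𝟎)) (ℤP.≤-reflexive (sym (ℤP.+-identityˡ _)))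
      where
      gx≡0 : f x ≡ 𝟎 → g x ≡ 𝟎
      gx≡0 e = ⊗-cancelˡ (x ⊕ ⊝ a) (x≢a ∘ x⊝y≡𝟎⇒x≡y x a) (trans
        (trans (sym (+-identityʳ _)) (trans (cong ((x ⊕ ⊝ a) ⊗ g x ⊕_) (sym fa≡0)) (trans (sym (r x)) e)))
        (sym (zeroʳ _)))

  ↑-fibre-bound : ∀ k → .{{NonZero k}} → ∀ y → ∑ (λ x → ⟦ x ↑ k ≟ y ⟧) ℤ.≤ + k
  ↑-fibre-bound (suc k) y = ℤP.≤-trans
    (∑-mono (λ x → ⟦⟧-mono (λ { refl → -‿inverseʳ (x ↑ suc k) }) (x ↑ suc k ≟ y) (x ↑ suc k ⊕ ⊝ y ≟ 𝟎)))
    (root-bound (suc k) (Monic-+ (suc k) (Monic-↑ (suc k)) (Low-const k (⊝ y))))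

-- Fermat's theorem and the additive order of 1

module Fermat {N : ℕ} (K : FinField N) where
  open FieldArithmetic K
  open import Algebra.Properties.CommutativeMonoid.Sum +-commutativeMonoid using ()
    renaming (sum to ∑⊕; sum-permute to ∑⊕-permute; ∑-distrib-+ to ∑⊕-distrib; sum-replicate to ∑⊕-replicate)
  open import Algebra.Properties.CommutativeMonoid.Sum *-commutativeMonoid using ()
    renaming (sum to ∏; sum-permute to ∏-permute; ∑-distrib-+ to ∏-distrib; sum-replicate to ∏-replicate; sum-cong-≗ to ∏-cong)
  open import Algebra.Properties.Monoid.Mult +-monoid public using () renaming (_×_ to infixr 9 _⋆_)
  open import Data.Fin.Permutation using (permutation)

  -- Translation by 1 permutes the field, so the sum of all elements does not change when N copies
  -- of 1 are added to it.
  N⋆𝟏≡𝟎 : N ⋆ 𝟏 ≡ 𝟎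
  N⋆𝟏≡𝟎 = ⊕-cancelˡ (∑⊕ id) _ _ (begin
    ∑⊕ id ⊕ N ⋆ 𝟏                   ≡⟨ cong (∑⊕ id ⊕_) (∑⊕-replicate N) ⟨
    ∑⊕ id ⊕ ∑⊕ {N} (λ _ → 𝟏)        ≡⟨ ∑⊕-distrib {N} id (λ _ → 𝟏) ⟨
    ∑⊕ (λ x → x ⊕ 𝟏)                ≡⟨ ∑⊕-permute id (permutation (_⊕ 𝟏) (_⊕ ⊝ 𝟏)
                                         (λ x → ⊝-⊕ x 𝟏)
                                         (λ x → ⊕-⊝ x 𝟏)) ⟨
    ∑⊕ id                           ≡⟨ +-identityʳ _ ⟨
    ∑⊕ id ⊕ 𝟎                       ∎)
    where
    open ≡-Reasoning

  private
    ∏-one : ∀ {n} (h : Fin n → Fin N) → (∀ x → h x ≡ 𝟏) → ∏ h ≡ 𝟏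
    ∏-one {zero}  h e = refl
    ∏-one {suc n} h e = trans (cong₂ _⊗_ (e zero) (∏-one (h ∘ suc) (e ∘ suc))) (*-identityˡ 𝟏)

    ∏-single : ∀ {n} (a : Fin n) (h : Fin n → Fin N) → (∀ x → x ≢ a → h x ≡ 𝟏) → ∏ h ≡ h a
    ∏-single zero    h e = trans (cong (h zero ⊗_) (∏-one (h ∘ suc) (λ x → e (suc x) λ ()))) (*-identityʳ _)
    ∏-single (suc a) h e = trans
      (cong₂ _⊗_ (e zero λ ()) (∏-single a (h ∘ suc) (λ x x≢a → e (suc x) (x≢a ∘ FinP.suc-injective))))
      (*-identityˡ _)

    ∏-nonzero : ∀ {n} (h : Fin n → Fin N) → (∀ x → h x ≢ 𝟎) → ∏ h ≢ 𝟎
    ∏-nonzero {zero}  h e = λ 1≡0 → 𝟎≢𝟏 (sym 1≡0)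
    ∏-nonzero {suc n} h e = ⊗-nonzero (e zero) (∏-nonzero (h ∘ suc) (e ∘ suc))

    -- Turns the product over all of `Fin N` into the product of the units.
    unitPart : Fin N → Fin N
    unitPart x with x ≟ 𝟎
    ... | yes _ = 𝟏
    ... | no  _ = x

    unitPart-nonzero : ∀ x → unitPart x ≢ 𝟎
    unitPart-nonzero x with x ≟ 𝟎
    ... | yes _  = λ e → 𝟎≢𝟏 (sym e)
    ... | no x≢0 = x≢0

    -- Correction at `𝟎`: there multiplication by y does not move the argument, and the factor y is
    -- left over.
    atZero : Fin N → Fin N → Fin N
    atZero y x with x ≟ 𝟎
    ... | yes _ = y
    ... | no  _ = 𝟏

    atZero-𝟎 : ∀ y → atZero y 𝟎 ≡ y
    atZero-𝟎 y with 𝟎 ≟ 𝟎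
    ... | yes _  = refl
    ... | no 0≢0 = ⊥-elim (0≢0 refl)

    atZero-nonzero : ∀ y x → x ≢ 𝟎 → atZero y x ≡ 𝟏
    atZero-nonzero y x x≢0 with x ≟ 𝟎
    ... | yes e = ⊥-elim (x≢0 e)
    ... | no _  = refl

    unitPart-scale : ∀ y → y ≢ 𝟎 → ∀ x → y ⊗ unitPart x ≡ atZero y x ⊗ unitPart (y ⊗ x)
    unitPart-scale y y≢0 x with x ≟ 𝟎 | y ⊗ x ≟ 𝟎
    ... | yes _    | yes _    = refl
    ... | yes refl | no yx≢0  = ⊥-elim (yx≢0 (zeroʳ y))
    ... | no x≢0   | yes yx≡0 = ⊥-elim (⊗-nonzero y≢0 x≢0 yx≡0)
    ... | no _     | no _     = sym (*-identityˡ _)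

  -- Multiplication by y permutes the units and preserves their product. The product runs over all N
  -- indices, so y occurs N times and the index `𝟎` returns one of them; hence the exponent N with
  -- value y.
  ↑N : ∀ y → y ≢ 𝟎 → y ↑ N ≡ y
  ↑N y y≢0 = ⊗-cancelˡ P (∏-nonzero unitPart unitPart-nonzero) (begin
    P ⊗ y ↑ N                                        ≡⟨ *-comm P (y ↑ N) ⟩
    y ↑ N ⊗ P                                        ≡⟨ cong (_⊗ P) (∏-replicate N) ⟨
    ∏ {N} (λ _ → y) ⊗ P                              ≡⟨ ∏-distrib {N} (λ _ → y) unitPart ⟨
    ∏ (λ x → y ⊗ unitPart x)                         ≡⟨ ∏-cong (unitPart-scale y y≢0) ⟩
    ∏ (λ x → atZero y x ⊗ unitPart (y ⊗ x))          ≡⟨ ∏-distrib (atZero y) (unitPart ∘ (y ⊗_)) ⟩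
    ∏ (atZero y) ⊗ ∏ (unitPart ∘ (y ⊗_))
      ≡⟨ cong₂ _⊗_ (trans (∏-single 𝟎 (atZero y) (atZero-nonzero y)) (atZero-𝟎 y))
           (sym (∏-permute unitPart (permutation (y ⊗_) (inv y ⊗_) (inv-cancelʳ y y≢0) (inv-cancelˡ y y≢0)))) ⟩
    y ⊗ P                                            ≡⟨ *-comm y P ⟩
    P ⊗ y                                            ∎)
    where
    open ≡-Reasoning
    P = ∏ unitPart

  frobenius-N : ∀ y → .{{NonZero N}} → y ↑ N ≡ y
  frobenius-N y with y ≟ 𝟎
  ... | yes refl = 𝟎↑ N
  ... | no y≢0   = ↑N y y≢0

  fermat : ∀ {M} → N ≡ suc M → ∀ y → y ≢ 𝟎 → y ↑ M ≡ 𝟏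
  fermat {M} N≡1+M y y≢0 = ⊗-cancelˡ y y≢0
    (trans (trans (cong (y ↑_) (sym N≡1+M)) (↑N y y≢0)) (sym (*-identityʳ y)))

module Totient where
  open import Data.Integer using (_*_; _-_)

  -- Euler's function of `product D` when `D` consists of distinct primes.
  totient : List ℕ → ℤ
  totient []      = 1ℤ
  totient (l ∷ D) = (+ l - 1ℤ) * totient D

-- Sums over the units

module UnitSums {N M : ℕ} (K : FinField N) (N≡1+M : N ≡ suc M) where
  open import Data.Integer using (_+_; _*_; _-_; -_; _≤_)
  open Indicators
  open FieldArithmetic K
  open FieldSums N

  -- The trivial character, extended by 0.
  ε : Fin N → ℤ
  ε x = ⟦ ¬? (x ≟ 𝟎) ⟧

  ε-𝟎 : ε 𝟎 ≡ 0ℤ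
  ε-𝟎 = ⟦⟧-no (¬? (𝟎 ≟ 𝟎)) (λ h → h refl)

  ε-unit : ∀ {x} → x ≢ 𝟎 → ε x ≡ 1ℤ
  ε-unit {x} x≢0 = ⟦⟧-yes (¬? (x ≟ 𝟎)) x≢0

  0≤ε : ∀ x → 0ℤ ≤ ε x
  0≤ε x = 0≤⟦⟧ (¬? (x ≟ 𝟎))

  ε-scale : ∀ {t} → t ≢ 𝟎 → ∀ x → ε (t ⊗ x) ≡ ε x
  ε-scale {t} t≢0 x = ⟦⟧-cong ⊗-nonzeroʳ (⊗-nonzero t≢0) (¬? (t ⊗ x ≟ 𝟎)) (¬? (x ≟ 𝟎))

  ε-*-cong : ∀ x {a b : ℤ} → (x ≢ 𝟎 → a ≡ b) → ε x * a ≡ ε x * b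
  ε-*-cong x = ⟦⟧-*-cong (¬? (x ≟ 𝟎))

  ε-absorb : ∀ (f : Fin N → ℤ) → f 𝟎 ≡ 0ℤ → ∀ x → ε x * f x ≡ f x
  ε-absorb f f0 x with x ≟ 𝟎
  ... | yes refl = sym f0
  ... | no _     = ℤP.*-identityˡ (f x)

  on-units : ∀ (f g : Fin N → ℤ) → f 𝟎 ≡ 0ℤ → g 𝟎 ≡ 0ℤ → (∀ x → x ≢ 𝟎 → f x ≡ g x) → ∀ x → f x ≡ g x
  on-units f g f0 g0 h x with x ≟ 𝟎
  ... | yes refl = trans f0 (sym g0)
  ... | no x≢0   = h x x≢0

  ∑ε : ∑ ε ≡ + M
  ∑ε = begin
    ∑ ε                                      ≡⟨ ∑-cong (λ x → trans (⟦⟧-¬ (x ≟ 𝟎)) (cong (λ t → 1ℤ - t) (sym (ℤP.*-identityʳ ⟦ x ≟ 𝟎 ⟧)))) ⟩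
    ∑ (λ x → 1ℤ - ⟦ x ≟ 𝟎 ⟧ * 1ℤ)            ≡⟨ ∑-- (λ _ → 1ℤ) (λ x → ⟦ x ≟ 𝟎 ⟧ * 1ℤ) ⟩
    ∑ (λ _ → 1ℤ) - ∑ (λ x → ⟦ x ≟ 𝟎 ⟧ * 1ℤ)  ≡⟨ cong₂ _-_ (trans ∑-one (cong +_ N≡1+M)) (∑-δ 𝟎 (λ _ → 1ℤ)) ⟩
    + suc M - 1ℤ                             ≡⟨⟩
    + M                                      ∎
    where
    open ≡-Reasoning

  ∑-scale : ∀ {t} → t ≢ 𝟎 → (f : Fin N → ℤ) → ∑ (λ x → f (t ⊗ x)) ≡ ∑ f
  ∑-scale {t} t≢0 = ∑-reindex (t ⊗_) (inv t ⊗_) (inv-cancelʳ t t≢0) (inv-cancelˡ t t≢0)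

-- Sums of characters of given order as integer functions

module PowerKernels {N M : ℕ} (K : FinField N) (N≡1+M : N ≡ suc M) (0<M : 0 ℕ.< M) where
  open import Data.Integer using (_+_; _*_; _-_; -_; _≤_)
  open IntegerInequalities
  open Indicators
  open FieldArithmetic K
  open FieldSums N
  open RootBound K
  open Fermat K
  open UnitSums K N≡1+M
  open Totient

  -- Requiring a unit z keeps 0 out, so that `P l` vanishes at `𝟎` like a sum of characters.
  IsPower : ℕ → Fin N → Set
  IsPower l x = ∃ λ z → z ≢ 𝟎 × z ↑ l ≡ x

  power? : ∀ l x → Dec (IsPower l x)
  power? l x = FinP.any? (λ z → ¬? (z ≟ 𝟎) ×-dec (z ↑ l ≟ x))

  P : ℕ → Fin N → ℤ
  P l x = ⟦ power? l x ⟧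

  IsPower⇒unit : ∀ {l x} → IsPower l x → x ≢ 𝟎
  IsPower⇒unit {l} (z , z≢0 , refl) = ↑-nonzero l z≢0

  P-𝟎 : ∀ l → P l 𝟎 ≡ 0ℤ
  P-𝟎 l = ⟦⟧-no (power? l 𝟎) (λ p → IsPower⇒unit {l} p refl)

  P-𝟏 : ∀ l → P l 𝟏 ≡ 1ℤ
  P-𝟏 l = ⟦⟧-yes (power? l 𝟏) (𝟏 , (λ e → 𝟎≢𝟏 (sym e)) , 𝟏↑ l)

  ↑-inv : ∀ {t} → t ≢ 𝟎 → ∀ l → t ↑ l ⊗ inv t ↑ l ≡ 𝟏
  ↑-inv {t} t≢0 l = trans (sym (^-distrib-* t (inv t) l)) (trans (cong (_↑ l) (⊗-inv t t≢0)) (𝟏↑ l))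

  -- On units this says that f factors through the quotient by the subgroup of l-th powers.
  Invariant : ℕ → (Fin N → ℤ) → Set
  Invariant l f = ∀ t → t ≢ 𝟎 → ∀ x → f (t ↑ l ⊗ x) ≡ f x

  P-invariant : ∀ l → Invariant l (P l)
  P-invariant l t t≢0 x = ⟦⟧-cong
    (λ { (z , z≢0 , e) → inv t ⊗ z , ⊗-nonzero (inv-nonzero t≢0) z≢0 , (begin
           (inv t ⊗ z) ↑ l             ≡⟨ ^-distrib-* (inv t) z l ⟩
           inv t ↑ l ⊗ z ↑ l           ≡⟨ cong (inv t ↑ l ⊗_) e ⟩
           inv t ↑ l ⊗ (t ↑ l ⊗ x)     ≡⟨ *-assoc _ _ x ⟨
           inv t ↑ l ⊗ t ↑ l ⊗ x       ≡⟨ cong (_⊗ x) (trans (*-comm _ _) (↑-inv t≢0 l)) ⟩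
           𝟏 ⊗ x                       ≡⟨ *-identityˡ x ⟩
           x                           ∎) })
    (λ { (z , z≢0 , e) → t ⊗ z , ⊗-nonzero t≢0 z≢0 , trans (^-distrib-* t z l) (cong (t ↑ l ⊗_) e) })
    (power? l (t ↑ l ⊗ x)) (power? l x)
    where
    open ≡-Reasoning

  module _ (l : ℕ) (l∣M : l ∣ M) where
    private
      k = _∣_.quotient l∣M
      M≡kl : M ≡ k ℕ.* l
      M≡kl = _∣_.equality l∣M
      kl≢0 : NonZero (k ℕ.* l)
      kl≢0 = subst NonZero M≡kl (ℕ.>-nonZero 0<M)
      instance
        l-nonZero : NonZero l
        l-nonZero = ℕP.m*n≢0⇒n≢0 k {{kl≢0}}
        k-nonZero : NonZero k
        k-nonZero = ℕP.m*n≢0⇒m≢0 k {{kl≢0}}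

    -- Fibres of x ↦ x^k have at most k = M / l elements and lie over the
    -- l-th roots of unity, so there are at least l of the latter.
    roots-of-unity : ∑ (λ u → ⟦ u ↑ l ≟ 𝟏 ⟧) ≡ + l
    roots-of-unity = ℤP.≤-antisym (↑-fibre-bound l 𝟏)
      (*-cancelˡ-≤ (+ k) (ℤ.+<+ (ℕ.>-nonZero⁻¹ k)) (begin
        + k * + l                                          ≡⟨ ℤP.pos-* k l ⟨
        + (k ℕ.* l)                                        ≡⟨ cong +_ M≡kl ⟨
        + M                                                ≡⟨ ∑ε ⟨
        ∑ ε                                                ≡⟨ ∑-cong (λ x → ∑-δ (x ↑ k) (λ _ → ε x)) ⟨
        ∑ (λ x → ∑ (λ w → ⟦ w ≟ x ↑ k ⟧ * ε x))            ≡⟨ ∑-swap (λ x w → ⟦ w ≟ x ↑ k ⟧ * ε x) ⟩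
        ∑ (λ w → ∑ (λ x → ⟦ w ≟ x ↑ k ⟧ * ε x))            ≤⟨ ∑-mono (λ w → ∑-mono (λ x → bound w x)) ⟩
        ∑ (λ w → ∑ (λ x → ⟦ w ↑ l ≟ 𝟏 ⟧ * ⟦ x ↑ k ≟ w ⟧))  ≡⟨ ∑-cong (λ w → ∑-*ˡ ⟦ w ↑ l ≟ 𝟏 ⟧ (λ x → ⟦ x ↑ k ≟ w ⟧)) ⟨
        ∑ (λ w → ⟦ w ↑ l ≟ 𝟏 ⟧ * ∑ (λ x → ⟦ x ↑ k ≟ w ⟧))
          ≤⟨ ∑-mono (λ w → *-monoˡ-≤ ⟦ w ↑ l ≟ 𝟏 ⟧ (0≤⟦⟧ (w ↑ l ≟ 𝟏)) (↑-fibre-bound k w)) ⟩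
        ∑ (λ w → ⟦ w ↑ l ≟ 𝟏 ⟧ * + k)                      ≡⟨ ∑-*ʳ (+ k) (λ w → ⟦ w ↑ l ≟ 𝟏 ⟧) ⟨
        ∑ (λ w → ⟦ w ↑ l ≟ 𝟏 ⟧) * + k                      ≡⟨ ℤP.*-comm _ (+ k) ⟩
        + k * ∑ (λ w → ⟦ w ↑ l ≟ 𝟏 ⟧)                      ∎))
      where
      open ℤP.≤-Reasoning
      bound : ∀ w x → ⟦ w ≟ x ↑ k ⟧ * ε x ≤ ⟦ w ↑ l ≟ 𝟏 ⟧ * ⟦ x ↑ k ≟ w ⟧
      bound w x = subst₂ _≤_ (⟦⟧-× (w ≟ x ↑ k) (¬? (x ≟ 𝟎))) (⟦⟧-× (w ↑ l ≟ 𝟏) (x ↑ k ≟ w))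
        (⟦⟧-mono (λ { (refl , x≢0) → trans (^-assocʳ x k l) (trans (cong (x ↑_) (sym M≡kl)) (fermat N≡1+M x x≢0)) , refl })
          ((w ≟ x ↑ k) ×-dec ¬? (x ≟ 𝟎)) ((w ↑ l ≟ 𝟏) ×-dec (x ↑ k ≟ w)))

    -- A nonempty fibre is the translate of the l-th roots of unity by any one of its members.
    fibre-count : ∀ y → y ≢ 𝟎 → ∑ (λ u → ⟦ u ↑ l ≟ y ⟧) ≡ + l * P l y
    fibre-count y y≢0 with power? l y
    ... | no ¬p = trans (∑-zero (λ u → ⟦⟧-no (u ↑ l ≟ y)
            λ { e → ¬p (u , (λ { refl → y≢0 (trans (sym e) (𝟎↑ l)) }) , e) })) (sym (ℤP.*-zeroʳ (+ l)))
    ... | yes (z , z≢0 , refl) = begin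
      ∑ (λ u → ⟦ u ↑ l ≟ z ↑ l ⟧)         ≡⟨ ∑-scale z≢0 (λ u → ⟦ u ↑ l ≟ z ↑ l ⟧) ⟨
      ∑ (λ u → ⟦ (z ⊗ u) ↑ l ≟ z ↑ l ⟧)   ≡⟨ ∑-cong (λ u → ⟦⟧-cong
           (λ e → ⊗-cancelˡ (z ↑ l) (↑-nonzero l z≢0) (trans (sym (^-distrib-* z u l)) (trans e (sym (*-identityʳ _)))))
           (λ e → trans (^-distrib-* z u l) (trans (cong (z ↑ l ⊗_) e) (*-identityʳ _)))
           ((z ⊗ u) ↑ l ≟ z ↑ l) (u ↑ l ≟ 𝟏)) ⟩
      ∑ (λ u → ⟦ u ↑ l ≟ 𝟏 ⟧)             ≡⟨ roots-of-unity ⟩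
      + l                                 ≡⟨ ℤP.*-identityʳ (+ l) ⟨
      + l * 1ℤ                            ∎
      where
      open ≡-Reasoning

    -- The units are counted according to their l-th powers, each power being attained l times.
    index : + l * ∑ (P l) ≡ + M
    index = begin
      + l * ∑ (P l)                                  ≡⟨ ∑-*ˡ (+ l) (P l) ⟩
      ∑ (λ y → + l * P l y)                          ≡⟨ ∑-cong (on-units (λ y → + l * P l y) (λ y → ε y * ∑ (λ u → ⟦ u ↑ l ≟ y ⟧))
                                                          (trans (cong (+ l *_) (P-𝟎 l)) (ℤP.*-zeroʳ (+ l)))
                                                          (trans (cong (_* ∑ (λ u → ⟦ u ↑ l ≟ 𝟎 ⟧)) ε-𝟎) (ℤP.*-zeroˡ (∑ (λ u → ⟦ u ↑ l ≟ 𝟎 ⟧))))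
                                                          (λ y y≢0 → sym (trans (cong₂ _*_ (ε-unit y≢0) (fibre-count y y≢0)) (ℤP.*-identityˡ _)))) ⟩
      ∑ (λ y → ε y * ∑ (λ u → ⟦ u ↑ l ≟ y ⟧))        ≡⟨ ∑-cong (λ y → ∑-*ˡ (ε y) (λ u → ⟦ u ↑ l ≟ y ⟧)) ⟩
      ∑ (λ y → ∑ (λ u → ε y * ⟦ u ↑ l ≟ y ⟧))        ≡⟨ ∑-swap (λ y u → ε y * ⟦ u ↑ l ≟ y ⟧) ⟩
      ∑ (λ u → ∑ (λ y → ε y * ⟦ u ↑ l ≟ y ⟧))        ≡⟨ ∑-cong (λ u → ∑-cong (λ y → trans (ℤP.*-comm (ε y) ⟦ u ↑ l ≟ y ⟧)
                                                          (cong (_* ε y) (⟦⟧-cong sym sym (u ↑ l ≟ y) (y ≟ u ↑ l))))) ⟩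
      ∑ (λ u → ∑ (λ y → ⟦ y ≟ u ↑ l ⟧ * ε y))        ≡⟨ ∑-cong (λ u → ∑-δ (u ↑ l) ε) ⟩
      ∑ (λ u → ε (u ↑ l))                            ≡⟨ ∑-cong (λ u → ⟦⟧-cong (λ { h refl → h (𝟎↑ l) }) (↑-nonzero l)
                                                          (¬? (u ↑ l ≟ 𝟎)) (¬? (u ≟ 𝟎))) ⟩
      ∑ ε                                            ≡⟨ ∑ε ⟩
      + M                                            ∎
      where
      open ≡-Reasoning

  -- The sum of the characters of exact order l (l prime).
  c : ℕ → Fin N → ℤ
  c l x = + l * P l x - ε x

  c-𝟎 : ∀ l → c l 𝟎 ≡ 0ℤ
  c-𝟎 l = trans (cong₂ (λ s t → + l * s - t) (P-𝟎 l) ε-𝟎) (trans (cong (λ t → t - 0ℤ) (ℤP.*-zeroʳ (+ l))) refl)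

  c-𝟏 : ∀ l → c l 𝟏 ≡ + l - 1ℤ
  c-𝟏 l = cong₂ (λ s t → s - t) (trans (cong (+ l *_) (P-𝟏 l)) (ℤP.*-identityʳ (+ l))) (ε-unit (λ e → 𝟎≢𝟏 (sym e)))

  c-invariant : ∀ l → Invariant l (c l)
  c-invariant l t t≢0 x = cong₂ (λ s t → + l * s - t) (P-invariant l t t≢0 x) (ε-scale (↑-nonzero l t≢0) x)

  ∑c : ∀ l → l ∣ M → ∑ (c l) ≡ 0ℤ
  ∑c l l∣M = begin
    ∑ (c l)                           ≡⟨ ∑-- (λ x → + l * P l x) ε ⟩
    ∑ (λ x → + l * P l x) - ∑ ε       ≡⟨ cong₂ _-_ (trans (sym (∑-*ˡ (+ l) (P l))) (index l l∣M)) ∑ε ⟩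
    + M - + M                         ≡⟨ ℤP.+-inverseʳ (+ M) ⟩
    0ℤ                                ∎
    where
    open ≡-Reasoning

  -- Orthogonality without characters. If f is a sum of distinct characters closed under inversion,
  -- then ∑_w χ(w) ψ(wu) is M ψ(u) for χ = ψ⁻¹ and 0 otherwise, which adds up to this correlation.
  record Kernel (f : Fin N → ℤ) : Set where
    field
      at-𝟎        : f 𝟎 ≡ 0ℤ
      correlation : ∀ u → ∑ (λ w → f w * f (w ⊗ u)) ≡ + M * f u

  correlation-𝟎 : ∀ f → f 𝟎 ≡ 0ℤ → ∑ (λ w → f w * f (w ⊗ 𝟎)) ≡ + M * f 𝟎
  correlation-𝟎 f f0 = trans
    (∑-zero (λ w → trans (cong (f w *_) (trans (cong f (zeroʳ w)) f0)) (ℤP.*-zeroʳ (f w))))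
    (sym (trans (cong (+ M *_) f0) (ℤP.*-zeroʳ (+ M))))

  correlation-units : ∀ f → f 𝟎 ≡ 0ℤ → (∀ u → u ≢ 𝟎 → ∑ (λ w → f w * f (w ⊗ u)) ≡ + M * f u) → Kernel f
  correlation-units f f0 h = record { at-𝟎 = f0 ; correlation = corr }
    where
    corr : ∀ u → ∑ (λ w → f w * f (w ⊗ u)) ≡ + M * f u
    corr u with u ≟ 𝟎
    ... | yes refl = correlation-𝟎 f f0
    ... | no u≢0   = h u u≢0

  ε-kernel : Kernel ε
  ε-kernel = correlation-units ε ε-𝟎 λ u u≢0 → begin
    ∑ (λ w → ε w * ε (w ⊗ u))   ≡⟨ ∑-cong (λ w → cong (ε w *_) (trans (cong ε (*-comm w u)) (ε-scale u≢0 w))) ⟩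
    ∑ (λ w → ε w * ε w)         ≡⟨ ∑-cong (λ w → ⟦⟧-idem (¬? (w ≟ 𝟎))) ⟩
    ∑ ε                         ≡⟨ ∑ε ⟩
    + M                         ≡⟨ ℤP.*-identityʳ (+ M) ⟨
    + M * 1ℤ                    ≡⟨ cong (+ M *_) (ε-unit u≢0) ⟨
    + M * ε u                   ∎
    where
    open ≡-Reasoning

  -- If w is an l-th power, then wu and u lie in the same coset, so `P l w * P l (w ⊗ u)` is
  -- `P l w * P l u`. After expansion every sum is ∑ `P l` or ∑ `ε`, both known.
  c-kernel : ∀ l → l ∣ M → Kernel (c l)
  c-kernel l l∣M = correlation-units (c l) (c-𝟎 l) λ u u≢0 → begin
    ∑ (λ w → c l w * c l (w ⊗ u))
      ≡⟨ ∑-cong (λ w → pointwise u u≢0 w) ⟩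
    ∑ (λ w → (a u * P l w + - + l * P l (u ⊗ w)) + ε w)
      ≡⟨ ∑-+ (λ w → a u * P l w + - + l * P l (u ⊗ w)) ε ⟩
    ∑ (λ w → a u * P l w + - + l * P l (u ⊗ w)) + ∑ ε
      ≡⟨ cong (λ t → t + ∑ ε) (∑-+ (λ w → a u * P l w) (λ w → - + l * P l (u ⊗ w))) ⟩
    (∑ (λ w → a u * P l w) + ∑ (λ w → - + l * P l (u ⊗ w))) + ∑ ε
      ≡⟨ cong₂ (λ s t → (s + t) + ∑ ε) (sym (∑-*ˡ (a u) (P l)))
           (trans (sym (∑-*ˡ (- + l) (λ w → P l (u ⊗ w)))) (cong (λ t → - + l * t) (∑-scale u≢0 (P l)))) ⟩
    (a u * ∑ (P l) + - + l * ∑ (P l)) + ∑ ε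
      ≡⟨ p (+ l) (P l u) (∑ (P l)) (∑ ε) ⟩
    + l * (P l u) * (+ l * ∑ (P l)) - + 2 * (+ l * ∑ (P l)) + ∑ ε
      ≡⟨ cong₂ (λ s t → + l * (P l u) * s - + 2 * s + t) (index l l∣M) ∑ε ⟩
    + l * (P l u) * + M - + 2 * + M + + M
      ≡⟨ r (+ l * P l u) (+ M) ⟩
    + M * (+ l * P l u - 1ℤ)
      ≡⟨ cong (λ t → + M * (+ l * P l u - t)) (ε-unit u≢0) ⟨
    + M * c l u ∎
    where
    open ≡-Reasoning
    a : Fin N → ℤ
    a u = + l * + l * P l u - + l
    p : ∀ l u s e → ((l * l * u - l) * s + - l * s) + e ≡ l * u * (l * s) - + 2 * (l * s) + e
    p = solve-∀
    r : ∀ x m → x * m - + 2 * m + m ≡ m * (x - 1ℤ)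
    r = solve-∀
    q₁ : ∀ l p e p′ e′ → (l * p - e) * (l * p′ - e′) ≡ l * l * (p * p′) - l * (p * e′) - l * (e * p′) + e * e′
    q₁ = solve-∀
    q₂ : ∀ l p pu p′ e → l * l * (p * pu) - l * p - l * p′ + e ≡ ((l * l * pu - l) * p + - l * p′) + e
    q₂ = solve-∀
    pointwise : ∀ u → u ≢ 𝟎 → ∀ w → c l w * c l (w ⊗ u) ≡ (a u * P l w + - + l * P l (u ⊗ w)) + ε w
    pointwise u u≢0 w = begin
      (+ l * P l w - ε w) * (+ l * P l (w ⊗ u) - ε (w ⊗ u))
        ≡⟨ q₁ (+ l) (P l w) (ε w) (P l (w ⊗ u)) (ε (w ⊗ u)) ⟩
      + l * + l * (P l w * P l (w ⊗ u)) - + l * (P l w * ε (w ⊗ u)) - + l * (ε w * P l (w ⊗ u)) + ε w * ε (w ⊗ u)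
        ≡⟨ cong₂ _+_ (cong₂ _-_ (cong₂ _-_ (cong (+ l * + l *_) PP) (cong (+ l *_) Pε)) (cong (+ l *_) εP)) εε ⟩
      + l * + l * (P l w * P l u) - + l * P l w - + l * P l (u ⊗ w) + ε w
        ≡⟨ q₂ (+ l) (P l w) (P l u) (P l (u ⊗ w)) (ε w) ⟩
      (a u * P l w + - + l * P l (u ⊗ w)) + ε w ∎
      where
      PP : P l w * P l (w ⊗ u) ≡ P l w * P l u
      PP = ⟦⟧-*-cong (power? l w) (λ { (t , t≢0 , refl) → P-invariant l t t≢0 u })
      Pε : P l w * ε (w ⊗ u) ≡ P l w
      Pε = trans (⟦⟧-*-cong (power? l w) (λ p → ε-unit (⊗-nonzero (IsPower⇒unit {l} p) u≢0))) (ℤP.*-identityʳ (P l w))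
      εP : ε w * P l (w ⊗ u) ≡ P l (u ⊗ w)
      εP = trans (cong (λ t → ε w * P l t) (*-comm w u))
        (ε-absorb (λ w → P l (u ⊗ w)) (trans (cong (P l) (zeroʳ u)) (P-𝟎 l)) w)
      εε : ε w * ε (w ⊗ u) ≡ ε w
      εε = trans (cong (ε w *_) (trans (cong ε (*-comm w u)) (ε-scale u≢0 w))) (⟦⟧-idem (¬? (w ≟ 𝟎)))

  ↑-split : ∀ w → w ≢ 𝟎 → ∀ a b → 1 ℕ.+ a ≡ b → w ≡ w ↑ b ⊗ inv w ↑ a
  ↑-split w w≢0 a _ refl = sym (trans (*-assoc w (w ↑ a) (inv w ↑ a)) (trans (cong (w ⊗_) (↑-inv w≢0 a)) (*-identityʳ w)))

  -- A Bézout relation writes the exponent 1 of w as a difference of a multiple of d and a multiple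
  -- of l, in one order or the other; `inv w` carries the negative part.
  coprime-decomposition : ∀ {d l} → Coprime d l → ∀ w → w ≢ 𝟎 →
    ∃₂ λ v t → v ≢ 𝟎 × t ≢ 𝟎 × w ≡ v ↑ d ⊗ t ↑ l
  coprime-decomposition {d} {l} cop w w≢0 with coprime-Bézout cop
  ... | Bézout.+- x y 1+yl≡xd = w ↑ x , inv w ↑ y , ↑-nonzero x w≢0 , ↑-nonzero y (inv-nonzero w≢0) ,
    trans (↑-split w w≢0 (y ℕ.* l) (x ℕ.* d) 1+yl≡xd) (sym (cong₂ _⊗_ (^-assocʳ w x d) (^-assocʳ (inv w) y l)))
  ... | Bézout.-+ x y 1+xd≡yl = inv w ↑ x , w ↑ y , ↑-nonzero x (inv-nonzero w≢0) , ↑-nonzero y w≢0 ,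
    trans (↑-split w w≢0 (x ℕ.* d) (y ℕ.* l) 1+xd≡yl)
      (trans (*-comm _ _) (sym (cong₂ _⊗_ (^-assocʳ (inv w) x d) (^-assocʳ w y l))))

  private
    M≢0 : + M ≢ 0ℤ
    M≢0 e = ℕP.<-irrefl (sym (ℤP.+-injective e)) 0<M

    M-cancel : ∀ {a b} → + M * a ≡ + M * b → a ≡ b
    M-cancel {a} {b} = ℤP.*-cancelˡ-≡ (+ M) a b {{ℤ.≢-nonZero M≢0}}

    -- Translate w by x^d, which h does not see, and average over x.
    average : ∀ {d l} → Coprime d l → ∀ h f → Invariant d h → Invariant l f → h 𝟎 ≡ 0ℤ →
      + M * ∑ (λ w → h w * f w) ≡ ∑ h * ∑ (λ x → ε x * f (x ↑ d))
    average {d} {l} cop h f h-inv f-inv h0 = begin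
      + M * ∑ (λ w → h w * f w)
        ≡⟨ cong (_* ∑ (λ w → h w * f w)) (sym ∑ε) ⟩
      ∑ ε * ∑ (λ w → h w * f w)
        ≡⟨ ∑-*ʳ (∑ (λ w → h w * f w)) ε ⟩
      ∑ (λ x → ε x * ∑ (λ w → h w * f w))
        ≡⟨ ∑-cong (λ x → ε-*-cong x (λ x≢0 → sym (∑-scale (↑-nonzero d x≢0) (λ w → h w * f w)))) ⟩
      ∑ (λ x → ε x * ∑ (λ w → h (x ↑ d ⊗ w) * f (x ↑ d ⊗ w)))
        ≡⟨ ∑-cong (λ x → ε-*-cong x (λ x≢0 → ∑-cong (λ w → cong (_* f (x ↑ d ⊗ w)) (h-inv x x≢0 w)))) ⟩
      ∑ (λ x → ε x * ∑ (λ w → h w * f (x ↑ d ⊗ w)))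
        ≡⟨ ∑-cong (λ x → trans (∑-*ˡ (ε x) (λ w → h w * f (x ↑ d ⊗ w)))
             (∑-cong (λ w → r (ε x) (h w) (f (x ↑ d ⊗ w))))) ⟩
      ∑ (λ x → ∑ (λ w → h w * (ε x * f (x ↑ d ⊗ w))))
        ≡⟨ ∑-swap (λ x w → h w * (ε x * f (x ↑ d ⊗ w))) ⟩
      ∑ (λ w → ∑ (λ x → h w * (ε x * f (x ↑ d ⊗ w))))
        ≡⟨ ∑-cong (λ w → sym (∑-*ˡ (h w) (λ x → ε x * f (x ↑ d ⊗ w)))) ⟩
      ∑ (λ w → h w * ∑ (λ x → ε x * f (x ↑ d ⊗ w)))
        ≡⟨ ∑-cong (on-units (λ w → h w * ∑ (λ x → ε x * f (x ↑ d ⊗ w))) (λ w → h w * G)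
             (vanish (∑ (λ x → ε x * f (x ↑ d ⊗ 𝟎)))) (vanish G) (λ w w≢0 → cong (h w *_) (inner w w≢0))) ⟩
      ∑ (λ w → h w * G)
        ≡⟨ ∑-*ʳ G h ⟨
      ∑ h * G ∎
      where
      open ≡-Reasoning
      G = ∑ (λ x → ε x * f (x ↑ d))
      r : ∀ a b c → a * (b * c) ≡ b * (a * c)
      r = solve-∀
      vanish : ∀ a → h 𝟎 * a ≡ 0ℤ
      vanish a = trans (cong (_* a) h0) (ℤP.*-zeroˡ a)
      -- Writing w = v^d t^l, the factor t^l is invisible to f and v^d is absorbed by x ↦ vx, so the
      -- inner sum does not depend on w.
      inner : ∀ w → w ≢ 𝟎 → ∑ (λ x → ε x * f (x ↑ d ⊗ w)) ≡ G
      inner w w≢0 with coprime-decomposition cop w w≢0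
      ... | v , t , v≢0 , t≢0 , refl = begin
        ∑ (λ x → ε x * f (x ↑ d ⊗ (v ↑ d ⊗ t ↑ l)))
          ≡⟨ ∑-cong (λ x → cong₂ _*_ (sym (ε-scale v≢0 x)) (trans (cong f (regroup x)) (f-inv t t≢0 ((v ⊗ x) ↑ d)))) ⟩
        ∑ (λ x → ε (v ⊗ x) * f ((v ⊗ x) ↑ d))
          ≡⟨ ∑-scale v≢0 (λ x → ε x * f (x ↑ d)) ⟩
        G ∎
        where
        regroup : ∀ x → x ↑ d ⊗ (v ↑ d ⊗ t ↑ l) ≡ t ↑ l ⊗ (v ⊗ x) ↑ d
        regroup x = trans (solve 3 (λ a b e → a :* (b :* e) := e :* (b :* a)) refl (x ↑ d) (v ↑ d) (t ↑ l))
          (cong (t ↑ l ⊗_) (sym (^-distrib-* v x d)))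
          where
          open KSolver

  -- The cosets of the d-th and of the l-th powers are equidistributed relative to
  -- each other when d and l are coprime.
  independence : ∀ {d l} → Coprime d l → ∀ h f → Invariant d h → Invariant l f → h 𝟎 ≡ 0ℤ → f 𝟎 ≡ 0ℤ →
    + M * ∑ (λ w → h w * f w) ≡ ∑ h * ∑ f
  independence {d} {l} cop h f h-inv f-inv h0 f0 =
    trans (average cop h f h-inv f-inv h0) (cong (∑ h *_) (sym ∑f≡G))
    where
    open ≡-Reasoning
    -- The averaging is applied once more with h = `ε`, to identify the mean of f over d-th powers
    -- with its mean over all units.
    ∑f≡G : ∑ f ≡ ∑ (λ x → ε x * f (x ↑ d))
    ∑f≡G = M-cancel (begin
      + M * ∑ f                                ≡⟨ cong (+ M *_) (∑-cong (λ x → sym (ε-absorb f f0 x))) ⟩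
      + M * ∑ (λ x → ε x * f x)                ≡⟨ average cop ε f (λ t t≢0 → ε-scale (↑-nonzero d t≢0)) f-inv ε-𝟎 ⟩
      ∑ ε * ∑ (λ x → ε x * f (x ↑ d))          ≡⟨ cong (_* ∑ (λ x → ε x * f (x ↑ d))) ∑ε ⟩
      + M * ∑ (λ x → ε x * f (x ↑ d))          ∎)

  Invariant-shift : ∀ {d} f → Invariant d f → ∀ u → Invariant d (λ w → f w * f (w ⊗ u))
  Invariant-shift {d} f inv-f u t t≢0 x =
    cong₂ _*_ (inv-f t t≢0 x) (trans (cong f (*-assoc (t ↑ d) x u)) (inv-f t t≢0 (x ⊗ u)))

  Invariant-* : ∀ {d l} f g → Invariant d f → Invariant l g → Invariant (l ℕ.* d) (λ x → g x * f x)
  Invariant-* {d} {l} f g inv-f inv-g t t≢0 x = cong₂ _*_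
    (trans (cong (λ s → g (s ⊗ x)) (trans (cong (t ↑_) (ℕP.*-comm l d)) (sym (^-assocʳ t d l)))) (inv-g (t ↑ d) (↑-nonzero d t≢0) x))
    (trans (cong (λ s → f (s ⊗ x)) (sym (^-assocʳ t l d))) (inv-f (t ↑ l) (↑-nonzero l t≢0) x))

  CoprimeDivisors : List ℕ → Set
  CoprimeDivisors []      = ⊤
  CoprimeDivisors (l ∷ D) = l ∣ M × Coprime (product D) l × CoprimeDivisors D

  -- The sum of the characters of exact order ∏ D (D a list of distinct primes).
  cs : List ℕ → Fin N → ℤ
  cs []      = ε
  cs (l ∷ D) x = c l x * cs D x

  cs-𝟏 : ∀ D → cs D 𝟏 ≡ totient D
  cs-𝟏 []      = ε-unit (λ e → 𝟎≢𝟏 (sym e))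
  cs-𝟏 (l ∷ D) = cong₂ _*_ (c-𝟏 l) (cs-𝟏 D)

  cs-invariant : ∀ D → Invariant (product D) (cs D)
  cs-invariant []      t t≢0 = ε-scale (↑-nonzero 1 t≢0)
  cs-invariant (l ∷ D) = Invariant-* {product D} {l} (cs D) (c l) (cs-invariant D) (c-invariant l)

  -- For fixed u the correlation products of `cs D` and of `c l` are themselves invariant under (∏
  -- D)-th and l-th powers, so by independence the correlation of the product is the product of
  -- correlations, up to M.
  cs-kernel : ∀ D → CoprimeDivisors D → Kernel (cs D)
  cs-kernel []      _ = ε-kernel
  cs-kernel (l ∷ D) (l∣M , cop , good) = record
    { at-𝟎 = trans (cong (_* cs D 𝟎) (c-𝟎 l)) (ℤP.*-zeroˡ (cs D 𝟎))
    ; correlation = λ u → M-cancel (begin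
      + M * ∑ (λ w → cs (l ∷ D) w * cs (l ∷ D) (w ⊗ u))
        ≡⟨ cong (+ M *_) (∑-cong (λ w → r (c l w) (cs D w) (c l (w ⊗ u)) (cs D (w ⊗ u)))) ⟩
      + M * ∑ (λ w → (cs D w * cs D (w ⊗ u)) * (c l w * c l (w ⊗ u)))
        ≡⟨ independence cop (λ w → cs D w * cs D (w ⊗ u)) (λ w → c l w * c l (w ⊗ u))
             (Invariant-shift {product D} (cs D) (cs-invariant D) u) (Invariant-shift {l} (c l) (c-invariant l) u)
             (vanish (cs D) (at-𝟎 IH) (cs D (𝟎 ⊗ u))) (vanish (c l) (c-𝟎 l) (c l (𝟎 ⊗ u))) ⟩
      ∑ (λ w → cs D w * cs D (w ⊗ u)) * ∑ (λ w → c l w * c l (w ⊗ u))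
        ≡⟨ cong₂ _*_ (correlation IH u) (correlation (c-kernel l l∣M) u) ⟩
      (+ M * cs D u) * (+ M * c l u)
        ≡⟨ q (+ M) (cs D u) (c l u) ⟩
      + M * (+ M * cs (l ∷ D) u) ∎) }
    where
    open ≡-Reasoning
    open Kernel
    IH = cs-kernel D good
    vanish : ∀ (f : Fin N → ℤ) → f 𝟎 ≡ 0ℤ → ∀ a → f 𝟎 * a ≡ 0ℤ
    vanish f f0 a = trans (cong (_* a) f0) (ℤP.*-zeroˡ a)
    r : ∀ a b c d → (a * b) * (c * d) ≡ (b * d) * (a * c)
    r = solve-∀
    q : ∀ m x y → (m * x) * (m * y) ≡ m * (m * (y * x))
    q = solve-∀

  ∑cs : ∀ l D → CoprimeDivisors (l ∷ D) → ∑ (cs (l ∷ D)) ≡ 0ℤ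
  ∑cs l D (l∣M , cop , good) = M-cancel (begin
    + M * ∑ (cs (l ∷ D))              ≡⟨ cong (+ M *_) (∑-cong (λ w → ℤP.*-comm (c l w) (cs D w))) ⟩
    + M * ∑ (λ w → cs D w * c l w)    ≡⟨ independence cop (cs D) (c l) (cs-invariant D) (c-invariant l)
                                           (Kernel.at-𝟎 (cs-kernel D good)) (c-𝟎 l) ⟩
    ∑ (cs D) * ∑ (c l)                ≡⟨ cong (∑ (cs D) *_) (∑c l l∣M) ⟩
    ∑ (cs D) * 0ℤ                     ≡⟨ ℤP.*-zeroʳ (∑ (cs D)) ⟩
    0ℤ                                ≡⟨ ℤP.*-zeroʳ (+ M) ⟨
    + M * 0ℤ                          ∎)
    where
    open ≡-Reasoning

-- The properties of Tr : F_{q^n} → F_q used for the character sums; A = q^{n-1}.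
record TraceForm {N : ℕ} (K : FinField N) (q A : ℕ) : Set₁ where
  open FieldArithmetic K
  open FieldSums N
  open Indicators
  field
    τ         : Fin N → Fin N
    Scalar    : Fin N → Set
    scalar?   : ∀ x → Dec (Scalar x)
    scalar-𝟎  : Scalar 𝟎
    scalar-/  : ∀ {x y} → Scalar x → Scalar y → Scalar (x ⊗ inv y)
    τ-⊕       : ∀ x y → τ (x ⊕ y) ≡ τ x ⊕ τ y
    τ-linear  : ∀ {t} → Scalar t → ∀ x → τ (t ⊗ x) ≡ t ⊗ τ x
    #scalars  : ∑ (λ x → ⟦ scalar? x ⟧) ≡ + q
    τ-fibre   : ∀ {b} → Scalar b → ∑ (λ x → ⟦ τ x ≟ b ⟧) ≡ + A
    size      : + N ≡ + q ℤ.* + A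

-- The second moment and the bound for character sums

module SecondMoment {N M q A : ℕ} (K : FinField N) (N≡1+M : N ≡ suc M) (0<M : 0 ℕ.< M)
                    (tr : TraceForm K q A) (1<q : 1 ℕ.< q) where
  open import Data.Integer using (_+_; _*_; _-_; -_; _≤_; _<_)
  open IntegerInequalities
  open Indicators
  open FieldArithmetic K
  open FieldSums N
  open UnitSums K N≡1+M
  open PowerKernels K N≡1+M 0<M
  open TraceForm tr

  τ-𝟎 : τ 𝟎 ≡ 𝟎
  τ-𝟎 = trans (cong τ (sym (zeroˡ 𝟎))) (trans (τ-linear scalar-𝟎 𝟎) (zeroˡ (τ 𝟎)))

  τ-⊝ : ∀ x y → τ x ≡ τ y → τ (x ⊕ ⊝ y) ≡ 𝟎
  τ-⊝ x y e = ⊕-cancelˡ (τ y) _ _ (begin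
    τ y ⊕ τ (x ⊕ ⊝ y)   ≡⟨ +-comm (τ y) _ ⟩
    τ (x ⊕ ⊝ y) ⊕ τ y   ≡⟨ τ-⊕ (x ⊕ ⊝ y) y ⟨
    τ (x ⊕ ⊝ y ⊕ y)     ≡⟨ cong τ (⊝-⊕ x y) ⟩
    τ x                 ≡⟨ e ⟩
    τ y                 ≡⟨ +-identityʳ (τ y) ⟨
    τ y ⊕ 𝟎             ∎)
    where
    open ≡-Reasoning

  τ-⊝⁻¹ : ∀ x y → τ (x ⊕ ⊝ y) ≡ 𝟎 → τ x ≡ τ y
  τ-⊝⁻¹ x y e = begin
    τ x                  ≡⟨ cong τ (⊝-⊕ x y) ⟨
    τ (x ⊕ ⊝ y ⊕ y)      ≡⟨ τ-⊕ (x ⊕ ⊝ y) y ⟩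
    τ (x ⊕ ⊝ y) ⊕ τ y    ≡⟨ cong (_⊕ τ y) e ⟩
    𝟎 ⊕ τ y              ≡⟨ +-identityˡ (τ y) ⟩
    τ y                  ∎
    where
    open ≡-Reasoning

  private
    q-1 : ℤ
    q-1 = + q - 1ℤ

    0<q-1 : 0ℤ < q-1
    0<q-1 = subst (λ t → t < q-1) (ℤP.+-inverseʳ 1ℤ) (ℤP.+-monoˡ-< (- 1ℤ) (ℤ.+<+ 1<q))

  ∑-units : ∀ (g : Fin N → ℤ) → ∑ (λ z → ε z * g z) ≡ ∑ g - g 𝟎
  ∑-units g = begin
    ∑ (λ z → ε z * g z)                  ≡⟨ ∑-cong (λ z → trans (cong (_* g z) (⟦⟧-¬ (z ≟ 𝟎))) (r ⟦ z ≟ 𝟎 ⟧ (g z))) ⟩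
    ∑ (λ z → g z - ⟦ z ≟ 𝟎 ⟧ * g z)      ≡⟨ ∑-- g (λ z → ⟦ z ≟ 𝟎 ⟧ * g z) ⟩
    ∑ g - ∑ (λ z → ⟦ z ≟ 𝟎 ⟧ * g z)      ≡⟨ cong (λ t → ∑ g - t) (∑-δ 𝟎 g) ⟩
    ∑ g - g 𝟎                            ∎
    where
    open ≡-Reasoning
    r : ∀ d g → (1ℤ - d) * g ≡ g - d * g
    r = solve-∀

  -- For a ≠ b, multiplication by a - b permutes the units, so the count is that of units of trace
  -- 0, namely A - 1. For a = b every unit counts, and N - 1 = (A - 1) + (N - A).
  coincidences : ∀ a b → ∑ (λ z → ε z * ⟦ τ (z ⊗ a) ≟ τ (z ⊗ b) ⟧)
                         ≡ (+ A - 1ℤ) + ⟦ a ≟ b ⟧ * (+ N - + A)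
  coincidences a b with a ≟ b
  ... | yes refl = begin
    ∑ (λ z → ε z * ⟦ τ (z ⊗ a) ≟ τ (z ⊗ a) ⟧)
      ≡⟨ ∑-cong (λ z → trans (cong (ε z *_) (⟦⟧-yes (τ (z ⊗ a) ≟ τ (z ⊗ a)) refl)) (ℤP.*-identityʳ (ε z))) ⟩
    ∑ ε                            ≡⟨ ∑ε ⟩
    + M                            ≡⟨⟩
    + suc M - 1ℤ                   ≡⟨ cong (λ t → + t - 1ℤ) (sym N≡1+M) ⟩
    + N - 1ℤ                       ≡⟨ r (+ N) (+ A) ⟩
    (+ A - 1ℤ) + 1ℤ * (+ N - + A)  ∎
    where
    open ≡-Reasoning
    r : ∀ n a → n - 1ℤ ≡ (a - 1ℤ) + 1ℤ * (n - a)
    r = solve-∀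
  ... | no a≢b = begin
    ∑ (λ z → ε z * ⟦ τ (z ⊗ a) ≟ τ (z ⊗ b) ⟧)
      ≡⟨ ∑-cong (λ z → cong₂ _*_ (sym (ε-scale d≢0 z)) (⟦⟧-cong (to z) (from z) (τ (z ⊗ a) ≟ τ (z ⊗ b)) (τ (d ⊗ z) ≟ 𝟎))) ⟩
    ∑ (λ z → ε (d ⊗ z) * ⟦ τ (d ⊗ z) ≟ 𝟎 ⟧)
      ≡⟨ ∑-scale d≢0 (λ z → ε z * ⟦ τ z ≟ 𝟎 ⟧) ⟩
    ∑ (λ z → ε z * ⟦ τ z ≟ 𝟎 ⟧)
      ≡⟨ ∑-units (λ z → ⟦ τ z ≟ 𝟎 ⟧) ⟩
    ∑ (λ z → ⟦ τ z ≟ 𝟎 ⟧) - ⟦ τ 𝟎 ≟ 𝟎 ⟧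
      ≡⟨ cong₂ _-_ (τ-fibre scalar-𝟎) (⟦⟧-yes (τ 𝟎 ≟ 𝟎) τ-𝟎) ⟩
    + A - 1ℤ
      ≡⟨ ℤP.+-identityʳ _ ⟨
    (+ A - 1ℤ) + 0ℤ
      ≡⟨ cong (λ t → (+ A - 1ℤ) + t) (ℤP.*-zeroˡ (+ N - + A)) ⟨
    (+ A - 1ℤ) + 0ℤ * (+ N - + A) ∎
    where
    open ≡-Reasoning
    d = a ⊕ ⊝ b
    d≢0 : d ≢ 𝟎
    d≢0 = a≢b ∘ x⊝y≡𝟎⇒x≡y a b
    expand : ∀ z → d ⊗ z ≡ z ⊗ a ⊕ ⊝ (z ⊗ b)
    expand z = trans (*-comm d z) (trans (distribˡ z a (⊝ b)) (cong (z ⊗ a ⊕_) (sym (-‿distribʳ-* z b))))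
    to : ∀ z → τ (z ⊗ a) ≡ τ (z ⊗ b) → τ (d ⊗ z) ≡ 𝟎
    to z e = trans (cong τ (expand z)) (τ-⊝ (z ⊗ a) (z ⊗ b) e)
    from : ∀ z → τ (d ⊗ z) ≡ 𝟎 → τ (z ⊗ a) ≡ τ (z ⊗ b)
    from z e = τ-⊝⁻¹ (z ⊗ a) (z ⊗ b) (trans (cong τ (sym (expand z))) e)

  -- The map s is squaring with e = 2 for the sums over Tr(u²) = β, and the identity with e = 1 for
  -- the size of the quadric itself.
  module _ (s : Fin N → Fin N) (e : ℕ)
           (s-⊗ : ∀ x y → s (x ⊗ y) ≡ s x ⊗ s y) (s-unit : ∀ {x} → x ≢ 𝟎 → s x ≢ 𝟎)
           (s-fibre : ∀ y → ∑ (λ u → ⟦ s u ≟ y ⟧) ≤ + e)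
           (f : Fin N → ℤ) (f-kernel : Kernel f) (∑f≡0 : ∑ f ≡ 0ℤ) where
    open Kernel f-kernel

    private
      F : Fin N → Fin N → ℤ
      F b z = ∑ (λ u → ⟦ τ (z ⊗ s u) ≟ b ⟧ * f u)

      moment : Fin N → ℤ
      moment b = ∑ (λ z → ε z * (F b z * F b z))

      0≤moment : ∀ b → 0ℤ ≤ moment b
      0≤moment b = ∑-nonneg (λ z → *-nonneg (0≤ε z) (square-nonneg (F b z)))

      ∑f² : ∑ (λ u → f u * f u) ≡ + M * f 𝟏
      ∑f² = trans (∑-cong (λ w → cong (λ t → f w * f t) (sym (*-identityʳ w)))) (correlation 𝟏)

      0≤∑f² : 0ℤ ≤ ∑ (λ u → f u * f u)
      0≤∑f² = ∑-nonneg (λ u → square-nonneg (f u))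

      0≤A : 0ℤ ≤ + A
      0≤A = ℤ.+≤+ ℕ.z≤n

      0≤e : 0ℤ ≤ + e
      0≤e = ℤ.+≤+ ℕ.z≤n

      0<+M : 0ℤ < + M
      0<+M = ℤ.+<+ 0<M

      0≤f𝟏 : 0ℤ ≤ f 𝟏
      0≤f𝟏 = *-cancelˡ-≤ (+ M) 0<+M (subst₂ _≤_ (sym (ℤP.*-zeroʳ (+ M))) ∑f² 0≤∑f²)

      s-inv : ∀ w → w ≢ 𝟎 → ∀ u → s (inv w) ⊗ s (w ⊗ u) ≡ s u
      s-inv w w≢0 u = trans (sym (s-⊗ (inv w) (w ⊗ u))) (cong s (inv-cancelˡ w w≢0 u))

      -- 2 f(u) f(v) ≤ f(u)² + f(v)² separates the variables, and each u has at most e partners v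
      -- with s v = s u. Doubling both sides avoids halves.
      diagonal : ∑ (λ u → ∑ (λ v → ⟦ s u ≟ s v ⟧ * (f u * f v))) ≤ + e * ∑ (λ u → f u * f u)
      diagonal = *-cancelˡ-≤ (+ 2) (ℤ.+<+ (ℕ.s≤s ℕ.z≤n)) (begin
        + 2 * ∑ (λ u → ∑ (λ v → ⟦ s u ≟ s v ⟧ * (f u * f v)))
          ≡⟨ ∑-*ˡ (+ 2) (λ u → ∑ (λ v → ⟦ s u ≟ s v ⟧ * (f u * f v))) ⟩
        ∑ (λ u → + 2 * ∑ (λ v → ⟦ s u ≟ s v ⟧ * (f u * f v)))
          ≡⟨ ∑-cong (λ u → ∑-*ˡ (+ 2) (λ v → ⟦ s u ≟ s v ⟧ * (f u * f v))) ⟩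
        ∑ (λ u → ∑ (λ v → + 2 * (⟦ s u ≟ s v ⟧ * (f u * f v))))
          ≤⟨ ∑-mono (λ u → ∑-mono (λ v → pointwise u v)) ⟩
        ∑ (λ u → ∑ (λ v → ⟦ s v ≟ s u ⟧ * (f u * f u) + ⟦ s u ≟ s v ⟧ * (f v * f v)))
          ≡⟨ ∑-cong (λ u → ∑-+ (λ v → ⟦ s v ≟ s u ⟧ * (f u * f u)) (λ v → ⟦ s u ≟ s v ⟧ * (f v * f v))) ⟩
        ∑ (λ u → ∑ (λ v → ⟦ s v ≟ s u ⟧ * (f u * f u)) + ∑ (λ v → ⟦ s u ≟ s v ⟧ * (f v * f v)))
          ≡⟨ ∑-+ (λ u → ∑ (λ v → ⟦ s v ≟ s u ⟧ * (f u * f u))) (λ u → ∑ (λ v → ⟦ s u ≟ s v ⟧ * (f v * f v))) ⟩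
        ∑ (λ u → ∑ (λ v → ⟦ s v ≟ s u ⟧ * (f u * f u))) + ∑ (λ u → ∑ (λ v → ⟦ s u ≟ s v ⟧ * (f v * f v)))
          ≡⟨ cong (λ t → half + t) (∑-swap (λ u v → ⟦ s u ≟ s v ⟧ * (f v * f v))) ⟩
        half + half
          ≤⟨ ℤP.+-mono-≤ half≤ half≤ ⟩
        + e * ∑ (λ u → f u * f u) + + e * ∑ (λ u → f u * f u)
          ≡⟨ r (+ e * ∑ (λ u → f u * f u)) ⟩
        + 2 * (+ e * ∑ (λ u → f u * f u)) ∎)
        where
        open ℤP.≤-Reasoning
        r : ∀ x → x + x ≡ + 2 * x
        r = solve-∀
        half = ∑ (λ u → ∑ (λ v → ⟦ s v ≟ s u ⟧ * (f u * f u)))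
        half≤ : half ≤ + e * ∑ (λ u → f u * f u)
        half≤ = begin
          half                                                  ≡⟨ ∑-cong (λ u → ∑-*ʳ (f u * f u) (λ v → ⟦ s v ≟ s u ⟧)) ⟨
          ∑ (λ u → ∑ (λ v → ⟦ s v ≟ s u ⟧) * (f u * f u))       ≤⟨ ∑-mono (λ u → ℤP.*-monoʳ-≤-nonNeg (f u * f u) {{ℤ.nonNegative (square-nonneg (f u))}} (s-fibre (s u))) ⟩
          ∑ (λ u → + e * (f u * f u))                           ≡⟨ ∑-*ˡ (+ e) (λ u → f u * f u) ⟨
          + e * ∑ (λ u → f u * f u)                             ∎
        am-gm : ∀ x y → + 2 * (x * y) ≤ x * x + y * y
        am-gm x y = 2*-bound (square-nonneg x) (square-nonneg y) (ℤP.≤-reflexive (t x y))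
          where
          t : ∀ x y → (x * y) * (x * y) ≡ (x * x) * (y * y)
          t = solve-∀
        pointwise : ∀ u v → + 2 * (⟦ s u ≟ s v ⟧ * (f u * f v)) ≤ ⟦ s v ≟ s u ⟧ * (f u * f u) + ⟦ s u ≟ s v ⟧ * (f v * f v)
        pointwise u v = begin
          + 2 * (i * (f u * f v))               ≡⟨ a i (f u * f v) ⟩
          i * (+ 2 * (f u * f v))               ≤⟨ *-monoˡ-≤ i (0≤⟦⟧ (s u ≟ s v)) (am-gm (f u) (f v)) ⟩
          i * (f u * f u + f v * f v)           ≡⟨ ℤP.*-distribˡ-+ i (f u * f u) (f v * f v) ⟩
          i * (f u * f u) + i * (f v * f v)     ≡⟨ cong (λ t → t * (f u * f u) + i * (f v * f v)) (⟦⟧-cong sym sym (s u ≟ s v) (s v ≟ s u)) ⟩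
          ⟦ s v ≟ s u ⟧ * (f u * f u) + i * (f v * f v) ∎
          where
          i = ⟦ s u ≟ s v ⟧
          a : ∀ i x → + 2 * (i * x) ≡ i * (+ 2 * x)
          a = solve-∀

      -- The summation index b has to equal both traces. It runs over the whole field, so it is
      -- eliminated by a single `∑-δ`.
      ∑F² : ∀ z → ∑ (λ b → F b z * F b z) ≡ ∑ (λ u → ∑ (λ v → ⟦ τ (z ⊗ s u) ≟ τ (z ⊗ s v) ⟧ * (f u * f v)))
      ∑F² z = begin
        ∑ (λ b → F b z * F b z)
          ≡⟨ ∑-cong (λ b → ∑-product (λ u → i u b * f u) (λ v → i v b * f v)) ⟩
        ∑ (λ b → ∑ (λ u → ∑ (λ v → (i u b * f u) * (i v b * f v))))
          ≡⟨ ∑-swap (λ b u → ∑ (λ v → (i u b * f u) * (i v b * f v))) ⟩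
        ∑ (λ u → ∑ (λ b → ∑ (λ v → (i u b * f u) * (i v b * f v))))
          ≡⟨ ∑-cong (λ u → ∑-swap (λ b v → (i u b * f u) * (i v b * f v))) ⟩
        ∑ (λ u → ∑ (λ v → ∑ (λ b → (i u b * f u) * (i v b * f v))))
          ≡⟨ ∑-cong (λ u → ∑-cong (λ v → ∑-cong (λ b → trans (r (i u b) (f u) (i v b) (f v))
               (cong (_* (i v b * (f u * f v))) (⟦⟧-cong sym sym (τ (z ⊗ s u) ≟ b) (b ≟ τ (z ⊗ s u))))))) ⟩
        ∑ (λ u → ∑ (λ v → ∑ (λ b → ⟦ b ≟ τ (z ⊗ s u) ⟧ * (i v b * (f u * f v)))))
          ≡⟨ ∑-cong (λ u → ∑-cong (λ v → ∑-δ (τ (z ⊗ s u)) (λ b → i v b * (f u * f v)))) ⟩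
        ∑ (λ u → ∑ (λ v → i v (τ (z ⊗ s u)) * (f u * f v)))
          ≡⟨ ∑-cong (λ u → ∑-cong (λ v → cong (_* (f u * f v)) (⟦⟧-cong sym sym (τ (z ⊗ s v) ≟ τ (z ⊗ s u)) (τ (z ⊗ s u) ≟ τ (z ⊗ s v))))) ⟩
        ∑ (λ u → ∑ (λ v → ⟦ τ (z ⊗ s u) ≟ τ (z ⊗ s v) ⟧ * (f u * f v))) ∎
        where
        open ≡-Reasoning
        i : Fin N → Fin N → ℤ
        i u b = ⟦ τ (z ⊗ s u) ≟ b ⟧
        r : ∀ i a j b → (i * a) * (j * b) ≡ i * (j * (a * b))
        r = solve-∀

      -- The constant A - 1 in `coincidences` is multiplied by (∑ f)² = 0; what is left is N - A
      -- times the diagonal.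
      total-moment : ∑ moment ≡ (+ N - + A) * ∑ (λ u → ∑ (λ v → ⟦ s u ≟ s v ⟧ * (f u * f v)))
      total-moment = begin
        ∑ (λ b → ∑ (λ z → ε z * (F b z * F b z)))
          ≡⟨ ∑-swap (λ b z → ε z * (F b z * F b z)) ⟩
        ∑ (λ z → ∑ (λ b → ε z * (F b z * F b z)))
          ≡⟨ ∑-cong (λ z → ∑-*ˡ (ε z) (λ b → F b z * F b z)) ⟨
        ∑ (λ z → ε z * ∑ (λ b → F b z * F b z))
          ≡⟨ ∑-cong (λ z → cong (ε z *_) (∑F² z)) ⟩
        ∑ (λ z → ε z * ∑ (λ u → ∑ (λ v → j z u v * (f u * f v))))
          ≡⟨ ∑-cong (λ z → trans (∑-*ˡ (ε z) (λ u → ∑ (λ v → j z u v * (f u * f v))))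
               (∑-cong (λ u → trans (∑-*ˡ (ε z) (λ v → j z u v * (f u * f v)))
                 (∑-cong (λ v → r (ε z) (j z u v) (f u * f v)))))) ⟩
        ∑ (λ z → ∑ (λ u → ∑ (λ v → (f u * f v) * (ε z * j z u v))))
          ≡⟨ ∑-swap (λ z u → ∑ (λ v → (f u * f v) * (ε z * j z u v))) ⟩
        ∑ (λ u → ∑ (λ z → ∑ (λ v → (f u * f v) * (ε z * j z u v))))
          ≡⟨ ∑-cong (λ u → ∑-swap (λ z v → (f u * f v) * (ε z * j z u v))) ⟩
        ∑ (λ u → ∑ (λ v → ∑ (λ z → (f u * f v) * (ε z * j z u v))))
          ≡⟨ ∑-cong (λ u → ∑-cong (λ v → ∑-*ˡ (f u * f v) (λ z → ε z * j z u v))) ⟨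
        ∑ (λ u → ∑ (λ v → (f u * f v) * ∑ (λ z → ε z * j z u v)))
          ≡⟨ ∑-cong (λ u → ∑-cong (λ v → trans (cong ((f u * f v) *_) (coincidences (s u) (s v)))
               (t (f u) (f v) (+ A - 1ℤ) ⟦ s u ≟ s v ⟧ (+ N - + A)))) ⟩
        ∑ (λ u → ∑ (λ v → f u * (f v * (+ A - 1ℤ)) + (+ N - + A) * (⟦ s u ≟ s v ⟧ * (f u * f v))))
          ≡⟨ ∑-cong (λ u → trans (∑-+ (λ v → f u * (f v * (+ A - 1ℤ))) (λ v → (+ N - + A) * (⟦ s u ≟ s v ⟧ * (f u * f v))))
               (cong₂ _+_ (inner u) (sym (∑-*ˡ (+ N - + A) (λ v → ⟦ s u ≟ s v ⟧ * (f u * f v)))))) ⟩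
        ∑ (λ u → 0ℤ + (+ N - + A) * ∑ (λ v → ⟦ s u ≟ s v ⟧ * (f u * f v)))
          ≡⟨ ∑-cong (λ u → ℤP.+-identityˡ _) ⟩
        ∑ (λ u → (+ N - + A) * ∑ (λ v → ⟦ s u ≟ s v ⟧ * (f u * f v)))
          ≡⟨ ∑-*ˡ (+ N - + A) (λ u → ∑ (λ v → ⟦ s u ≟ s v ⟧ * (f u * f v))) ⟨
        (+ N - + A) * ∑ (λ u → ∑ (λ v → ⟦ s u ≟ s v ⟧ * (f u * f v))) ∎
        where
        open ≡-Reasoning
        j : Fin N → Fin N → Fin N → ℤ
        j z u v = ⟦ τ (z ⊗ s u) ≟ τ (z ⊗ s v) ⟧
        r : ∀ e i x → e * (i * x) ≡ x * (e * i)
        r = solve-∀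
        t : ∀ a b c i d → (a * b) * (c + i * d) ≡ a * (b * c) + d * (i * (a * b))
        t = solve-∀
        inner : ∀ u → ∑ (λ v → f u * (f v * (+ A - 1ℤ))) ≡ 0ℤ
        inner u = begin
          ∑ (λ v → f u * (f v * (+ A - 1ℤ)))   ≡⟨ ∑-*ˡ (f u) (λ v → f v * (+ A - 1ℤ)) ⟨
          f u * ∑ (λ v → f v * (+ A - 1ℤ))     ≡⟨ cong (f u *_) (∑-*ʳ (+ A - 1ℤ) f) ⟨
          f u * (∑ f * (+ A - 1ℤ))             ≡⟨ cong (λ t → f u * (t * (+ A - 1ℤ))) ∑f≡0 ⟩
          f u * (0ℤ * (+ A - 1ℤ))              ≡⟨ trans (cong (f u *_) (ℤP.*-zeroˡ (+ A - 1ℤ))) (ℤP.*-zeroʳ (f u)) ⟩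
          0ℤ                                   ∎

      -- Since t = β/b is a scalar, the trace is linear in it, and z ↦ tz carries the condition for
      -- b to the condition for β.
      moment-scale : ∀ {b β} → Scalar b → Scalar β → b ≢ 𝟎 → β ≢ 𝟎 → moment b ≡ moment β
      moment-scale {b} {β} b∈ β∈ b≢0 β≢0 = begin
        ∑ (λ z → ε z * (F b z * F b z))
          ≡⟨ ∑-cong (λ z → cong₂ (λ s t → s * (t * t)) (sym (ε-scale t≢0 z)) (F-scale z)) ⟩
        ∑ (λ z → ε (t ⊗ z) * (F β (t ⊗ z) * F β (t ⊗ z)))
          ≡⟨ ∑-scale t≢0 (λ z → ε z * (F β z * F β z)) ⟩
        ∑ (λ z → ε z * (F β z * F β z)) ∎
        where
        open ≡-Reasoning
        t = β ⊗ inv b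
        t≢0 : t ≢ 𝟎
        t≢0 = ⊗-nonzero β≢0 (inv-nonzero b≢0)
        tb≡β : t ⊗ b ≡ β
        tb≡β = trans (*-assoc β (inv b) b) (trans (cong (β ⊗_) (trans (*-comm (inv b) b) (⊗-inv b b≢0))) (*-identityʳ β))
        τ-t : ∀ z u → τ ((t ⊗ z) ⊗ s u) ≡ t ⊗ τ (z ⊗ s u)
        τ-t z u = trans (cong τ (*-assoc t z (s u))) (τ-linear (scalar-/ β∈ b∈) (z ⊗ s u))
        F-scale : ∀ z → F b z ≡ F β (t ⊗ z)
        F-scale z = ∑-cong (λ u → cong (_* f u) (⟦⟧-cong
          (λ h → trans (τ-t z u) (trans (cong (t ⊗_) h) tb≡β))
          (λ h → ⊗-cancelˡ t t≢0 (trans (sym (τ-t z u)) (trans h (sym tb≡β))))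
          (τ (z ⊗ s u) ≟ b) (τ ((t ⊗ z) ⊗ s u) ≟ β)))

      -- All nonzero scalars b have the same moment, so each has at most 1/(q-1) of the total.
      moment-bound : ∀ {β} → Scalar β → β ≢ 𝟎 → moment β ≤ + A * (+ e * (+ M * f 𝟏))
      moment-bound {β} β∈ β≢0 = *-cancelˡ-≤ q-1 0<q-1 (begin
        q-1 * moment β
          ≡⟨ cong (_* moment β) nonzero-scalars ⟨
        ∑ (λ b → ε b * ⟦ scalar? b ⟧) * moment β
          ≡⟨ ∑-*ʳ (moment β) (λ b → ε b * ⟦ scalar? b ⟧) ⟩
        ∑ (λ b → (ε b * ⟦ scalar? b ⟧) * moment β)
          ≤⟨ ∑-mono pointwise ⟩
        ∑ moment
          ≡⟨ total-moment ⟩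
        (+ N - + A) * ∑ (λ u → ∑ (λ v → ⟦ s u ≟ s v ⟧ * (f u * f v)))
          ≤⟨ *-monoˡ-≤ (+ N - + A) 0≤N-A diagonal ⟩
        (+ N - + A) * (+ e * ∑ (λ u → f u * f u))
          ≡⟨ cong₂ (λ s t → s * (+ e * t)) N-A ∑f² ⟩
        (q-1 * + A) * (+ e * (+ M * f 𝟏))
          ≡⟨ ℤP.*-assoc q-1 (+ A) (+ e * (+ M * f 𝟏)) ⟩
        q-1 * (+ A * (+ e * (+ M * f 𝟏))) ∎)
        where
        open ℤP.≤-Reasoning
        nonzero-scalars : ∑ (λ b → ε b * ⟦ scalar? b ⟧) ≡ q-1
        nonzero-scalars = trans (∑-units (λ b → ⟦ scalar? b ⟧)) (cong₂ _-_ #scalars (⟦⟧-yes (scalar? 𝟎) scalar-𝟎))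
        N-A : + N - + A ≡ q-1 * + A
        N-A = trans (cong (λ t → t - + A) size) (r (+ q) (+ A))
          where
          r : ∀ q a → q * a - a ≡ (q - 1ℤ) * a
          r = solve-∀
        0≤N-A : 0ℤ ≤ + N - + A
        0≤N-A = subst (0ℤ ≤_) (sym N-A) (*-nonneg (ℤP.<⇒≤ 0<q-1) 0≤A)
        pointwise : ∀ b → (ε b * ⟦ scalar? b ⟧) * moment β ≤ moment b
        pointwise b with scalar? b | b ≟ 𝟎
        ... | yes b∈ | no b≢0 = ℤP.≤-reflexive (trans (ℤP.*-identityˡ (moment β)) (moment-scale β∈ b∈ β≢0 b≢0))
        ... | yes _  | yes _  = subst (_≤ moment b) (sym (ℤP.*-zeroˡ (moment β))) (0≤moment b)
        ... | no _   | yes _  = subst (_≤ moment b) (sym (ℤP.*-zeroˡ (moment β))) (0≤moment b)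
        ... | no _   | no _   = subst (_≤ moment b) (sym (ℤP.*-zeroˡ (moment β))) (0≤moment b)

      -- Translating u by w turns the correlation identity for f into an expression
      -- of the sum at z = 1 through the sums at z = s(w⁻¹).
      recover : ∀ β → + M * ∑ (λ u → ⟦ τ (s u) ≟ β ⟧ * f u) ≡ ∑ (λ w → f w * (ε w * F β (s (inv w))))
      recover β = begin
        + M * ∑ (λ u → i u * f u)
          ≡⟨ ∑-*ˡ (+ M) (λ u → i u * f u) ⟩
        ∑ (λ u → + M * (i u * f u))
          ≡⟨ ∑-cong (λ u → trans (r (+ M) (i u) (f u)) (cong (i u *_) (sym (correlation u)))) ⟩
        ∑ (λ u → i u * ∑ (λ w → f w * f (w ⊗ u)))
          ≡⟨ ∑-cong (λ u → ∑-*ˡ (i u) (λ w → f w * f (w ⊗ u))) ⟩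
        ∑ (λ u → ∑ (λ w → i u * (f w * f (w ⊗ u))))
          ≡⟨ ∑-swap (λ u w → i u * (f w * f (w ⊗ u))) ⟩
        ∑ (λ w → ∑ (λ u → i u * (f w * f (w ⊗ u))))
          ≡⟨ ∑-cong (λ w → trans (∑-cong (λ u → r′ (i u) (f w) (f (w ⊗ u)))) (sym (∑-*ˡ (f w) (λ u → i u * f (w ⊗ u))))) ⟩
        ∑ (λ w → f w * ∑ (λ u → i u * f (w ⊗ u)))
          -- Because f vanishes at `𝟎`, the factor `ε w` can be inserted freely; it makes the sum of
          -- squares in the later estimate a sum over units, comparable with `moment`.
          ≡⟨ ∑-cong (on-units (λ w → f w * ∑ (λ u → i u * f (w ⊗ u))) (λ w → f w * (ε w * F β (s (inv w))))
               (vanish _) (vanish _) (λ w w≢0 → cong (f w *_) (unit w w≢0))) ⟩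
        ∑ (λ w → f w * (ε w * F β (s (inv w)))) ∎
        where
        open ≡-Reasoning
        i : Fin N → ℤ
        i u = ⟦ τ (s u) ≟ β ⟧
        r : ∀ m i f → m * (i * f) ≡ i * (m * f)
        r = solve-∀
        r′ : ∀ i a b → i * (a * b) ≡ a * (i * b)
        r′ = solve-∀
        vanish : ∀ a → f 𝟎 * a ≡ 0ℤ
        vanish a = trans (cong (_* a) at-𝟎) (ℤP.*-zeroˡ a)
        unit : ∀ w → w ≢ 𝟎 → ∑ (λ u → i u * f (w ⊗ u)) ≡ ε w * F β (s (inv w))
        unit w w≢0 = begin
          ∑ (λ u → i u * f (w ⊗ u))
            ≡⟨ ∑-cong (λ u → cong (λ t → ⟦ τ t ≟ β ⟧ * f (w ⊗ u)) (sym (s-inv w w≢0 u))) ⟩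
          ∑ (λ u → ⟦ τ (s (inv w) ⊗ s (w ⊗ u)) ≟ β ⟧ * f (w ⊗ u))
            ≡⟨ ∑-scale w≢0 (λ u → ⟦ τ (s (inv w) ⊗ s u) ≟ β ⟧ * f u) ⟩
          F β (s (inv w))
            ≡⟨ ℤP.*-identityˡ _ ⟨
          1ℤ * F β (s (inv w))
            ≡⟨ cong (_* F β (s (inv w))) (ε-unit w≢0) ⟨
          ε w * F β (s (inv w)) ∎

      ε-inv : ∀ w → ε (inv w) ≡ ε w
      ε-inv w = ⟦⟧-cong (λ { h refl → h inv-𝟎 }) inv-nonzero (¬? (inv w ≟ 𝟎)) (¬? (w ≟ 𝟎))

      -- Inversion followed by s sends units to units and takes each value z at most e times, so the
      -- sum over w counts each z at most e times.
      pulled-back : ∀ β → ∑ (λ w → (ε w * F β (s (inv w))) * (ε w * F β (s (inv w)))) ≤ + e * moment β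
      pulled-back β = begin
        ∑ (λ w → (ε w * F β (s (inv w))) * (ε w * F β (s (inv w))))
          ≡⟨ ∑-cong (λ w → trans (r (ε w) (F β (s (inv w)))) (cong₂ _*_ (trans (⟦⟧-idem (¬? (w ≟ 𝟎))) (sym (ε-inv w))) refl)) ⟩
        ∑ (λ w → ε (inv w) * G (s (inv w)))
          ≡⟨ ∑-reindex inv inv inv-involutive inv-involutive (λ w → ε w * G (s w)) ⟩
        ∑ (λ w → ε w * G (s w))
          ≡⟨ ∑-cong (λ w → ∑-δ (s w) (λ z → ε w * G z)) ⟨
        ∑ (λ w → ∑ (λ z → ⟦ z ≟ s w ⟧ * (ε w * G z)))
          ≤⟨ ∑-mono (λ w → ∑-mono (λ z → pointwise w z)) ⟩
        ∑ (λ w → ∑ (λ z → ⟦ s w ≟ z ⟧ * (ε z * G z)))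
          ≡⟨ ∑-swap (λ w z → ⟦ s w ≟ z ⟧ * (ε z * G z)) ⟩
        ∑ (λ z → ∑ (λ w → ⟦ s w ≟ z ⟧ * (ε z * G z)))
          ≡⟨ ∑-cong (λ z → ∑-*ʳ (ε z * G z) (λ w → ⟦ s w ≟ z ⟧)) ⟨
        ∑ (λ z → ∑ (λ w → ⟦ s w ≟ z ⟧) * (ε z * G z))
          ≤⟨ ∑-mono (λ z → ℤP.*-monoʳ-≤-nonNeg (ε z * G z) {{ℤ.nonNegative (*-nonneg (0≤ε z) (square-nonneg (F β z)))}} (s-fibre z)) ⟩
        ∑ (λ z → + e * (ε z * G z))
          ≡⟨ ∑-*ˡ (+ e) (λ z → ε z * G z) ⟨
        + e * moment β ∎
        where
        open ℤP.≤-Reasoning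
        G : Fin N → ℤ
        G z = F β z * F β z
        r : ∀ a b → (a * b) * (a * b) ≡ (a * a) * (b * b)
        r = solve-∀
        pointwise : ∀ w z → ⟦ z ≟ s w ⟧ * (ε w * G z) ≤ ⟦ s w ≟ z ⟧ * (ε z * G z)
        pointwise w z = begin
          ⟦ z ≟ s w ⟧ * (ε w * G z)   ≤⟨ ⟦⟧-*-mono (z ≟ s w) (λ { refl → ℤP.*-monoʳ-≤-nonNeg (G z) {{ℤ.nonNegative (square-nonneg (F β z))}}
                                            (⟦⟧-mono s-unit (¬? (w ≟ 𝟎)) (¬? (z ≟ 𝟎))) }) ⟩
          ⟦ z ≟ s w ⟧ * (ε z * G z)   ≡⟨ cong (_* (ε z * G z)) (⟦⟧-cong sym sym (z ≟ s w) (s w ≟ z)) ⟩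
          ⟦ s w ≟ z ⟧ * (ε z * G z)   ∎

    -- For T the sum in question, (MT)² ≤ (∑ f²) e `moment β` ≤ (M f(1)) e (A e M f(1)) = (M e
    -- f(1))² A. Both copies of M f(1) come from the correlation at u = 1, which is why M cancels
    -- exactly and f(1) survives as the number of characters.
    character-sum-bound : ∀ {β} → Scalar β → β ≢ 𝟎 →
      ∑ (λ u → ⟦ τ (s u) ≟ β ⟧ * f u) ∣≤ + e * f 𝟏 √ + A
    character-sum-bound {β} β∈ β≢0 = √-cancel (+ M) 0<+M 0≤ef (sqrt-bound (*-nonneg (ℤP.<⇒≤ 0<+M) 0≤ef) (begin
      (+ M * T) * (+ M * T)
        ≡⟨ cong₂ _*_ (recover β) (recover β) ⟩
      ∑ (λ w → f w * g w) * ∑ (λ w → f w * g w)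
        ≤⟨ Sums.cauchy-schwarz f g ⟩
      ∑ (λ w → f w * f w) * ∑ (λ w → g w * g w)
        ≤⟨ *-monoˡ-≤ (∑ (λ w → f w * f w)) 0≤∑f² (pulled-back β) ⟩
      ∑ (λ w → f w * f w) * (+ e * moment β)
        ≤⟨ *-monoˡ-≤ (∑ (λ w → f w * f w)) 0≤∑f² (*-monoˡ-≤ (+ e) 0≤e (moment-bound β∈ β≢0)) ⟩
      ∑ (λ w → f w * f w) * (+ e * (+ A * (+ e * (+ M * f 𝟏))))
        ≡⟨ cong (_* (+ e * (+ A * (+ e * (+ M * f 𝟏))))) ∑f² ⟩
      (+ M * f 𝟏) * (+ e * (+ A * (+ e * (+ M * f 𝟏))))
        ≡⟨ r (+ M) (f 𝟏) (+ e) (+ A) ⟩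
      (+ M * (+ e * f 𝟏)) * (+ M * (+ e * f 𝟏)) * + A ∎))
      where
      open ℤP.≤-Reasoning
      T = ∑ (λ u → ⟦ τ (s u) ≟ β ⟧ * f u)
      g : Fin N → ℤ
      g w = ε w * F β (s (inv w))
      0≤ef : 0ℤ ≤ + e * f 𝟏
      0≤ef = *-nonneg 0≤e 0≤f𝟏
      r : ∀ m f e a → (m * f) * (e * (a * (e * (m * f)))) ≡ (m * (e * f)) * (m * (e * f)) * a
      r = solve-∀

-- Additivity of the Frobenius map

module BinomialDivisibility where
  open import Data.Nat.Base using (_!; _<_; _∸_; _*_; s≤s)
  open import Data.Nat.Properties using (_!*_!≢0)

  prime∤! : ∀ {p} → Prime p → ∀ k → k < p → ¬ (p ∣ k !)
  prime∤! {p} pr zero    _   p∣1 = ℕP.<-irrefl (sym (∣1⇒≡1 p∣1)) (ℕ.nonTrivial⇒n>1 p {{prime⇒nonTrivial pr}})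
  prime∤! {p} pr (suc k) k<p p∣ with euclidsLemma (suc k) (k !) pr p∣
  ... | inj₁ p∣1+k = >⇒∤ k<p p∣1+k
  ... | inj₂ p∣k!  = prime∤! pr k (ℕP.<-trans (ℕP.n<1+n k) k<p) p∣k!

  -- The prime p divides p! = C(p,k) k! (p-k)!, but neither of the two factorials.
  prime∣C : ∀ {p} → Prime p → ∀ k → 0 < k → k < p → p ∣ (p C k)
  prime∣C {p@(suc p-1)} pr k@(suc k-1) _ k<p with euclidsLemma (p C k) (k ! * (p ∸ k) !) pr p∣product
    where
    instance
      denominator≢0 : NonZero (k ! * (p ∸ k) !)
      denominator≢0 = k !* (p ∸ k) !≢0
    C*denominator : (p C k) * (k ! * (p ∸ k) !) ≡ p !
    C*denominator = trans (cong (_* (k ! * (p ∸ k) !)) (nCk≡n!/k![n-k]! (ℕP.<⇒≤ k<p)))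
      (m/n*n≡m (k![n∸k]!∣n! (ℕP.<⇒≤ k<p)))
    p∣product : p ∣ (p C k) * (k ! * (p ∸ k) !)
    p∣product = subst (p ∣_) (sym C*denominator) (m∣m*n (p-1 !))
  ... | inj₁ p∣C = p∣C
  ... | inj₂ p∣d with euclidsLemma (k !) ((p ∸ k) !) pr p∣d
  ... | inj₁ p∣k!     = ⊥-elim (prime∤! pr k k<p p∣k!)
  ... | inj₂ p∣[p-k]! = ⊥-elim (prime∤! pr (p ∸ k) (s≤s (ℕP.m∸n≤m p-1 k-1)) p∣[p-k]!)

module Frobenius {N : ℕ} (K : FinField N) (p : ℕ) (p-prime : Prime p) where
  open FieldArithmetic K
  open Fermat K
  open BinomialDivisibility
  open import Algebra.Properties.CommutativeSemiring.Binomial commutativeSemiring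
    using () renaming (theorem to binomial-theorem; binomialTerm to term)
  open import Algebra.Properties.Semiring.Mult semiring using (×-assoc-*; ×1-homo-*)
  open import Algebra.Properties.Monoid.Mult +-monoid using (×-homo-1)
  open import Algebra.Properties.CommutativeMonoid.Sum +-commutativeMonoid using (sum; sum-init-last; sum-cong-≗; sum-replicate-zero)

  p^j⋆𝟏 : ∀ j → (p ℕ.^ j) ⋆ 𝟏 ≡ (p ⋆ 𝟏) ↑ j
  p^j⋆𝟏 zero    = ×-homo-1 𝟏
  p^j⋆𝟏 (suc j) = trans (×1-homo-* p (p ℕ.^ j)) (cong ((p ⋆ 𝟏) ⊗_) (p^j⋆𝟏 j))

  -- The element N·1 = (p·1)^j is 0, and a field has no nonzero nilpotents.
  p⋆𝟏≡𝟎 : ∀ j → N ≡ p ℕ.^ j → p ⋆ 𝟏 ≡ 𝟎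
  p⋆𝟏≡𝟎 j N≡p^j with p ⋆ 𝟏 ≟ 𝟎
  ... | yes e = e
  ... | no ne = ⊥-elim (↑-nonzero j ne (trans (sym (p^j⋆𝟏 j)) (trans (cong (_⋆ 𝟏) (sym N≡p^j)) N⋆𝟏≡𝟎)))

  module _ (char-p : p ⋆ 𝟏 ≡ 𝟎) where

    multiple-vanishes : ∀ {m} → p ∣ m → ∀ x → m ⋆ x ≡ 𝟎
    multiple-vanishes {m} (divides k refl) x = begin
      (k ℕ.* p) ⋆ x         ≡⟨ cong ((k ℕ.* p) ⋆_) (*-identityˡ x) ⟨
      (k ℕ.* p) ⋆ (𝟏 ⊗ x)   ≡⟨ ×-assoc-* (k ℕ.* p) 𝟏 x ⟨
      (k ℕ.* p) ⋆ 𝟏 ⊗ x     ≡⟨ cong (_⊗ x) (×1-homo-* k p) ⟩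
      k ⋆ 𝟏 ⊗ p ⋆ 𝟏 ⊗ x     ≡⟨ cong (λ t → k ⋆ 𝟏 ⊗ t ⊗ x) char-p ⟩
      k ⋆ 𝟏 ⊗ 𝟎 ⊗ x         ≡⟨ trans (cong (_⊗ x) (zeroʳ (k ⋆ 𝟏))) (zeroˡ x) ⟩
      𝟎                     ∎
      where
      open ≡-Reasoning

    private
      frobenius′ : ∀ p′ → p ≡ suc p′ → ∀ x y → (x ⊕ y) ↑ p ≡ x ↑ p ⊕ y ↑ p
      frobenius′ p′ refl x y = begin
        (x ⊕ y) ↑ p                                        ≡⟨ binomial-theorem p x y ⟩
        t zero ⊕ sum (t ∘ suc)                             ≡⟨ cong (t zero ⊕_) (sum-init-last (t ∘ suc)) ⟩
        t zero ⊕ (sum (t ∘ suc ∘ Fin.inject₁) ⊕ t (suc (Fin.fromℕ p′)))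
          ≡⟨ cong₂ _⊕_ first (cong₂ _⊕_ (trans (sum-cong-≗ middle) (sum-replicate-zero p′)) last) ⟩
        y ↑ p ⊕ (𝟎 ⊕ x ↑ p)                                ≡⟨ cong (y ↑ p ⊕_) (+-identityˡ (x ↑ p)) ⟩
        y ↑ p ⊕ x ↑ p                                      ≡⟨ +-comm (y ↑ p) (x ↑ p) ⟩
        x ↑ p ⊕ y ↑ p                                      ∎
        where
        open ≡-Reasoning
        t : Fin (suc p) → Fin N
        t = term x y p
        first : t zero ≡ y ↑ p
        first = trans (×-homo-1 _) (*-identityˡ (y ↑ p))
        middle : ∀ (i : Fin p′) → t (suc (Fin.inject₁ i)) ≡ 𝟎
        middle i = multiple-vanishes (prime∣C p-prime _ (ℕ.s≤s ℕ.z≤n)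
          (ℕ.s≤s (subst (ℕ._< p′) (sym (FinP.toℕ-inject₁ i)) (FinP.toℕ<n i)))) _
        last : t (suc (Fin.fromℕ p′)) ≡ x ↑ p
        last = begin
          (p C suc (Fin.toℕ (Fin.fromℕ p′))) ⋆ (x ↑ suc (Fin.toℕ (Fin.fromℕ p′)) ⊗ y ↑ (p ℕ.∸ suc (Fin.toℕ (Fin.fromℕ p′))))
            ≡⟨ cong (λ j → (p C suc j) ⋆ (x ↑ suc j ⊗ y ↑ (p ℕ.∸ suc j))) (FinP.toℕ-fromℕ p′) ⟩
          (p C p) ⋆ (x ↑ p ⊗ y ↑ (p ℕ.∸ p))
            ≡⟨ cong₂ (λ i j → i ⋆ (x ↑ p ⊗ y ↑ j)) (nCn≡1 p) (ℕP.n∸n≡0 p) ⟩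
          1 ⋆ (x ↑ p ⊗ 𝟏)
            ≡⟨ trans (×-homo-1 _) (*-identityʳ (x ↑ p)) ⟩
          x ↑ p ∎

    frobenius : ∀ x y → (x ⊕ y) ↑ p ≡ x ↑ p ⊕ y ↑ p
    frobenius = frobenius′ (ℕ.pred p) (sym (ℕP.suc-pred p {{prime⇒nonZero p-prime}}))

    frobenius^ : ∀ j x y → (x ⊕ y) ↑ (p ℕ.^ j) ≡ x ↑ (p ℕ.^ j) ⊕ y ↑ (p ℕ.^ j)
    frobenius^ zero    x y = trans (*-identityʳ _) (sym (cong₂ _⊕_ (*-identityʳ x) (*-identityʳ y)))
    frobenius^ (suc j) x y = begin
      (x ⊕ y) ↑ (p ℕ.* p ℕ.^ j)                         ≡⟨ ^-assocʳ (x ⊕ y) p (p ℕ.^ j) ⟨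
      ((x ⊕ y) ↑ p) ↑ (p ℕ.^ j)                         ≡⟨ cong (_↑ (p ℕ.^ j)) (frobenius x y) ⟩
      (x ↑ p ⊕ y ↑ p) ↑ (p ℕ.^ j)                       ≡⟨ frobenius^ j (x ↑ p) (y ↑ p) ⟩
      (x ↑ p) ↑ (p ℕ.^ j) ⊕ (y ↑ p) ↑ (p ℕ.^ j)         ≡⟨ cong₂ _⊕_ (^-assocʳ x p (p ℕ.^ j)) (^-assocʳ y p (p ℕ.^ j)) ⟩
      x ↑ (p ℕ.* p ℕ.^ j) ⊕ y ↑ (p ℕ.* p ℕ.^ j)         ∎
      where
      open ≡-Reasoning

-- The trace: linearity, values and fibres

module FieldTrace {N : ℕ} (K : FinField N) (p k n : ℕ) (p-prime : Prime p) (1≤k : 1 ℕ.≤ k)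
                  (N≡q^1+n : N ≡ (p ℕ.^ k) ℕ.^ suc n) where
  open FieldArithmetic K
  open FieldSums N
  open RootBound K
  open Indicators
  open IntegerInequalities
  open Fermat K
  open Frobenius K p p-prime
  open import Data.Integer using (_*_; _≤_; _<_)

  q A : ℕ
  q = p ℕ.^ k
  A = q ℕ.^ n

  private
    1<p : 1 ℕ.< p
    1<p = ℕ.nonTrivial⇒n>1 p {{prime⇒nonTrivial p-prime}}

  1<q : 1 ℕ.< q
  1<q = ℕP.^-monoʳ-< p 1<p 1≤k

  private
    instance
      q-nonZero : NonZero q
      q-nonZero = ℕ.>-nonZero (ℕP.<-trans (ℕ.s≤s ℕ.z≤n) 1<q)
      A-nonZero : NonZero A
      A-nonZero = ℕP.m^n≢0 q n
      N-nonZero : NonZero N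
      N-nonZero = subst NonZero (sym N≡q^1+n) (ℕP.m^n≢0 q (suc n))

    frobenius-q^ : ∀ i x y → (x ⊕ y) ↑ (q ℕ.^ i) ≡ x ↑ (q ℕ.^ i) ⊕ y ↑ (q ℕ.^ i)
    frobenius-q^ i x y = subst (λ j → (x ⊕ y) ↑ j ≡ x ↑ j ⊕ y ↑ j) (sym (ℕP.^-*-assoc p k i))
      (frobenius^ (p⋆𝟏≡𝟎 (k ℕ.* suc n) (trans N≡q^1+n (ℕP.^-*-assoc p k (suc n)))) (k ℕ.* i) x y)

    frobenius-q : ∀ x y → (x ⊕ y) ↑ q ≡ x ↑ q ⊕ y ↑ q
    frobenius-q x y = subst (λ j → (x ⊕ y) ↑ j ≡ x ↑ j ⊕ y ↑ j) (ℕP.*-identityʳ q) (frobenius-q^ 1 x y)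

  Scalar : Fin N → Set
  Scalar t = t ↑ q ≡ t

  scalar? : ∀ t → Dec (Scalar t)
  scalar? t = t ↑ q ≟ t

  scalar-𝟎 : Scalar 𝟎
  scalar-𝟎 = 𝟎↑ q

  scalar-inv : ∀ {y} → Scalar y → Scalar (inv y)
  scalar-inv {y} y∈ with y ≟ 𝟎
  ... | yes refl = subst Scalar (sym inv-𝟎) scalar-𝟎
  ... | no y≢0   = ⊗-cancelˡ y y≢0 (begin
    y ⊗ inv y ↑ q        ≡⟨ cong (_⊗ inv y ↑ q) y∈ ⟨
    y ↑ q ⊗ inv y ↑ q    ≡⟨ ^-distrib-* y (inv y) q ⟨
    (y ⊗ inv y) ↑ q      ≡⟨ cong (_↑ q) (⊗-inv y y≢0) ⟩
    𝟏 ↑ q                ≡⟨ 𝟏↑ q ⟩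
    𝟏                    ≡⟨ ⊗-inv y y≢0 ⟨
    y ⊗ inv y            ∎)
    where
    open ≡-Reasoning

  partialTrace : ℕ → Fin N → Fin N
  partialTrace zero    x = 𝟎
  partialTrace (suc i) x = partialTrace i x ⊕ x ↑ (q ℕ.^ i)

  partialTrace-⊕ : ∀ i x y → partialTrace i (x ⊕ y) ≡ partialTrace i x ⊕ partialTrace i y
  partialTrace-⊕ zero    x y = sym (+-identityˡ 𝟎)
  partialTrace-⊕ (suc i) x y = trans (cong₂ _⊕_ (partialTrace-⊕ i x y) (frobenius-q^ i x y))
    (solve 4 (λ a b c d → (a :+ b) :+ (c :+ d) := (a :+ c) :+ (b :+ d)) refl
      (partialTrace i x) (partialTrace i y) (x ↑ (q ℕ.^ i)) (y ↑ (q ℕ.^ i)))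
    where
    open KSolver

  scalar-↑ : ∀ {t} → Scalar t → ∀ i → t ↑ (q ℕ.^ i) ≡ t
  scalar-↑ {t} t∈ zero    = *-identityʳ t
  scalar-↑ {t} t∈ (suc i) = trans (sym (^-assocʳ t q (q ℕ.^ i))) (trans (cong (_↑ (q ℕ.^ i)) t∈) (scalar-↑ t∈ i))

  partialTrace-linear : ∀ i {t} → Scalar t → ∀ x → partialTrace i (t ⊗ x) ≡ t ⊗ partialTrace i x
  partialTrace-linear zero    {t} t∈ x = sym (zeroʳ t)
  partialTrace-linear (suc i) {t} t∈ x = trans
    (cong₂ _⊕_ (partialTrace-linear i t∈ x) (trans (^-distrib-* t x (q ℕ.^ i)) (cong (_⊗ x ↑ (q ℕ.^ i)) (scalar-↑ t∈ i))))
    (sym (distribˡ t (partialTrace i x) (x ↑ (q ℕ.^ i))))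

  -- Raising to the power q shifts the summands by one, so T^q - T telescopes to x^(q^i) - x; both
  -- differences are cleared here.
  partialTrace-↑q : ∀ i x → partialTrace i x ↑ q ⊕ x ≡ partialTrace i x ⊕ x ↑ (q ℕ.^ i)
  partialTrace-↑q zero    x = cong₂ _⊕_ (𝟎↑ q) (sym (*-identityʳ x))
  partialTrace-↑q (suc i) x = begin
    (T ⊕ y) ↑ q ⊕ x                   ≡⟨ cong (_⊕ x) (frobenius-q T y) ⟩
    T ↑ q ⊕ y ↑ q ⊕ x                 ≡⟨ solve 3 (λ a b c → (a :+ b) :+ c := (a :+ c) :+ b) refl (T ↑ q) (y ↑ q) x ⟩
    T ↑ q ⊕ x ⊕ y ↑ q                 ≡⟨ cong₂ _⊕_ (partialTrace-↑q i x) (trans (^-assocʳ x (q ℕ.^ i) q) (cong (x ↑_) (ℕP.*-comm (q ℕ.^ i) q))) ⟩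
    T ⊕ y ⊕ x ↑ (q ℕ.^ suc i)         ∎
    where
    open ≡-Reasoning
    open KSolver
    T = partialTrace i x
    y = x ↑ (q ℕ.^ i)

  τ : Fin N → Fin N
  τ = partialTrace (suc n)

  -- For the full trace the two ends of the telescoping sum agree, because x^N = x.
  τ-scalar : ∀ x → Scalar (τ x)
  τ-scalar x = ⊕-cancelˡ x _ _ (trans (+-comm x _) (trans (partialTrace-↑q (suc n) x)
    (trans (cong (τ x ⊕_) (trans (cong (x ↑_) (sym N≡q^1+n)) (frobenius-N x))) (+-comm (τ x) x))))

  partialTrace-Low : ∀ i → i ℕ.≤ n → Low A (partialTrace i)
  partialTrace-Low zero    _   = Low-zero A
  partialTrace-Low (suc i) i<n = Low-+ A (partialTrace-Low i (ℕP.<⇒≤ i<n))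
    (Low-≤ (ℕP.^-monoʳ-< q 1<q i<n) (Monic⇒Low (q ℕ.^ i) (Monic-↑ (q ℕ.^ i))))

  -- As a polynomial in x, Tr(x) - b is monic of degree A = qⁿ: the last conjugate leads, and all
  -- earlier ones have smaller degree.
  τ-fibre≤ : ∀ b → ∑ (λ x → ⟦ τ x ≟ b ⟧) ≤ + A
  τ-fibre≤ b = ℤP.≤-trans
    (∑-mono (λ x → ⟦⟧-mono (λ { refl → -‿inverseʳ (τ x) }) (τ x ≟ b) (τ x ⊕ ⊝ b ≟ 𝟎)))
    (root-bound A (Monic-+ A
      (Monic-cong A (λ x → +-comm (partialTrace n x) (x ↑ A)) (Monic-+ A (Monic-↑ A) (partialTrace-Low n ℕP.≤-refl)))
      (Low-≤ (ℕ.>-nonZero⁻¹ A) (Low-const 0 (⊝ b)))))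

  #scalars≤ : ∑ (λ x → ⟦ scalar? x ⟧) ≤ + q
  #scalars≤ = ℤP.≤-trans
    (∑-mono (λ x → ⟦⟧-mono (λ e → trans (cong (_⊕ (⊝ 𝟏) ⊗ x) e) (trans (cong (x ⊕_) (trans (sym (-‿distribˡ-* 𝟏 x)) (cong ⊝_ (*-identityˡ x)))) (-‿inverseʳ x)))
      (scalar? x) (x ↑ q ⊕ (⊝ 𝟏) ⊗ x ≟ 𝟎)))
    (root-bound q (Monic-+ q (Monic-↑ q) (Low-scale q (⊝ 𝟏) (Low-≤ 1<q
      (Low-cong 2 (λ x → sym (*-identityʳ x)) (Monic⇒Low 1 (Monic-↑ 1)))))))

  private
    size : + N ≡ + q * + A
    size = trans (cong +_ N≡q^1+n) (ℤP.pos-* q A)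

    fibre : Fin N → ℤ
    fibre b = ∑ (λ x → ⟦ τ x ≟ b ⟧)

    fibre-total : ∑ (λ b → ⟦ scalar? b ⟧ * fibre b) ≡ + N
    fibre-total = begin
      ∑ (λ b → ⟦ scalar? b ⟧ * fibre b)
        ≡⟨ ∑-cong (λ b → ∑-*ˡ ⟦ scalar? b ⟧ (λ x → ⟦ τ x ≟ b ⟧)) ⟩
      ∑ (λ b → ∑ (λ x → ⟦ scalar? b ⟧ * ⟦ τ x ≟ b ⟧))
        ≡⟨ ∑-swap (λ b x → ⟦ scalar? b ⟧ * ⟦ τ x ≟ b ⟧) ⟩
      ∑ (λ x → ∑ (λ b → ⟦ scalar? b ⟧ * ⟦ τ x ≟ b ⟧))
        ≡⟨ ∑-cong (λ x → ∑-cong (λ b → trans (ℤP.*-comm ⟦ scalar? b ⟧ ⟦ τ x ≟ b ⟧)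
             (cong (_* ⟦ scalar? b ⟧) (⟦⟧-cong sym sym (τ x ≟ b) (b ≟ τ x))))) ⟩
      ∑ (λ x → ∑ (λ b → ⟦ b ≟ τ x ⟧ * ⟦ scalar? b ⟧))
        ≡⟨ ∑-cong (λ x → trans (∑-δ (τ x) (λ b → ⟦ scalar? b ⟧)) (⟦⟧-yes (scalar? (τ x)) (τ-scalar x))) ⟩
      ∑ (λ _ → 1ℤ)
        ≡⟨ ∑-one ⟩
      + N ∎
      where
      open ≡-Reasoning

    0<A : 0ℤ < + A
    0<A = ℤ.+<+ (ℕ.>-nonZero⁻¹ A)

    scaled-fibres≤ : ∑ (λ b → ⟦ scalar? b ⟧ * fibre b) ≤ ∑ (λ b → ⟦ scalar? b ⟧ * + A)
    scaled-fibres≤ = ∑-mono (λ b → *-monoˡ-≤ ⟦ scalar? b ⟧ (0≤⟦⟧ (scalar? b)) (τ-fibre≤ b))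

  -- N = q A elements map to at most q scalars with at most A elements over each,
  -- so both bounds are attained.
  #scalars : ∑ (λ x → ⟦ scalar? x ⟧) ≡ + q
  #scalars = ℤP.≤-antisym #scalars≤ (*-cancelˡ-≤ (+ A) 0<A (begin
    + A * + q                                    ≡⟨ ℤP.*-comm (+ A) (+ q) ⟩
    + q * + A                                    ≡⟨ size ⟨
    + N                                          ≡⟨ fibre-total ⟨
    ∑ (λ b → ⟦ scalar? b ⟧ * fibre b)            ≤⟨ scaled-fibres≤ ⟩
    ∑ (λ b → ⟦ scalar? b ⟧ * + A)                ≡⟨ ∑-*ʳ (+ A) (λ b → ⟦ scalar? b ⟧) ⟨
    ∑ (λ b → ⟦ scalar? b ⟧) * + A                ≡⟨ ℤP.*-comm _ (+ A) ⟩
    + A * ∑ (λ b → ⟦ scalar? b ⟧)                ∎))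
    where
    open ℤP.≤-Reasoning

  -- The deficits A - `fibre b` over the scalars are nonnegative and add up to qA - N = 0, so each
  -- of them vanishes.
  τ-fibre : ∀ {b} → Scalar b → fibre b ≡ + A
  τ-fibre {b} b∈ = sym (ℤP.i-j≡0⇒i≡j (+ A) (fibre b) (ℤP.≤-antisym deficit≤0 (ℤP.i≤j⇒0≤j-i (τ-fibre≤ b))))
    where
    open ℤP.≤-Reasoning
    open import Data.Integer using (_-_)
    deficit : Fin N → ℤ
    deficit b = ⟦ scalar? b ⟧ * + A - ⟦ scalar? b ⟧ * fibre b
    0≤deficit : ∀ b → 0ℤ ≤ deficit b
    0≤deficit b = ℤP.i≤j⇒0≤j-i (*-monoˡ-≤ ⟦ scalar? b ⟧ (0≤⟦⟧ (scalar? b)) (τ-fibre≤ b))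
    deficit≤0 : + A - fibre b ≤ 0ℤ
    deficit≤0 = begin
      + A - fibre b
        ≡⟨ cong₂ _-_ (ℤP.*-identityˡ (+ A)) (ℤP.*-identityˡ (fibre b)) ⟨
      1ℤ * + A - 1ℤ * fibre b
        ≡⟨ cong (λ t → t * + A - t * fibre b) (⟦⟧-yes (scalar? b) b∈) ⟨
      deficit b
        ≡⟨ ∑-δ b deficit ⟨
      ∑ (λ x → ⟦ x ≟ b ⟧ * deficit x)
        ≤⟨ ∑-mono (λ x → subst (⟦ x ≟ b ⟧ * deficit x ≤_) (ℤP.*-identityˡ (deficit x))
             (ℤP.*-monoʳ-≤-nonNeg (deficit x) {{ℤ.nonNegative (0≤deficit x)}} (⟦⟧≤1 (x ≟ b)))) ⟩
      ∑ deficit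
        ≡⟨ ∑-- (λ b → ⟦ scalar? b ⟧ * + A) (λ b → ⟦ scalar? b ⟧ * fibre b) ⟩
      ∑ (λ b → ⟦ scalar? b ⟧ * + A) - ∑ (λ b → ⟦ scalar? b ⟧ * fibre b)
        ≡⟨ cong₂ _-_ (trans (sym (∑-*ʳ (+ A) (λ b → ⟦ scalar? b ⟧))) (trans (cong (_* + A) #scalars) (sym size))) fibre-total ⟩
      + N - + N
        ≡⟨ ℤP.+-inverseʳ (+ N) ⟩
      0ℤ ∎

  traceForm : TraceForm K q A
  traceForm = record
    { τ = τ ; Scalar = Scalar ; scalar? = scalar? ; scalar-𝟎 = scalar-𝟎
    ; scalar-/ = λ {x} {y} x∈ y∈ → trans (^-distrib-* x (inv y) q) (cong₂ _⊗_ x∈ (scalar-inv y∈))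
    ; τ-⊕ = partialTrace-⊕ (suc n) ; τ-linear = partialTrace-linear (suc n)
    ; #scalars = #scalars ; τ-fibre = τ-fibre ; size = size }

-- Divisibility between distinct primes

module DistinctPrimes where

  prime∣prime⇒≡ : ∀ {p r} → Prime p → Prime r → p ∣ r → p ≡ r
  prime∣prime⇒≡ {p} p-prime r-prime p∣r with prime⇒irreducible r-prime p∣r
  ... | inj₁ refl = ⊥-elim (ℕP.<-irrefl refl (ℕ.nonTrivial⇒n>1 p {{prime⇒nonTrivial p-prime}}))
  ... | inj₂ p≡r  = p≡r

  prime∤⇒coprime : ∀ {p d} → Prime p → ¬ (p ∣ d) → Coprime d p
  prime∤⇒coprime p-prime p∤d (i∣d , i∣p) with prime⇒irreducible p-prime i∣p
  ... | inj₁ i≡1  = i≡1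
  ... | inj₂ refl = ⊥-elim (p∤d i∣d)

-- Expanding the indicator of freeness over the primes of m

module CharacterExpansion {N M q A : ℕ} (K : FinField N) (N≡1+M : N ≡ suc M) (0<M : 0 ℕ.< M)
    (tr : TraceForm K q A) (1<q : 1 ℕ.< q)
    (β : Fin N) (β-scalar : TraceForm.Scalar tr β) (β≢0 : β ≢ FinField.𝟎 K) (2∣M : 2 ∣ M) where
  open import Data.Integer using (_+_; _*_; _-_; -_; _≤_)
  open IntegerInequalities
  open Indicators
  open DistinctPrimes
  open Totient
  open FieldArithmetic K
  open FieldSums N
  open RootBound K
  open UnitSums K N≡1+M
  open PowerKernels K N≡1+M 0<M
  open TraceForm tr
  open SecondMoment K N≡1+M 0<M tr 1<q

  hit : Fin N → ℤ
  hit u = ⟦ τ (u ⊗ u) ≟ β ⟧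

  -- At a unit the factor for l equals l off the l-th powers and 0 on them. Written as l - 1 minus
  -- c_l, it shows the weight of the trivial character and the contribution of the characters of
  -- order l.
  sieve : List ℕ → Fin N → ℤ
  sieve []      u = 1ℤ
  sieve (l ∷ L) u = ((+ l - 1ℤ) * ε u - c l u) * sieve L u

  -- D collects the primes at which the nontrivial characters were chosen in
  -- expanding the sieve, L the primes not yet expanded.
  X : List ℕ → List ℕ → ℤ
  X D L = ∑ (λ u → hit u * (cs D u * sieve L u))

  -- Relative error 2 for each of the 2^r choices at the r primes of `L`.
  bound : List ℕ → ℤ
  bound L = + 2 * + (2 ℕ.^ length L)

  ε*cs : ∀ D u → ε u * cs D u ≡ cs D u
  ε*cs D = ε-absorb (cs D) (cs-𝟎 D)
    where
    cs-𝟎 : ∀ D → cs D 𝟎 ≡ 0ℤ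
    cs-𝟎 []      = ε-𝟎
    cs-𝟎 (l ∷ D) = trans (cong (_* cs D 𝟎) (c-𝟎 l)) (ℤP.*-zeroˡ (cs D 𝟎))

  -- The trivial choice at l has weight l - 1 and the nontrivial one moves l into `D` with a minus
  -- sign. The factor `ε` of the trivial choice is absorbed by `cs D`.
  X-step : ∀ D l L → X D (l ∷ L) ≡ (+ l - 1ℤ) * X D L - X (l ∷ D) L
  X-step D l L = begin
    ∑ (λ u → hit u * (cs D u * (((+ l - 1ℤ) * ε u - c l u) * sieve L u)))
      ≡⟨ ∑-cong pointwise ⟩
    ∑ (λ u → (+ l - 1ℤ) * (hit u * (cs D u * sieve L u)) - hit u * (c l u * cs D u * sieve L u))
      ≡⟨ ∑-- (λ u → (+ l - 1ℤ) * (hit u * (cs D u * sieve L u))) (λ u → hit u * (c l u * cs D u * sieve L u)) ⟩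
    ∑ (λ u → (+ l - 1ℤ) * (hit u * (cs D u * sieve L u))) - X (l ∷ D) L
      ≡⟨ cong (λ t → t - X (l ∷ D) L) (∑-*ˡ (+ l - 1ℤ) (λ u → hit u * (cs D u * sieve L u))) ⟨
    (+ l - 1ℤ) * X D L - X (l ∷ D) L ∎
    where
    open ≡-Reasoning
    r : ∀ h d a e c s → h * (d * ((a * e - c) * s)) ≡ a * (h * ((e * d) * s)) - h * (c * d * s)
    r = solve-∀
    pointwise : ∀ u → hit u * (cs D u * (((+ l - 1ℤ) * ε u - c l u) * sieve L u))
                    ≡ (+ l - 1ℤ) * (hit u * (cs D u * sieve L u)) - hit u * (c l u * cs D u * sieve L u)
    pointwise u = trans (r (hit u) (cs D u) (+ l - 1ℤ) (ε u) (c l u) (sieve L u))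
      (cong (λ t → (+ l - 1ℤ) * (hit u * (t * sieve L u)) - hit u * (c l u * cs D u * sieve L u)) (ε*cs D u))

  square≡↑2 : ∀ u → u ⊗ u ≡ u ↑ 2
  square≡↑2 u = cong (u ⊗_) (sym (*-identityʳ u))

  square-⊗ : ∀ x y → (x ⊗ y) ⊗ (x ⊗ y) ≡ (x ⊗ x) ⊗ (y ⊗ y)
  square-⊗ = solve 2 (λ x y → (x :* y) :* (x :* y) := (x :* x) :* (y :* y)) refl
    where
    open KSolver

  square-fibre : ∀ y → ∑ (λ u → ⟦ u ⊗ u ≟ y ⟧) ≤ + 2
  square-fibre y = subst (_≤ + 2) (∑-cong (λ u → cong (λ t → ⟦ t ≟ y ⟧) (sym (square≡↑2 u)))) (↑-fibre-bound 2 y)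

  0≤A : 0ℤ ≤ + A
  0≤A = ℤ.+≤+ ℕ.z≤n

  X-base : ∀ d D → CoprimeDivisors (d ∷ D) → X (d ∷ D) [] ∣≤ bound [] * totient (d ∷ D) * totient [] √ + A
  X-base d D good = subst₂ (λ a b → a ∣≤ b √ + A)
    (∑-cong (λ u → cong (hit u *_) (sym (ℤP.*-identityʳ (cs (d ∷ D) u)))))
    (trans (cong (+ 2 *_) (cs-𝟏 (d ∷ D))) (sym (ℤP.*-identityʳ (+ 2 * totient (d ∷ D)))))
    (character-sum-bound (λ u → u ⊗ u) 2
      square-⊗
      (λ x≢0 → ⊗-nonzero x≢0 x≢0) square-fibre (cs (d ∷ D)) (cs-kernel (d ∷ D) good) (∑cs d D good) β-scalar β≢0)

  -- A nonzero β keeps 0 off the level set, which lets `ε` be dropped and unit-only facts be used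
  -- under `hit`.
  hit-unit : ∀ y → τ y ≡ β → y ≢ 𝟎
  hit-unit y e refl = β≢0 (trans (sym e) τ-𝟎)

  square-count : X [] [] - + A ≡ ∑ (λ y → ⟦ τ y ≟ β ⟧ * c 2 y)
  square-count = begin
    X [] [] - + A
      ≡⟨ cong (λ t → t - + A) (∑-cong drop-ε) ⟩
    ∑ (λ u → ⟦ τ (u ⊗ u) ≟ β ⟧) - + A
      ≡⟨ cong (λ t → t - + A) (∑-cong (λ u → ∑-δ (u ⊗ u) (λ y → ⟦ τ y ≟ β ⟧))) ⟨
    ∑ (λ u → ∑ (λ y → ⟦ y ≟ u ⊗ u ⟧ * ⟦ τ y ≟ β ⟧)) - + A
      ≡⟨ cong (λ t → t - + A) (∑-swap (λ u y → ⟦ y ≟ u ⊗ u ⟧ * ⟦ τ y ≟ β ⟧)) ⟩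
    ∑ (λ y → ∑ (λ u → ⟦ y ≟ u ⊗ u ⟧ * ⟦ τ y ≟ β ⟧)) - + A
      ≡⟨ cong (λ t → t - + A) (∑-cong (λ y → trans (sym (∑-*ʳ ⟦ τ y ≟ β ⟧ (λ u → ⟦ y ≟ u ⊗ u ⟧))) (ℤP.*-comm _ ⟦ τ y ≟ β ⟧))) ⟩
    ∑ (λ y → ⟦ τ y ≟ β ⟧ * ∑ (λ u → ⟦ y ≟ u ⊗ u ⟧)) - + A
      ≡⟨ cong (λ t → t - + A) (∑-cong (λ y → trans (⟦⟧-*-cong (τ y ≟ β) (λ e → squares y (hit-unit y e)))
           (ℤP.*-distribˡ-+ ⟦ τ y ≟ β ⟧ 1ℤ (c 2 y)))) ⟩
    ∑ (λ y → ⟦ τ y ≟ β ⟧ * 1ℤ + ⟦ τ y ≟ β ⟧ * c 2 y) - + A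
      ≡⟨ cong (λ t → t - + A) (∑-+ (λ y → ⟦ τ y ≟ β ⟧ * 1ℤ) (λ y → ⟦ τ y ≟ β ⟧ * c 2 y)) ⟩
    (∑ (λ y → ⟦ τ y ≟ β ⟧ * 1ℤ) + ∑ (λ y → ⟦ τ y ≟ β ⟧ * c 2 y)) - + A
      ≡⟨ cong (λ t → (t + ∑ (λ y → ⟦ τ y ≟ β ⟧ * c 2 y)) - + A)
           (trans (∑-cong (λ y → ℤP.*-identityʳ ⟦ τ y ≟ β ⟧)) (τ-fibre β-scalar)) ⟩
    (+ A + ∑ (λ y → ⟦ τ y ≟ β ⟧ * c 2 y)) - + A
      ≡⟨ r (+ A) (∑ (λ y → ⟦ τ y ≟ β ⟧ * c 2 y)) ⟩
    ∑ (λ y → ⟦ τ y ≟ β ⟧ * c 2 y) ∎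
    where
    open ≡-Reasoning
    r : ∀ a b → (a + b) - a ≡ b
    r = solve-∀
    drop-ε : ∀ u → hit u * (ε u * 1ℤ) ≡ ⟦ τ (u ⊗ u) ≟ β ⟧
    drop-ε u = trans (⟦⟧-*-cong (τ (u ⊗ u) ≟ β) (λ e → trans (ℤP.*-identityʳ (ε u)) (ε-unit (⊗-nonzeroˡ (hit-unit (u ⊗ u) e)))))
      (ℤP.*-identityʳ (hit u))
    r′ : ∀ p → p ≡ 1ℤ + (p - 1ℤ)
    r′ = solve-∀
    squares : ∀ y → y ≢ 𝟎 → ∑ (λ u → ⟦ y ≟ u ⊗ u ⟧) ≡ 1ℤ + c 2 y
    squares y y≢0 = begin
      ∑ (λ u → ⟦ y ≟ u ⊗ u ⟧)         ≡⟨ ∑-cong (λ u → ⟦⟧-cong (λ e → trans (sym (square≡↑2 u)) (sym e))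
                                            (λ e → trans (sym e) (sym (square≡↑2 u))) (y ≟ u ⊗ u) (u ↑ 2 ≟ y)) ⟩
      ∑ (λ u → ⟦ u ↑ 2 ≟ y ⟧)         ≡⟨ fibre-count 2 2∣M y y≢0 ⟩
      + 2 * P 2 y                     ≡⟨ r′ (+ 2 * P 2 y) ⟩
      1ℤ + (+ 2 * P 2 y - 1ℤ)         ≡⟨ cong (λ t → 1ℤ + (+ 2 * P 2 y - t)) (ε-unit y≢0) ⟨
      1ℤ + c 2 y                      ∎

  -- The constant is e c_2(1) = 1 · (2 - 1): the identity map has fibres of size 1 and there is one
  -- quadratic character.
  quadric-bound : X [] [] - + A ∣≤ 1ℤ √ + A
  quadric-bound = subst₂ (λ a b → a ∣≤ b √ + A) (sym square-count)
    (cong (1ℤ *_) (c-𝟏 2))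
    (character-sum-bound id 1 (λ x y → refl) id
      (λ y → ℤP.≤-reflexive (trans (∑-cong (λ u → sym (ℤP.*-identityʳ ⟦ u ≟ y ⟧))) (∑-δ y (λ _ → 1ℤ))))
      (c 2) (c-kernel 2 2∣M) (∑c 2 2∣M) β-scalar β≢0)

  -- The invariant of a branch of the expansion: any prime still in `L` may be moved to `D` with
  -- coprimality preserved.
  Compatible : List ℕ → List ℕ → Set
  Compatible D = All (λ l → Prime l × l ∣ M × ¬ (l ∣ product D))

  extend : ∀ D {l L} → Prime l → All (l ≢_) L → Compatible D L → Compatible (l ∷ D) L
  extend D l-prime []          []                              = []
  extend D {l} l-prime (l≢l′ ∷ u) ((pr , l′∣M , l′∤D) ∷ good) =
    (pr , l′∣M , λ l′∣ → case (euclidsLemma l (product D) pr l′∣)) ∷ extend D l-prime u good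
    where
    case : _ ⊎ _ → ⊥
    case (inj₁ l′∣l) = l≢l′ (sym (prime∣prime⇒≡ pr l-prime l′∣l))
    case (inj₂ l′∣D) = l′∤D l′∣D

  private
    0≤l-1 : ∀ {l} → Prime l → 0ℤ ≤ + l - 1ℤ
    0≤l-1 {l} pr = ℤP.i≤j⇒0≤j-i (ℤ.+≤+ (ℕ.>-nonZero⁻¹ l {{prime⇒nonZero pr}}))

    bound-suc : ∀ l L → bound (l ∷ L) ≡ + 2 * bound L
    bound-suc l L = cong (+ 2 *_) (ℤP.pos-* 2 (2 ℕ.^ length L))

  -- The branch without l carries the explicit weight l - 1, the branch with l carries the same
  -- factor inside `totient (l ∷ d ∷ D)`. Relative to the totients both have equal size, so each
  -- prime doubles the bound.
  X-nontrivial : ∀ d D L → CoprimeDivisors (d ∷ D) → Unique L → Compatible (d ∷ D) L →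
    X (d ∷ D) L ∣≤ bound L * totient (d ∷ D) * totient L √ + A
  X-nontrivial d D []      good _        _ = X-base d D good
  X-nontrivial d D (l ∷ L) good (l∉L ∷ uniq) ((pr , l∣M , l∤D) ∷ comp) =
    subst₂ (λ a b → a ∣≤ b √ + A) (sym (X-step (d ∷ D) l L)) equal
      (√-+ 0≤A (√-* (+ l - 1ℤ) (0≤l-1 pr) (X-nontrivial d D L good uniq comp))
        (√-neg (X-nontrivial l (d ∷ D) L (l∣M , prime∤⇒coprime pr l∤D , good) uniq (extend (d ∷ D) pr l∉L comp))))
    where
    open ≡-Reasoning
    r : ∀ a b t s → a * (b * t * s) + b * (a * t) * s ≡ (+ 2 * b) * t * (a * s)
    r = solve-∀
    equal : (+ l - 1ℤ) * (bound L * totient (d ∷ D) * totient L) + bound L * totient (l ∷ d ∷ D) * totient L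
            ≡ bound (l ∷ L) * totient (d ∷ D) * totient (l ∷ L)
    equal = trans (r (+ l - 1ℤ) (bound L) (totient (d ∷ D)) (totient L))
      (cong (λ t → t * totient (d ∷ D) * totient (l ∷ L)) (sym (bound-suc l L)))

  -- Only the all-trivial branch has a main term, and it ends in the error 1 of `quadric-bound`
  -- instead of 2. With b = `bound L` the recursion is (b - 1) + b = 2b - 1.
  X-trivial : ∀ L → Unique L → Compatible [] L →
    X [] L - totient L * + A ∣≤ (bound L - 1ℤ) * totient L √ + A
  X-trivial []      _            _ = subst (λ t → X [] [] - t ∣≤ 1ℤ √ + A) (sym (ℤP.*-identityˡ (+ A))) quadric-bound
  X-trivial (l ∷ L) (l∉L ∷ uniq) ((pr , l∣M , l∤1) ∷ comp) =
    subst₂ (λ a b → a ∣≤ b √ + A) difference equal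
      (√-+ 0≤A (√-* (+ l - 1ℤ) (0≤l-1 pr) (X-trivial L uniq comp))
        (√-neg (X-nontrivial l [] L (l∣M , prime∤⇒coprime pr l∤1 , tt) uniq (extend [] pr l∉L comp))))
    where
    r : ∀ a x y t A → a * (x - t * A) + - y ≡ (a * x - y) - (a * t) * A
    r = solve-∀
    s : ∀ a b t → a * ((b - 1ℤ) * t) + b * (a * 1ℤ) * t ≡ (+ 2 * b - 1ℤ) * (a * t)
    s = solve-∀
    difference : (+ l - 1ℤ) * (X [] L - totient L * + A) + - X (l ∷ []) L ≡ X [] (l ∷ L) - totient (l ∷ L) * + A
    difference = trans (r (+ l - 1ℤ) (X [] L) (X (l ∷ []) L) (totient L) (+ A))
      (cong (λ t → t - totient (l ∷ L) * + A) (sym (X-step [] l L)))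
    equal : (+ l - 1ℤ) * ((bound L - 1ℤ) * totient L) + bound L * totient (l ∷ []) * totient L
            ≡ (bound (l ∷ L) - 1ℤ) * totient (l ∷ L)
    equal = trans (s (+ l - 1ℤ) (bound L) (totient L))
      (cong (λ t → (t - 1ℤ) * totient (l ∷ L)) (sym (bound-suc l L)))

  nonPowers? : ∀ L u → Dec (All (λ l → ¬ IsPower l u) L)
  nonPowers? L u = All.all? (λ l → ¬? (power? l u)) L

  sieve-value : ∀ L u → u ≢ 𝟎 → sieve L u ≡ + product L * ⟦ nonPowers? L u ⟧
  sieve-value []      u u≢0 = refl
  sieve-value (l ∷ L) u u≢0 = begin
    ((+ l - 1ℤ) * ε u - (+ l * P l u - ε u)) * sieve L u
      ≡⟨ cong₂ (λ s t → ((+ l - 1ℤ) * s - (+ l * P l u - s)) * t) (ε-unit u≢0) (sieve-value L u u≢0) ⟩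
    ((+ l - 1ℤ) * 1ℤ - (+ l * P l u - 1ℤ)) * (+ product L * ⟦ nonPowers? L u ⟧)
      ≡⟨ r (+ l) (P l u) (+ product L) ⟦ nonPowers? L u ⟧ ⟩
    (+ l * + product L) * ((1ℤ - P l u) * ⟦ nonPowers? L u ⟧)
      ≡⟨ cong₂ (λ s t → s * (t * ⟦ nonPowers? L u ⟧)) (ℤP.pos-* l (product L)) (⟦⟧-¬ (power? l u)) ⟨
    + product (l ∷ L) * (⟦ ¬? (power? l u) ⟧ * ⟦ nonPowers? L u ⟧)
      ≡⟨ cong (+ product (l ∷ L) *_) (trans (sym (⟦⟧-× (¬? (power? l u)) (nonPowers? L u)))
           (⟦⟧-cong (λ { (x , xs) → x ∷ xs }) (λ { (x ∷ xs) → x , xs }) (¬? (power? l u) ×-dec nonPowers? L u) (nonPowers? (l ∷ L) u))) ⟩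
    + product (l ∷ L) * ⟦ nonPowers? (l ∷ L) u ⟧ ∎
    where
    open ≡-Reasoning
    r : ∀ l p a b → ((l - 1ℤ) * 1ℤ - (l * p - 1ℤ)) * (a * b) ≡ (l * a) * ((1ℤ - p) * b)
    r = solve-∀

  #nonPowers : List ℕ → ℤ
  #nonPowers L = ∑ (λ u → hit u * ⟦ nonPowers? L u ⟧)

  X-value : ∀ L → X [] L ≡ + product L * #nonPowers L
  X-value L = trans (∑-cong pointwise) (sym (∑-*ˡ (+ product L) (λ u → hit u * ⟦ nonPowers? L u ⟧)))
    where
    r : ∀ h p a → h * (1ℤ * (p * a)) ≡ p * (h * a)
    r = solve-∀
    pointwise : ∀ u → hit u * (ε u * sieve L u) ≡ + product L * (hit u * ⟦ nonPowers? L u ⟧)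
    pointwise u = trans (⟦⟧-*-cong (τ (u ⊗ u) ≟ β) (λ e → let u≢0 = ⊗-nonzeroˡ (hit-unit (u ⊗ u) e) in
        cong₂ _*_ (ε-unit u≢0) (sieve-value L u u≢0)))
      (r (hit u) (+ product L) ⟦ nonPowers? L u ⟧)

  nonPower-count : ∀ L → Unique L → All (λ l → Prime l × l ∣ M) L →
    + product L * #nonPowers L - totient L * + A ∣≤ (bound L - 1ℤ) * totient L √ + A
  nonPower-count L uniq primes = subst (λ t → t - totient L * + A ∣≤ (bound L - 1ℤ) * totient L √ + A) (X-value L)
    (X-trivial L uniq (All.map (λ { (pr , l∣M) → pr , l∣M , prime∤1 pr }) primes))
    where
    open BinomialDivisibility using (prime∤!)
    prime∤1 : ∀ {l} → Prime l → ¬ (l ∣ 1)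
    -- The number 1 is read as 0!.
    prime∤1 {l} pr = prime∤! pr 0 (ℕ.>-nonZero⁻¹ l {{prime⇒nonZero pr}})

-- Prime divisors, square-free divisors and W

module PrimeDivisors where
  open import Data.Nat.Base using (_*_; _≤_; _^_; s≤s; z≤n)
  open DistinctPrimes

  ∤product : ∀ {l L} → Prime l → All Prime L → All (l ≢_) L → ¬ (l ∣ product L)
  ∤product l-prime primes l∉L l∣P = All.lookup l∉L (factorisationHasAllPrimeFactors l-prime l∣P primes) refl

  product∣ : ∀ {m} L → Unique L → All (λ l → Prime l × l ∣ m) L → product L ∣ m
  product∣ {m} [] _ _ = divides m (sym (ℕP.*-identityʳ m))
  product∣ {m} (l ∷ L) (l∉L ∷ uniq) ((pr , l∣m) ∷ good) with product∣ L uniq good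
  ... | divides k m≡kP with coprime-divisor (λ { (a , b) → coprime (b , a) }) (subst (l ∣_) (trans m≡kP (ℕP.*-comm k (product L))) l∣m)
    where
    coprime : Coprime (product L) l
    coprime = prime∤⇒coprime pr (∤product pr (All.map proj₁ good) l∉L)
  ... | divides j refl = divides j (trans m≡kP (ℕP.*-assoc j l (product L)))

  product-squareFree : ∀ L → Unique L → All Prime L → SquareFree (product L)
  product-squareFree [] _ _ p pr p²∣1 = ℕP.<-irrefl (sym (∣1⇒≡1 (∣-trans (m∣m*n p) p²∣1))) (ℕ.nonTrivial⇒n>1 p {{prime⇒nonTrivial pr}})
  product-squareFree (l ∷ L) (l∉L ∷ uniq) (l-prime ∷ primes) p pr p²∣lP with l ℕ.≟ p
  ... | yes refl = ∤product l-prime primes l∉L (*-cancelˡ-∣ l {{prime⇒nonZero pr}} p²∣lP)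
  ... | no l≢p   = product-squareFree L uniq primes p pr (coprime-divisor (prime∤⇒coprime l-prime l∤p²) p²∣lP)
    where
    l∤p² : ¬ (l ∣ p * p)
    l∤p² l∣p² with euclidsLemma p p l-prime l∣p²
    ... | inj₁ l∣p = l≢p (prime∣prime⇒≡ l-prime pr l∣p)
    ... | inj₂ l∣p = l≢p (prime∣prime⇒≡ l-prime pr l∣p)

  prime-divisor : ∀ d → .{{NonZero d}} → d ≢ 1 → ∃ λ p → Prime p × p ∣ d
  prime-divisor d d≢1 with factorise d
  ... | record { factors = [] ; isFactorisation = d≡1 } = ⊥-elim (d≢1 d≡1)
  ... | record { factors = p ∷ ps ; isFactorisation = refl ; factorsPrime = pr ∷ _ } = p , pr , m∣m*n (product ps)

  primesOf : ℕ → List ℕ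
  primesOf m = filter (λ p → prime? p ×-dec (p ∣? m)) (upTo (suc m))

  primesOf-unique : ∀ m → Unique (primesOf m)
  primesOf-unique m = UniqueP.filter⁺ (λ p → prime? p ×-dec (p ∣? m)) (UniqueP.upTo⁺ (suc m))

  primesOf-sound : ∀ m → All (λ p → Prime p × p ∣ m) (primesOf m)
  primesOf-sound m = AllP.all-filter (λ p → prime? p ×-dec (p ∣? m)) (upTo (suc m))

  primesOf-complete : ∀ m → .{{NonZero m}} → ∀ {p} → Prime p → p ∣ m → p ∈ primesOf m
  primesOf-complete m pr p∣m = ∈-filter⁺ (λ p → prime? p ×-dec (p ∣? m)) (∈-upTo⁺ (s≤s (∣⇒≤ p∣m))) (pr , p∣m)

  length-⊆ : ∀ {xs ys : List ℕ} → Unique xs → (∀ {x} → x ∈ xs → x ∈ ys) → length xs ≤ length ys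
  length-⊆ {[]}     _              _  = z≤n
  length-⊆ {x ∷ xs} (x∉xs ∷ uniq) xs⊆ys with ∈-∃++ (xs⊆ys (here refl))
  ... | as , bs , refl = subst (suc (length xs) ≤_) (sym split) (s≤s (length-⊆ uniq rest))
    where
    split : length (as ++ x ∷ bs) ≡ suc (length (as ++ bs))
    split = trans (ListP.length-++ as) (trans (ℕP.+-suc (length as) (length bs)) (cong suc (sym (ListP.length-++ as))))
    rest : ∀ {y} → y ∈ xs → y ∈ as ++ bs
    rest {y} y∈xs with ∈-++⁻ as (xs⊆ys (there y∈xs))
    ... | inj₁ y∈as          = ∈-++⁺ˡ y∈as
    ... | inj₂ (here refl)   = ⊥-elim (All.lookup x∉xs y∈xs refl)
    ... | inj₂ (there y∈bs)  = ∈-++⁺ʳ as y∈bs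

  subproducts : List ℕ → List ℕ
  subproducts []      = 1 ∷ []
  subproducts (l ∷ L) = subproducts L ++ map (l *_) (subproducts L)

  length-subproducts : ∀ L → length (subproducts L) ≡ 2 ^ length L
  length-subproducts []      = refl
  length-subproducts (l ∷ L) = begin
    length (subproducts L ++ map (l *_) (subproducts L))           ≡⟨ ListP.length-++ (subproducts L) ⟩
    length (subproducts L) ℕ.+ length (map (l *_) (subproducts L))  ≡⟨ cong (length (subproducts L) ℕ.+_) (ListP.length-map (l *_) (subproducts L)) ⟩
    length (subproducts L) ℕ.+ length (subproducts L)               ≡⟨ cong₂ ℕ._+_ (length-subproducts L) (trans (length-subproducts L) (sym (ℕP.+-identityʳ _))) ⟩
    2 ^ length (l ∷ L)                                              ∎
    where
    open ≡-Reasoning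

  subproducts-∣ : ∀ L {d} → d ∈ subproducts L → d ∣ product L
  subproducts-∣ []      (here refl) = ∣-refl
  subproducts-∣ (l ∷ L) d∈ with ∈-++⁻ (subproducts L) d∈
  ... | inj₁ d∈L = ∣-trans (subproducts-∣ L d∈L) (n∣m*n l)
  ... | inj₂ d∈lL with ∈-map⁻ (l *_) d∈lL
  ... | d′ , d′∈L , refl = *-monoʳ-∣ l (subproducts-∣ L d′∈L)

  subproducts-unique : ∀ L → Unique L → All Prime L → Unique (subproducts L)
  subproducts-unique []      _ _ = [] ∷ []
  subproducts-unique (l ∷ L) (l∉L ∷ uniq) (pr ∷ primes) =
    UniqueP.++⁺ IH (UniqueP.map⁺ (λ {x} {y} → ℕP.*-cancelˡ-≡ x y l {{prime⇒nonZero pr}}) IH) disjoint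
    where
    IH = subproducts-unique L uniq primes
    disjoint : ∀ {d} → ¬ (d ∈ subproducts L × d ∈ map (l *_) (subproducts L))
    disjoint (d∈L , d∈lL) with ∈-map⁻ (l *_) d∈lL
    ... | d′ , _ , refl = ∤product pr primes l∉L (∣-trans (m∣m*n d′) (subproducts-∣ L d∈L))

  squareFreeDivisors : ℕ → List ℕ
  squareFreeDivisors t = filter (λ d → (d ∣? t) ×-dec squareFree? d) (map suc (upTo t))

  ∈-squareFreeDivisors : ∀ m → .{{NonZero m}} → ∀ {d} → d ∣ m → SquareFree d → d ∈ squareFreeDivisors m
  ∈-squareFreeDivisors m {zero}  d∣m sf = ⊥-elim (sf 2 prime[2] (divides 0 refl))
  ∈-squareFreeDivisors m {suc d} d∣m sf = ∈-filter⁺ (λ d → (d ∣? m) ×-dec squareFree? d)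
    (∈-map⁺ suc (∈-upTo⁺ (∣⇒≤ d∣m))) (d∣m , sf)

  -- The subproducts of the primes dividing m are 2^r distinct square-free divisors of m.
  2^#primes≤W : ∀ m → .{{NonZero m}} → 2 ^ length (primesOf m) ≤ W m
  2^#primes≤W m = subst (_≤ W m) (length-subproducts L)
    (length-⊆ (subproducts-unique L (primesOf-unique m) primes) λ d∈ → ∈-squareFreeDivisors m
      (∣-trans (subproducts-∣ L d∈) (product∣ L (primesOf-unique m) (primesOf-sound m)))
      (λ p pr p²∣d → product-squareFree L (primesOf-unique m) primes p pr (∣-trans p²∣d (subproducts-∣ L d∈))))
    where
    L = primesOf m
    primes = All.map proj₁ (primesOf-sound m)

  W-mono : ∀ {r m} → .{{NonZero m}} → r ∣ m → W r ≤ W m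
  W-mono {r} {m} r∣m = length-⊆ (UniqueP.filter⁺ (λ d → (d ∣? r) ×-dec squareFree? d) (UniqueP.map⁺ ℕP.suc-injective (UniqueP.upTo⁺ r)))
    λ d∈ → let (_ , d∣r , sf) = ∈-filter⁻ (λ d → (d ∣? r) ×-dec squareFree? d) {xs = map suc (upTo r)} d∈ in
      ∈-squareFreeDivisors m (∣-trans d∣r r∣m) sf

  radicalPart∣ : ∀ m Q → radicalPart m Q ∣ m
  radicalPart∣ m Q = product∣ _ (UniqueP.filter⁺ P? (UniqueP.upTo⁺ (suc m)))
    (All.map (λ { (pr , p∣m , _) → pr , p∣m }) (AllP.all-filter P? (upTo (suc m))))
    where
    P? = λ p → prime? p ×-dec (p ∣? m) ×-dec (p ∣? Q)

-- The product formula for Euler's function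

module TotientFormula where
  open import Data.Integer using (_+_; _*_; _-_; -_)
  open Indicators
  open Totient
  open PrimeDivisors
  open DistinctPrimes

  ∑< : ℕ → (ℕ → ℤ) → ℤ
  ∑< zero    g = 0ℤ
  ∑< (suc n) g = g 0 + ∑< n (g ∘ suc)

  ∑<-cong : ∀ n {f g : ℕ → ℤ} → (∀ k → f k ≡ g k) → ∑< n f ≡ ∑< n g
  ∑<-cong zero    e = refl
  ∑<-cong (suc n) e = cong₂ _+_ (e 0) (∑<-cong n (e ∘ suc))

  ∑<-+ : ∀ a b g → ∑< (a ℕ.+ b) g ≡ ∑< a g + ∑< b (λ k → g (a ℕ.+ k))
  ∑<-+ zero    b g = sym (ℤP.+-identityˡ _)
  ∑<-+ (suc a) b g = trans (cong (λ t → g 0 + t) (∑<-+ a b (g ∘ suc))) (sym (ℤP.+-assoc (g 0) _ _))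

  ∑<-- : ∀ n f g → ∑< n (λ k → f k - g k) ≡ ∑< n f - ∑< n g
  ∑<-- zero    f g = refl
  ∑<-- (suc n) f g = trans (cong (λ t → (f 0 - g 0) + t) (∑<-- n (f ∘ suc) (g ∘ suc)))
    (r (f 0) (g 0) (∑< n (f ∘ suc)) (∑< n (g ∘ suc)))
    where
    r : ∀ a b s t → (a - b) + (s - t) ≡ (a + s) - (b + t)
    r = solve-∀

  ∑<-one : ∀ n → ∑< n (λ _ → 1ℤ) ≡ + n
  ∑<-one zero    = refl
  ∑<-one (suc n) = cong (λ t → 1ℤ + t) (∑<-one n)

  ∑<-last : ∀ n g → (∀ k → k ℕ.< n → g k ≡ 0ℤ) → ∑< (suc n) g ≡ g n
  ∑<-last zero    g _ = ℤP.+-identityʳ (g 0)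
  ∑<-last (suc n) g h = trans (cong₂ _+_ (h 0 (ℕ.s≤s ℕ.z≤n)) (∑<-last n (g ∘ suc) (λ k k<n → h (suc k) (ℕ.s≤s k<n))))
    (ℤP.+-identityˡ (g (suc n)))

  -- The index k stands for the number k + 1, so in each block of length l only the last entry is a
  -- multiple of l. The induction passes to the shift of g by l.
  ∑<-multiples : ∀ l n (g : ℕ → ℤ) → .{{NonZero l}} →
    ∑< (n ℕ.* l) (λ k → ⟦ l ∣? suc k ⟧ * g (suc k)) ≡ ∑< n (λ k → g (l ℕ.* suc k))
  ∑<-multiples l          zero    g = refl
  ∑<-multiples l@(suc l′) (suc n) g = begin
    ∑< (l ℕ.+ n ℕ.* l) h
      ≡⟨ ∑<-+ l (n ℕ.* l) h ⟩
    ∑< l h + ∑< (n ℕ.* l) (λ k → h (l ℕ.+ k))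
      ≡⟨ cong₂ _+_ first rest ⟩
    g (l ℕ.* 1) + ∑< n (λ k → g (l ℕ.* suc (suc k))) ∎
    where
    open ≡-Reasoning
    h : ℕ → ℤ
    h k = ⟦ l ∣? suc k ⟧ * g (suc k)
    first : ∑< l h ≡ g (l ℕ.* 1)
    first = begin
      ∑< l h                 ≡⟨ ∑<-last l′ h (λ k k<l′ → trans (cong (_* g (suc k)) (⟦⟧-no (l ∣? suc k) (>⇒∤ (ℕ.s≤s k<l′)))) (ℤP.*-zeroˡ (g (suc k)))) ⟩
      ⟦ l ∣? l ⟧ * g l       ≡⟨ cong (_* g l) (⟦⟧-yes (l ∣? l) ∣-refl) ⟩
      1ℤ * g l               ≡⟨ ℤP.*-identityˡ (g l) ⟩
      g l                    ≡⟨ cong g (ℕP.*-identityʳ l) ⟨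
      g (l ℕ.* 1)            ∎
    rest : ∑< (n ℕ.* l) (λ k → h (l ℕ.+ k)) ≡ ∑< n (λ k → g (l ℕ.* suc (suc k)))
    rest = begin
      ∑< (n ℕ.* l) (λ k → h (l ℕ.+ k))
        ≡⟨ ∑<-cong (n ℕ.* l) (λ k → cong₂ _*_
             (⟦⟧-cong (λ l∣ → ∣m+n∣m⇒∣n (subst (l ∣_) (sym (ℕP.+-suc l k)) l∣) ∣-refl)
                      (λ l∣ → subst (l ∣_) (ℕP.+-suc l k) (∣m∣n⇒∣m+n ∣-refl l∣))
                      (l ∣? suc (l ℕ.+ k)) (l ∣? suc k))
             (cong g (sym (ℕP.+-suc l k)))) ⟩
      ∑< (n ℕ.* l) (λ k → ⟦ l ∣? suc k ⟧ * g (l ℕ.+ suc k))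
        ≡⟨ ∑<-multiples l n (λ k → g (l ℕ.+ k)) ⟩
      ∑< n (λ k → g (l ℕ.+ l ℕ.* suc k))
        ≡⟨ ∑<-cong n (λ k → cong g (sym (ℕP.*-suc l (suc k)))) ⟩
      ∑< n (λ k → g (l ℕ.* suc (suc k))) ∎

  avoids? : ∀ L k → Dec (All (λ l → ¬ (l ∣ k)) L)
  avoids? L k = All.all? (λ l → ¬? (l ∣? k)) L

  -- Legendre's count of the numbers 1, ..., n without a divisor in `L`.
  sifted : List ℕ → ℕ → ℤ
  sifted L n = ∑< n (λ k → ⟦ avoids? L (suc k) ⟧)

  avoids-* : ∀ {l L} → Prime l → All Prime L → All (l ≢_) L → ∀ k → ⟦ avoids? L (l ℕ.* k) ⟧ ≡ ⟦ avoids? L k ⟧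
  avoids-* {l} {L} l-prime primes l∉L k = ⟦⟧-cong
    (All.map (λ l′∤lk l′∣k → l′∤lk (∣n⇒∣m*n l l′∣k)))
    (λ avoid → All.zipWith (λ { ((pr , l≢l′) , l′∤k) l′∣lk → strip pr l≢l′ l′∤k (euclidsLemma l k pr l′∣lk) }) (All.zip (primes , l∉L) , avoid))
    (avoids? L (l ℕ.* k)) (avoids? L k)
    where
    strip : ∀ {l′} → Prime l′ → l ≢ l′ → ¬ (l′ ∣ k) → l′ ∣ l ⊎ l′ ∣ k → ⊥
    strip pr l≢l′ l′∤k (inj₁ l′∣l) = l≢l′ (sym (prime∣prime⇒≡ pr l-prime l′∣l))
    strip pr l≢l′ l′∤k (inj₂ l′∣k) = l′∤k l′∣k

  -- Legendre's recursion: among 1, ..., nl the multiples of l that avoid `L` are the lk with k ≤ n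
  -- avoiding `L`, because l is a prime different from those of `L`.
  sifted-∷ : ∀ {l L} → Prime l → All Prime L → All (l ≢_) L → ∀ n →
    sifted (l ∷ L) (n ℕ.* l) ≡ sifted L (n ℕ.* l) - sifted L n
  sifted-∷ {l} {L} l-prime primes l∉L n = begin
    ∑< (n ℕ.* l) (λ k → ⟦ avoids? (l ∷ L) (suc k) ⟧)
      ≡⟨ ∑<-cong (n ℕ.* l) (λ k → trans (⟦⟧-cong (λ { (x ∷ xs) → x , xs }) (λ { (x , xs) → x ∷ xs })
             (avoids? (l ∷ L) (suc k)) (¬? (l ∣? suc k) ×-dec avoids? L (suc k)))
           (trans (⟦⟧-× (¬? (l ∣? suc k)) (avoids? L (suc k)))
             (trans (cong (_* ⟦ avoids? L (suc k) ⟧) (⟦⟧-¬ (l ∣? suc k))) (r ⟦ l ∣? suc k ⟧ ⟦ avoids? L (suc k) ⟧)))) ⟩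
    ∑< (n ℕ.* l) (λ k → ⟦ avoids? L (suc k) ⟧ - ⟦ l ∣? suc k ⟧ * ⟦ avoids? L (suc k) ⟧)
      ≡⟨ ∑<-- (n ℕ.* l) (λ k → ⟦ avoids? L (suc k) ⟧) (λ k → ⟦ l ∣? suc k ⟧ * ⟦ avoids? L (suc k) ⟧) ⟩
    sifted L (n ℕ.* l) - ∑< (n ℕ.* l) (λ k → ⟦ l ∣? suc k ⟧ * ⟦ avoids? L (suc k) ⟧)
      ≡⟨ cong (λ t → sifted L (n ℕ.* l) - t) (∑<-multiples l n (λ k → ⟦ avoids? L k ⟧) {{prime⇒nonZero l-prime}}) ⟩
    sifted L (n ℕ.* l) - ∑< n (λ k → ⟦ avoids? L (l ℕ.* suc k) ⟧)
      ≡⟨ cong (λ t → sifted L (n ℕ.* l) - t) (∑<-cong n (λ k → avoids-* l-prime primes l∉L (suc k))) ⟩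
    sifted L (n ℕ.* l) - sifted L n ∎
    where
    open ≡-Reasoning
    r : ∀ i a → (1ℤ - i) * a ≡ a - i * a
    r = solve-∀

  -- Stated for every multiple n of the product, since the recursion calls it at both n and n/l.
  sifted-product : ∀ L → Unique L → All Prime L → ∀ n → product L ∣ n → + product L * sifted L n ≡ + n * totient L
  sifted-product [] _ _ n _ = trans (ℤP.*-identityˡ _) (trans (∑<-one n) (sym (ℤP.*-identityʳ (+ n))))
  sifted-product (l ∷ L) (l∉L ∷ uniq) (pr ∷ primes) n (divides k n≡k*lP) = begin
    + (l ℕ.* product L) * sifted (l ∷ L) n
      ≡⟨ cong₂ (λ s t → s * sifted (l ∷ L) t) (ℤP.pos-* l (product L)) n≡n′l ⟩
    (+ l * + product L) * sifted (l ∷ L) (n′ ℕ.* l)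
      ≡⟨ cong ((+ l * + product L) *_) (sifted-∷ pr primes l∉L n′) ⟩
    (+ l * + product L) * (sifted L (n′ ℕ.* l) - sifted L n′)
      ≡⟨ r (+ l) (+ product L) (sifted L (n′ ℕ.* l)) (sifted L n′) ⟩
    + l * (+ product L * sifted L (n′ ℕ.* l) - + product L * sifted L n′)
      ≡⟨ cong₂ (λ s t → + l * (s - t)) (trans (IH (n′ ℕ.* l) (∣-trans P∣n′ (m∣m*n l))) (cong (_* totient L) (ℤP.pos-* n′ l))) (IH n′ P∣n′) ⟩
    + l * ((+ n′ * + l) * totient L - + n′ * totient L)
      ≡⟨ s (+ l) (+ n′) (totient L) ⟩
    (+ n′ * + l) * ((+ l - 1ℤ) * totient L)
      ≡⟨ cong (_* totient (l ∷ L)) (trans (sym (ℤP.pos-* n′ l)) (cong +_ (sym n≡n′l))) ⟩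
    + n * totient (l ∷ L) ∎
    where
    open ≡-Reasoning
    n′ = k ℕ.* product L
    n≡n′l : n ≡ n′ ℕ.* l
    n≡n′l = trans n≡k*lP (trans (cong (k ℕ.*_) (ℕP.*-comm l (product L))) (sym (ℕP.*-assoc k (product L) l)))
    P∣n′ : product L ∣ n′
    P∣n′ = divides k refl
    IH = sifted-product L uniq primes
    r : ∀ l p a b → (l * p) * (a - b) ≡ l * (p * a - p * b)
    r = solve-∀
    s : ∀ l n t → l * ((n * l) * t - n * t) ≡ (n * l) * ((l - 1ℤ) * t)
    s = solve-∀

  length-filter-applyUpTo : ∀ {a p} {A : Set a} {P : Pred A p} (P? : Decidable P) (f : ℕ → A) n →
    + length (filter P? (applyUpTo f n)) ≡ ∑< n (λ k → ⟦ P? (f k) ⟧)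
  length-filter-applyUpTo P? f zero = refl
  length-filter-applyUpTo P? f (suc n) with P? (f 0)
  ... | yes _ = cong (λ t → 1ℤ + t) (length-filter-applyUpTo P? (f ∘ suc) n)
  ... | no  _ = trans (length-filter-applyUpTo P? (f ∘ suc) n) (sym (ℤP.+-identityˡ _))

  coprime⇔avoids : ∀ m → .{{_ : NonZero m}} → ∀ k → ⟦ coprime? (suc k) m ⟧ ≡ ⟦ avoids? (primesOf m) (suc k) ⟧
  coprime⇔avoids m k = ⟦⟧-cong
    (λ cop → All.map (λ { (pr , l∣m) l∣k → no-unit pr (cop (l∣k , l∣m)) }) (primesOf-sound m))
    (λ avoid {d} d∣ → coprime avoid d d∣)
    (coprime? (suc k) m) (avoids? (primesOf m) (suc k))
    where
    no-unit : ∀ {l} → Prime l → l ≢ 1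
    no-unit pr refl = ℕP.<-irrefl refl (ℕ.nonTrivial⇒n>1 1 {{prime⇒nonTrivial pr}})
    coprime : All (λ l → ¬ (l ∣ suc k)) (primesOf m) → ∀ d → d ∣ suc k × d ∣ m → d ≡ 1
    coprime avoid d (d∣k , d∣m) with d ℕ.≟ 1
    ... | yes d≡1 = d≡1
    coprime avoid zero (divides k′ e , _) | no _ with trans e (ℕP.*-zeroʳ k′)
    ... | ()
    coprime avoid d@(suc _) (d∣k , d∣m) | no d≢1 with prime-divisor d d≢1
    ... | p , pr , p∣d = ⊥-elim (All.lookup avoid (primesOf-complete m pr (∣-trans p∣d d∣m)) (∣-trans p∣d d∣k))

  -- The identity φ(m)/m = ∏ (1 - 1/l) over the primes l dividing m, cleared of denominators.
  φ-formula : ∀ m → .{{_ : NonZero m}} → + product (primesOf m) * + φ m ≡ + m * totient (primesOf m)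
  φ-formula m = begin
    + product L * + φ m
      ≡⟨ cong (λ xs → + product L * + length (filter (λ k → coprime? k m) xs)) (ListP.map-upTo suc m) ⟩
    + product L * + length (filter (λ k → coprime? k m) (applyUpTo suc m))
      ≡⟨ cong (+ product L *_) (trans (length-filter-applyUpTo (λ k → coprime? k m) suc m) (∑<-cong m (coprime⇔avoids m))) ⟩
    + product L * sifted L m
      ≡⟨ sifted-product L (primesOf-unique m) (All.map proj₁ (primesOf-sound m)) m (product∣ L (primesOf-unique m) (primesOf-sound m)) ⟩
    + m * totient L ∎
    where
    open ≡-Reasoning
    L = primesOf m

-- From a field with a setoid equality to its indices

module Transport {c ℓ} (F : FiniteField c ℓ) where
  private module F = FiniteField F
  open F using (enum; Carrier; _≈_; 0#; 1#; pow; pow-cong)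
  open import Relation.Binary.Reasoning.Setoid F.setoid

  N : ℕ
  N = F.size

  index : Carrier → Fin N
  index x = proj₁ (F.enum-surj x)

  enum-index : ∀ x → enum (index x) ≈ x
  enum-index x = proj₂ (F.enum-surj x)

  enum-injective : ∀ {i j} → enum i ≈ enum j → i ≡ j
  enum-injective {i} {j} = F.enum-inj i j

  enum-cong : ∀ {i j} → i ≡ j → enum i ≈ enum j
  enum-cong refl = F.refl

  index-≡ : ∀ {i x} → enum i ≈ x → i ≡ index x
  index-≡ {i} {x} e = enum-injective (F.trans e (F.sym (enum-index x)))

  private
    _⊕_ _⊗_ : Fin N → Fin N → Fin N
    i ⊕ j = index (enum i F.+ enum j)
    i ⊗ j = index (enum i F.* enum j)

    ⊝_ inv : Fin N → Fin N
    ⊝ i = index (F.- enum i)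
    inv i with enum i F.≟ 0#
    ... | yes _ = index 0#
    ... | no ne = index (proj₁ (F.inverse (enum i) ne))

    enum-⊕ : ∀ i j → enum (i ⊕ j) ≈ enum i F.+ enum j
    enum-⊕ i j = enum-index _

    enum-⊗ : ∀ i j → enum (i ⊗ j) ≈ enum i F.* enum j
    enum-⊗ i j = enum-index _

    ⊕-assoc : ∀ i j k → (i ⊕ j) ⊕ k ≡ i ⊕ (j ⊕ k)
    ⊕-assoc i j k = enum-injective (begin
      enum ((i ⊕ j) ⊕ k)               ≈⟨ F.trans (enum-⊕ (i ⊕ j) k) (F.+-congʳ (enum-⊕ i j)) ⟩
      (enum i F.+ enum j) F.+ enum k   ≈⟨ F.+-assoc (enum i) (enum j) (enum k) ⟩
      enum i F.+ (enum j F.+ enum k)   ≈⟨ F.trans (enum-⊕ i (j ⊕ k)) (F.+-congˡ (enum-⊕ j k)) ⟨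
      enum (i ⊕ (j ⊕ k))               ∎)

    ⊗-assoc : ∀ i j k → (i ⊗ j) ⊗ k ≡ i ⊗ (j ⊗ k)
    ⊗-assoc i j k = enum-injective (begin
      enum ((i ⊗ j) ⊗ k)               ≈⟨ F.trans (enum-⊗ (i ⊗ j) k) (F.*-congʳ (enum-⊗ i j)) ⟩
      (enum i F.* enum j) F.* enum k   ≈⟨ F.*-assoc (enum i) (enum j) (enum k) ⟩
      enum i F.* (enum j F.* enum k)   ≈⟨ F.trans (enum-⊗ i (j ⊗ k)) (F.*-congˡ (enum-⊗ j k)) ⟨
      enum (i ⊗ (j ⊗ k))               ∎)

    ⊕-comm : ∀ i j → i ⊕ j ≡ j ⊕ i
    ⊕-comm i j = enum-injective (F.trans (enum-⊕ i j) (F.trans (F.+-comm _ _) (F.sym (enum-⊕ j i))))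

    ⊗-comm : ∀ i j → i ⊗ j ≡ j ⊗ i
    ⊗-comm i j = enum-injective (F.trans (enum-⊗ i j) (F.trans (F.*-comm _ _) (F.sym (enum-⊗ j i))))

    ⊕-identityˡ : ∀ i → index 0# ⊕ i ≡ i
    ⊕-identityˡ i = enum-injective (F.trans (enum-⊕ (index 0#) i) (F.trans (F.+-congʳ (enum-index 0#)) (F.+-identityˡ _)))

    ⊗-identityˡ : ∀ i → index 1# ⊗ i ≡ i
    ⊗-identityˡ i = enum-injective (F.trans (enum-⊗ (index 1#) i) (F.trans (F.*-congʳ (enum-index 1#)) (F.*-identityˡ _)))

    ⊝-inverseˡ : ∀ i → (⊝ i) ⊕ i ≡ index 0#
    ⊝-inverseˡ i = index-≡ (F.trans (enum-⊕ (⊝ i) i) (F.trans (F.+-congʳ (enum-index _)) (F.-‿inverseˡ _)))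

    ⊗-distribˡ-⊕ : ∀ i j k → i ⊗ (j ⊕ k) ≡ (i ⊗ j) ⊕ (i ⊗ k)
    ⊗-distribˡ-⊕ i j k = enum-injective (begin
      enum (i ⊗ (j ⊕ k))                             ≈⟨ F.trans (enum-⊗ i (j ⊕ k)) (F.*-congˡ (enum-⊕ j k)) ⟩
      enum i F.* (enum j F.+ enum k)                 ≈⟨ F.distribˡ (enum i) (enum j) (enum k) ⟩
      enum i F.* enum j F.+ enum i F.* enum k        ≈⟨ F.trans (enum-⊕ (i ⊗ j) (i ⊗ k)) (F.+-cong (enum-⊗ i j) (enum-⊗ i k)) ⟨
      enum ((i ⊗ j) ⊕ (i ⊗ k))                       ∎)

    ⊕⊗-isCommutativeRing : IsCommutativeRing _≡_ _⊕_ _⊗_ ⊝_ (index 0#) (index 1#)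
    ⊕⊗-isCommutativeRing = record
      { isRing = record
        { +-isAbelianGroup = record
          { isGroup = record
            { isMonoid = record
              { isSemigroup = record
                { isMagma = record { isEquivalence = isEquivalence ; ∙-cong = cong₂ _⊕_ }
                ; assoc = ⊕-assoc }
              ; identity = ⊕-identityˡ , λ i → trans (⊕-comm i (index 0#)) (⊕-identityˡ i) }
            ; inverse = ⊝-inverseˡ , λ i → trans (⊕-comm i (⊝ i)) (⊝-inverseˡ i)
            ; ⁻¹-cong = cong ⊝_ }
          ; comm = ⊕-comm }
        ; *-cong = cong₂ _⊗_
        ; *-assoc = ⊗-assoc
        ; *-identity = ⊗-identityˡ , λ i → trans (⊗-comm i (index 1#)) (⊗-identityˡ i)
        ; distrib = ⊗-distribˡ-⊕ , λ i j k → trans (⊗-comm (j ⊕ k) i)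
            (trans (⊗-distribˡ-⊕ i j k) (cong₂ _⊕_ (⊗-comm i j) (⊗-comm i k))) }
      ; *-comm = ⊗-comm }

    inv-zero : inv (index 0#) ≡ index 0#
    inv-zero with enum (index 0#) F.≟ 0#
    ... | yes _ = refl
    ... | no ne = ⊥-elim (ne (enum-index 0#))

    ⊗-inverseʳ : ∀ i → i ≢ index 0# → i ⊗ inv i ≡ index 1#
    ⊗-inverseʳ i i≢0 with enum i F.≟ 0#
    ... | yes e = ⊥-elim (i≢0 (index-≡ e))
    ... | no ne = index-≡ (F.trans (enum-⊗ i _) (F.trans (F.*-congˡ (enum-index _)) (proj₂ (F.inverse (enum i) ne))))

  field-on-indices : FinField N
  field-on-indices = record
    { _⊕_ = _⊕_ ; _⊗_ = _⊗_ ; ⊝_ = ⊝_ ; inv = inv ; 𝟎 = index 0# ; 𝟏 = index 1#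
    ; isCommutativeRing = ⊕⊗-isCommutativeRing
    ; 𝟎≢𝟏 = λ e → F.0≉1 (F.trans (F.sym (enum-index 0#)) (F.trans (enum-cong e) (enum-index 1#)))
    ; inv-𝟎 = inv-zero
    ; ⊗-inv = ⊗-inverseʳ }

  open FieldArithmetic field-on-indices using (_↑_; 𝟎)

  enum-square : ∀ i → enum (i ⊗ i) ≈ enum i F.* enum i
  enum-square i = enum-⊗ i i

  enum-↑ : ∀ i k → enum (i ↑ k) ≈ pow (enum i) k
  enum-↑ i zero    = enum-index 1#
  enum-↑ i (suc k) = F.trans (enum-⊗ i (i ↑ k)) (F.*-congˡ (enum-↑ i k))

  enum-unit : ∀ {i} → i ≢ 𝟎 → ¬ (enum i ≈ 0#)
  enum-unit i≢0 e = i≢0 (index-≡ e)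

  enum-unit⁻¹ : ∀ {i} → ¬ (enum i ≈ 0#) → i ≢ 𝟎
  enum-unit⁻¹ ne refl = ne (enum-index 0#)

  module _ (p k n : ℕ) (p-prime : Prime p) (1≤k : 1 ℕ.≤ k) (N≡ : N ≡ (p ℕ.^ k) ℕ.^ suc n) where
    open FieldTrace field-on-indices p k n p-prime 1≤k N≡ using (q; partialTrace)

    enum-trace : ∀ i x → enum (partialTrace i x) ≈ F.Tr q i (enum x)
    enum-trace zero    x = enum-index 0#
    enum-trace (suc i) x = F.trans (enum-⊕ (partialTrace i x) (x ↑ (q ℕ.^ i))) (F.+-cong (enum-trace i x) (enum-↑ x (q ℕ.^ i)))

    Tr-cong : ∀ i {x y} → x ≈ y → F.Tr q i x ≈ F.Tr q i y
    Tr-cong zero    e = F.refl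
    Tr-cong (suc i) e = F.+-cong (Tr-cong i e) (pow-cong (q ℕ.^ i) e)

-- Freeness as a sieve condition, and the final inequality

module MainBound {c ℓ} (F : FiniteField c ℓ) (p k n : ℕ) (p-prime : Prime p) (1≤k : 1 ℕ.≤ k)
    (size≡ : FiniteField.size F ≡ (p ℕ.^ k) ℕ.^ suc n)
    (β : FiniteField.Carrier F) (β∈ : FiniteField.InSubfield F (p ℕ.^ k) β)
    (β≉0 : ¬ (FiniteField._≈_ F β (FiniteField.0# F)))
    (m : ℕ) .{{m≢0 : NonZero m}} (2∣m : 2 ∣ m) (m∣ : m ∣ (p ℕ.^ k) ℕ.^ suc n ℕ.∸ 1) where
  private module F = FiniteField F
  open F using (enum)
  open import Data.Integer using (_+_; _*_; _-_; -_; _≤_; _<_)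
  open IntegerInequalities
  open Indicators
  open PrimeDivisors
  open Totient
  open TotientFormula
  open Transport F
  open FieldArithmetic field-on-indices using (_↑_; 𝟎; _⊗_; _≟_; ^-assocʳ; 𝟎↑; ⊗-nonzeroˡ)
  open FieldSums N
  open FieldTrace field-on-indices p k n p-prime 1≤k size≡ using (q; A; 1<q; τ; traceForm; Scalar)

  M : ℕ
  M = q ℕ.^ suc n ℕ.∸ 1

  private
    1<q^ : 1 ℕ.< q ℕ.^ suc n
    1<q^ = ℕP.<-≤-trans 1<q (ℕP.m≤m*n q A {{ℕP.m^n≢0 q n {{ℕ.>-nonZero (ℕP.<-trans (ℕ.s≤s ℕ.z≤n) 1<q)}}}})

    N≡1+M : N ≡ suc M
    N≡1+M = trans size≡ (sym (ℕP.m+[n∸m]≡n (ℕP.<⇒≤ 1<q^)))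

    0<M : 0 ℕ.< M
    0<M = ℕP.m<n⇒0<n∸m 1<q^

    β-scalar : Scalar (index β)
    β-scalar = index-≡ (F.trans (enum-↑ (index β) q) (F.trans (F.pow-cong q (enum-index β)) β∈))

    β≢0 : index β ≢ 𝟎
    β≢0 e = β≉0 (F.trans (F.sym (enum-index β)) (F.trans (enum-cong e) (enum-index F.0#)))

  open PowerKernels field-on-indices N≡1+M 0<M using (IsPower)
  open CharacterExpansion field-on-indices N≡1+M 0<M traceForm 1<q (index β) β-scalar β≢0 (∣-trans 2∣m m∣)

  L : List ℕ
  L = primesOf m

  free⇒nonPowers : ∀ u → F.IsFree m (enum u) → All (λ l → ¬ IsPower l u) L
  free⇒nonPowers u free = All.map (λ { {l} (pr , l∣m) (z , z≢0 , e) →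
    ℕP.<-irrefl (sym (free l (enum z) l∣m (enum-unit z≢0) (F.trans (enum-cong (sym e)) (enum-↑ z l))))
      (ℕ.nonTrivial⇒n>1 l {{prime⇒nonTrivial pr}}) }) (primesOf-sound m)

  -- If d ≠ 1 divides m, then d = jl with a prime l dividing m, and ζ^d is the l-th power of ζ^j; so
  -- prime exponents suffice.
  nonPowers⇒free : ∀ u → All (λ l → ¬ IsPower l u) L → F.IsFree m (enum u)
  nonPowers⇒free u avoid d ζ d∣m ζ≉0 u≈ζ^d with d ℕ.≟ 1
  ... | yes d≡1 = d≡1
  ... | no  d≢1 with prime-divisor d {{d≢0}} d≢1
    where
    d≢0 : NonZero d
    d≢0 = ℕ.≢-nonZero λ { refl → ℕ.≢-nonZero⁻¹ m (0∣⇒≡0 d∣m) }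
  ... | l , pr , divides j refl = ⊥-elim (All.lookup avoid (primesOf-complete m pr (∣-trans (n∣m*n j) d∣m))
    (w ↑ j , w^j≢0 , sym (enum-injective (F.trans u≈ζ^d (F.trans (F.pow-cong (j ℕ.* l) (F.sym (enum-index ζ)))
      (F.trans (F.sym (enum-↑ w (j ℕ.* l))) (enum-cong (sym (^-assocʳ w j l)))))))))
    where
    w = index ζ
    w≢0 : w ≢ 𝟎
    w≢0 = enum-unit⁻¹ (λ e → ζ≉0 (F.trans (F.sym (enum-index ζ)) e))
    w^j≢0 : w ↑ j ≢ 𝟎
    w^j≢0 = FieldArithmetic.↑-nonzero field-on-indices j w≢0

  Nβ≡#nonPowers : + F.Nβ q (suc n) β m ≡ #nonPowers L
  Nβ≡#nonPowers = trans
    (Sums.length-filter-tabulate (λ i → ¬? (enum i F.≟ F.0#) ×-dec F.isFree? m (enum i) ×-dec (F.Tr q (suc n) (enum i F.* enum i) F.≟ β)) id)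
    (∑-cong (λ u → trans
      (⟦⟧-cong
        (λ { (_ , free , tr≈β) → index-≡ (F.trans (trace u) tr≈β) , free⇒nonPowers u free })
        (λ { (τ≡β , avoid) → enum-unit (⊗-nonzeroˡ (hit-unit (u ⊗ u) τ≡β)) , nonPowers⇒free u avoid ,
               F.trans (F.sym (trace u)) (F.trans (enum-cong τ≡β) (enum-index β)) })
        (¬? (enum u F.≟ F.0#) ×-dec F.isFree? m (enum u) ×-dec (F.Tr q (suc n) (enum u F.* enum u) F.≟ β))
        ((τ (u ⊗ u) ≟ index β) ×-dec nonPowers? L u))
      (⟦⟧-× (τ (u ⊗ u) ≟ index β) (nonPowers? L u))))
    where
    trace : ∀ u → enum (τ (u ⊗ u)) F.≈ F.Tr q (suc n) (enum u F.* enum u)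
    trace u = F.trans (enum-trace p k n p-prime 1≤k size≡ (suc n) (u ⊗ u))
      (Tr-cong p k n p-prime 1≤k size≡ (suc n) (enum-square u))

  private
    ΠL = + product L
    Nm = + F.Nβ q (suc n) β m

    0<ΠL : 0ℤ < ΠL
    0<ΠL = ℤ.+<+ (ℕP.n≢0⇒n>0 λ e → ℕ.≢-nonZero⁻¹ m
      (0∣⇒≡0 (subst (_∣ m) e (product∣ L (primesOf-unique m) (primesOf-sound m)))))

    0≤bound-1 : 0ℤ ≤ bound L - 1ℤ
    0≤bound-1 = ℤP.i≤j⇒0≤j-i (ℤP.≤-trans (ℤ.+≤+ (ℕP.≤-trans (ℕP.m^n>0 2 (length L)) (ℕP.m≤m+n _ _)))
      (ℤP.≤-reflexive (ℤP.pos-* 2 (2 ℕ.^ length L))))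

  -- The sieve estimate is scaled by m and divided by the product of the primes of m; `φ-formula`
  -- then turns m `totient L` into that product times φ(m).
  normalised : + m * Nm - + φ m * + A ∣≤ (bound L - 1ℤ) * + φ m √ + A
  normalised = √-cancel ΠL 0<ΠL (*-nonneg 0≤bound-1 (ℤ.+≤+ ℕ.z≤n)) (subst₂ (λ a b → a ∣≤ b √ + A) lhs rhs
    (√-* (+ m) (ℤ.+≤+ ℕ.z≤n) (nonPower-count L (primesOf-unique m)
      (All.map (λ { (pr , l∣m) → pr , ∣-trans l∣m m∣ }) (primesOf-sound m)))))
    where
    open ≡-Reasoning
    r₁ : ∀ m P x t A → m * (P * x - t * A) ≡ P * (m * x) - (m * t) * A
    r₁ = solve-∀
    r₂ : ∀ P x f A → P * x - (P * f) * A ≡ P * (x - f * A)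
    r₂ = solve-∀
    r₃ : ∀ m b t → m * (b * t) ≡ b * (m * t)
    r₃ = solve-∀
    r₄ : ∀ P b f → b * (P * f) ≡ P * (b * f)
    r₄ = solve-∀
    lhs : + m * (ΠL * #nonPowers L - totient L * + A) ≡ ΠL * (+ m * Nm - + φ m * + A)
    lhs = begin
      + m * (ΠL * #nonPowers L - totient L * + A)     ≡⟨ r₁ (+ m) ΠL (#nonPowers L) (totient L) (+ A) ⟩
      ΠL * (+ m * #nonPowers L) - (+ m * totient L) * + A
        ≡⟨ cong₂ (λ x t → ΠL * (+ m * x) - t * + A) (sym Nβ≡#nonPowers) (sym (φ-formula m)) ⟩
      ΠL * (+ m * Nm) - (ΠL * + φ m) * + A            ≡⟨ r₂ ΠL (+ m * Nm) (+ φ m) (+ A) ⟩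
      ΠL * (+ m * Nm - + φ m * + A)                   ∎
    rhs : + m * ((bound L - 1ℤ) * totient L) ≡ ΠL * ((bound L - 1ℤ) * + φ m)
    rhs = trans (r₃ (+ m) (bound L - 1ℤ) (totient L))
      (trans (cong ((bound L - 1ℤ) *_) (sym (φ-formula m))) (r₄ ΠL (bound L - 1ℤ) (+ φ m)))

  module _ (Q : ℕ) where
    w w′ : ℤ
    w  = + W m
    w′ = + W (radicalPart m Q)

    -- Only W(m_Q) ≤ W(m) is used: the sieve gives the sharper 2 W(m) - 1.
    bound≤ : (bound L - 1ℤ) * + φ m ≤ (+ 4 * w - + 2 * w′ - 1ℤ) * + φ m
    bound≤ = ℤP.*-monoʳ-≤-nonNeg (+ φ m) (ℤP.+-monoˡ-≤ (- 1ℤ) (begin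
      + 2 * + (2 ℕ.^ length L)            ≤⟨ *-monoˡ-≤ (+ 2) (ℤ.+≤+ ℕ.z≤n) (ℤ.+≤+ (2^#primes≤W m)) ⟩
      + 2 * w                             ≡⟨ ℤP.+-identityʳ (+ 2 * w) ⟨
      + 2 * w + 0ℤ                        ≤⟨ ℤP.+-monoʳ-≤ (+ 2 * w) (*-nonneg {+ 2} (ℤ.+≤+ ℕ.z≤n) (ℤP.i≤j⇒0≤j-i (ℤ.+≤+ (W-mono (radicalPart∣ m Q))))) ⟩
      + 2 * w + + 2 * (w - w′)            ≡⟨ r w w′ ⟩
      + 4 * w - + 2 * w′                  ∎))
      where
      open ℤP.≤-Reasoning
      r : ∀ w v → + 2 * w + + 2 * (w - v) ≡ + 4 * w - + 2 * v
      r = solve-∀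

    two-sided : + m * Nm - + φ m * + A ∣≤ (+ 4 * w - + 2 * w′ - 1ℤ) * + φ m √ + A
    two-sided = √-mono (ℤ.+≤+ ℕ.z≤n) bound≤ normalised

    main : ((+ φ m) * (1ℤ - + (4 ℕ.* W m) + + (2 ℕ.* W (radicalPart m Q))))
           *√ (q ℕ.^ n) ≤ (+ (m ℕ.* F.Nβ q (suc n) β m) - + (φ m ℕ.* q ℕ.^ n))
    -- The coefficient b is minus the scale of `two-sided`, hence b ≤ 0. In that case a² ≤ b² r
    -- already implies b√r ≤ a, whatever the sign of a.
    main = inj₁ (b≤0 , inj₂ (subst₂ (λ x y → x * x ≤ y * + A) (sym a≡) b²≡ (_∣≤_√_.sq≤ two-sided)))
      where
      B = (+ 4 * w - + 2 * w′ - 1ℤ) * + φ m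
      r : ∀ f w v → f * (1ℤ - + 4 * w + + 2 * v) ≡ - ((+ 4 * w - + 2 * v - 1ℤ) * f)
      r = solve-∀
      s : ∀ b → b * b ≡ - b * - b
      s = solve-∀
      b = (+ φ m) * (1ℤ - + (4 ℕ.* W m) + + (2 ℕ.* W (radicalPart m Q)))
      b≡ : b ≡ - B
      b≡ = trans (cong₂ (λ x y → + φ m * (1ℤ - x + y)) (ℤP.pos-* 4 (W m)) (ℤP.pos-* 2 (W (radicalPart m Q)))) (r (+ φ m) w w′)
      b≤0 : b ≤ 0ℤ
      b≤0 = subst (_≤ 0ℤ) (sym b≡) (ℤP.neg-mono-≤ (_∣≤_√_.0≤scale two-sided))
      b²≡ : B * B ≡ b * b
      b²≡ = trans (s B) (sym (cong₂ _*_ b≡ b≡))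
      a≡ : + (m ℕ.* F.Nβ q (suc n) β m) - + (φ m ℕ.* q ℕ.^ n) ≡ + m * Nm - + φ m * + A
      a≡ = cong₂ _-_ (ℤP.pos-* m (F.Nβ q (suc n) β m)) (ℤP.pos-* (φ m) (q ℕ.^ n))

open import Data.Nat using (_+_; _*_; _∸_; _^_; _≤_; _/_)

theorem5p5 : ∀ {c ℓ} (q n : ℕ) →
    (∃₂ λ p k → Prime p × ¬ (2 ∣ p) × 1 ≤ k × q ≡ p ^ k) →
    2 ≤ n →
    2 ∣ ((q ^ n ∸ 1) / 2) →
    (F : FiniteField c ℓ) → FiniteField.size F ≡ q ^ n →
    (β : FiniteField.Carrier F) → FiniteField.InSubfield F q β →
    ¬ (FiniteField._≈_ F β (FiniteField.0# F)) →
    (m : ℕ) .{{_ : NonZero m}} → 2 ∣ m → m ∣ q ^ n ∸ 1 →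
    (Q : ℕ) → Q * (q ∸ 1) ≡ q ^ n ∸ 1 →
    ((+ φ m) ℤ.* (+ 1 ℤ.- + (4 * W m) ℤ.+ + (2 * W (radicalPart m Q))))
    *√ (q ^ (n ∸ 1))
    ≤ (+ (m * FiniteField.Nβ F q n β m) ℤ.- + (φ m * q ^ (n ∸ 1)))
-- With the degree of the extension written as `suc n`, the power `q ^ (suc n ∸ 1)` reduces to the
-- size A of a fibre of the trace.
theorem5p5 q (suc n) (p , k , p-prime , _ , 1≤k , refl) _ _ F size≡ β β∈ β≉0 m 2∣m m∣ Q _ =
  MainBound.main F p k n p-prime 1≤k size≡ β β∈ β≉0 m 2∣m m∣ Q
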